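{- Let $p$ and $q$ be distinct odd primes and let $E_{p,q}$ be the elliptic curve $y^2=x^3-pqx$. Suppose that any one of the following conditions holds: (i) $p\equiv 1 \pmod 4$, $q\equiv 1\pmod 4$, $pq\equiv 13\pmod{16}$ and $\left(\frac{p}{q}\right)=-1$; (ii) $p\not\equiv q\pmod 4$, $pq\equiv 3\pmod 8$ and $\left(\frac{p}{q}\right)=-1$; (iii) $p\equiv q\equiv 3\pmod 4$, $\left(\frac{p}{q}\right)=1$, $q\equiv 3\pmod 8$, and $p-q\equiv 8$ or $12\pmod{16}$; (iv) $p\equiv q\equiv 3\pmod 4$, $\left(\frac{p}{q}\right)=-1$, $p\equiv 3\pmod 8$, and $q-p\equiv 8$ or $12\pmod{16}$. Then the rank of $E_{p,q}(\mathbb{Q}(i))$ is $0$.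
   Context: $\left(\frac{\cdot}{\cdot}\right)$ is the Legendre symbol, and $\mathbb{Q}(i)$ is the field obtained by adjoining $i=\sqrt{ -1}$ to $\mathbb{Q}$. -}

module Defs where

open import Level using (0ℓ; _⊔_)
open import Algebra.Bundles using (CommutativeRing; RawGroup)
open import Algebra.Structures using (IsCommutativeRing)
import Algebra.Definitions.RawMonoid as RawMonoidOps
import Algebra.Solver.Ring.AlmostCommutativeRing as ACR
import Algebra.Solver.Ring.Simple as RingSolver
open import Data.Fin.Base using (Fin; toℕ)
import Data.Fin.Properties as Fin
open import Data.Integer.Base as ℤ using (ℤ; +_; -[1+_])
import Data.Integer.Divisibility as ℤ
open import Data.Nat.Base as ℕ using (ℕ; zero; suc)
import Data.Nat.Divisibility as ℕ
open import Data.Product.Base using (∃; _×_; _,_)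
open import Data.Rational.Base as ℚ using (ℚ; 0ℚ; 1ℚ)
import Data.Rational.Properties as ℚ
import Data.Rational.Solver as ℚSolver
open import Data.Sum.Base using (inj₁; inj₂)
open import Relation.Binary.Definitions using (DecidableEquality; tri<; tri≈; tri>)
open import Relation.Binary.PropositionalEquality
open import Relation.Nullary using (Dec; yes; no; contradiction)
open import Relation.Nullary.Decidable using (map′; _×-dec_)

------------------------------------------------------------------------
-- Congruences and the Legendre symbol

infix 4 _≅_[mod_] _≅?_[mod_]

_≅_[mod_] : ℤ → ℤ → ℕ → Set
a ≅ b [mod m ] = + m ℤ.∣ a ℤ.- b

_≅?_[mod_] : ∀ a b m → Dec (a ≅ b [mod m ])
a ≅? b [mod m ] = m ℕ.∣? ℤ.∣ a ℤ.- b ∣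

-- (a / p).  Only meaningful when p is an odd prime.
legendre : ℤ → ℕ → ℤ
legendre a p with a ≅? + 0 [mod p ]
... | yes _ = + 0
... | no  _ with Fin.any? {n = p} (λ x → + (toℕ x ℕ.* toℕ x) ≅? a [mod p ])
...   | yes _ = + 1
...   | no  _ = -[1+ 0 ]

------------------------------------------------------------------------
-- Rank

-- The rank of an abelian group, as the maximal number of ℤ-linearly
-- independent elements.  The definition uses only the operations, so it
-- is given for raw groups; it is intended for operations that form an
-- abelian group.
module _ {c ℓ} (G : RawGroup c ℓ) where
  open RawGroup G
  open RawMonoidOps rawMonoid using (sum) renaming (_×_ to _×ℕ_)

  infixr 8 _·_

  _·_ : ℤ → Carrier → Carrier
  (+ n)    · x = n ×ℕ x
  -[1+ n ] · x = (suc n ×ℕ x) ⁻¹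

  Independent : ∀ {r} → (Fin r → Carrier) → Set ℓ
  Independent {r} v =
    ∀ (k : Fin r → ℤ) → sum (λ i → k i · v i) ≈ ε → ∀ i → k i ≡ + 0

  Dependent : ∀ {r} → (Fin r → Carrier) → Set ℓ
  Dependent {r} v =
    ∃ λ (k : Fin r → ℤ) → (∃ λ i → k i ≢ + 0) × sum (λ i → k i · v i) ≈ ε

  HasRank : ℕ → Set (c ⊔ ℓ)
  HasRank r = (∃ λ (v : Fin r → Carrier) → Independent v)
            × (∀ (v : Fin (suc r) → Carrier) → Dependent v)

------------------------------------------------------------------------
-- The field ℚ(i)

infix 5 _+i_

-- x +i y is x + iy.
record ℚ[i] : Set where
  no-eta-equality; pattern
  constructor _+i_
  field
    re im : ℚ

open ℚ[i] public

infixl 6 _+_ _-_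
infixl 7 _*_
infix  8 -_

0# 1# : ℚ[i]
0# = 0ℚ +i 0ℚ
1# = 1ℚ +i 0ℚ

-_ : ℚ[i] → ℚ[i]
- (a +i b) = (ℚ.- a) +i (ℚ.- b)

_+_ _*_ _-_ : ℚ[i] → ℚ[i] → ℚ[i]
(a +i b) + (c +i d) = (a ℚ.+ c) +i (b ℚ.+ d)
(a +i b) * (c +i d) = (a ℚ.* c ℚ.- b ℚ.* d) +i (a ℚ.* d ℚ.+ b ℚ.* c)

z - w = z + (- w)

fromℤ : ℤ → ℚ[i]
fromℤ n = (n ℚ./ 1) +i 0ℚ

infix 4 _≟_

_≟_ : DecidableEquality ℚ[i]
(a +i b) ≟ (c +i d) =
  map′ (λ { (refl , refl) → refl }) (λ { refl → refl , refl })
       (a ℚ.≟ c ×-dec b ℚ.≟ d)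

private
  module RingLaws where
    open ℚSolver.+-*-Solver

    +-assoc : ∀ x y z → (x + y) + z ≡ x + (y + z)
    +-assoc (a +i b) (c +i d) (e +i f) =
      cong₂ _+i_ (ℚ.+-assoc a c e) (ℚ.+-assoc b d f)

    +-comm : ∀ x y → x + y ≡ y + x
    +-comm (a +i b) (c +i d) = cong₂ _+i_ (ℚ.+-comm a c) (ℚ.+-comm b d)

    +-identityˡ : ∀ x → 0# + x ≡ x
    +-identityˡ (a +i b) = cong₂ _+i_ (ℚ.+-identityˡ a) (ℚ.+-identityˡ b)

    -‿inverseˡ : ∀ x → (- x) + x ≡ 0#
    -‿inverseˡ (a +i b) = cong₂ _+i_ (ℚ.+-inverseˡ a) (ℚ.+-inverseˡ b)

    *-assoc : ∀ x y z → (x * y) * z ≡ x * (y * z)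
    *-assoc (a +i b) (c +i d) (e +i f) = cong₂ _+i_
      (solve 6 (λ a b c d e f →
        (a :* c :- b :* d) :* e :- (a :* d :+ b :* c) :* f :=
        a :* (c :* e :- d :* f) :- b :* (c :* f :+ d :* e)) refl a b c d e f)
      (solve 6 (λ a b c d e f →
        (a :* c :- b :* d) :* f :+ (a :* d :+ b :* c) :* e :=
        a :* (c :* f :+ d :* e) :+ b :* (c :* e :- d :* f)) refl a b c d e f)

    *-comm : ∀ x y → x * y ≡ y * x
    *-comm (a +i b) (c +i d) = cong₂ _+i_
      (solve 4 (λ a b c d → a :* c :- b :* d := c :* a :- d :* b) refl a b c d)
      (solve 4 (λ a b c d → a :* d :+ b :* c := c :* b :+ d :* a) refl a b c d)

    *-identityˡ : ∀ x → 1# * x ≡ x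
    *-identityˡ (a +i b) = cong₂ _+i_
      (solve 2 (λ a b → con 1ℚ :* a :- con 0ℚ :* b := a) refl a b)
      (solve 2 (λ a b → con 1ℚ :* b :+ con 0ℚ :* a := b) refl a b)

    distribˡ : ∀ x y z → x * (y + z) ≡ x * y + x * z
    distribˡ (a +i b) (c +i d) (e +i f) = cong₂ _+i_
      (solve 6 (λ a b c d e f →
        a :* (c :+ e) :- b :* (d :+ f) :=
        (a :* c :- b :* d) :+ (a :* e :- b :* f)) refl a b c d e f)
      (solve 6 (λ a b c d e f →
        a :* (d :+ f) :+ b :* (c :+ e) :=
        (a :* d :+ b :* c) :+ (a :* f :+ b :* e)) refl a b c d e f)

ℚ[i]-isCommutativeRing : IsCommutativeRing _≡_ _+_ _*_ -_ 0# 1#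
ℚ[i]-isCommutativeRing = record
  { isRing = record
    { +-isAbelianGroup = record
      { isGroup = record
        { isMonoid = record
          { isSemigroup = record
            { isMagma = isMagma _+_
            ; assoc   = +-assoc
            }
          ; identity = +-identityˡ , λ x → trans (+-comm x 0#) (+-identityˡ x)
          }
        ; inverse = -‿inverseˡ , λ x → trans (+-comm x (- x)) (-‿inverseˡ x)
        ; ⁻¹-cong = cong (λ x → - x)
        }
      ; comm = +-comm
      }
    ; *-cong     = cong₂ _*_
    ; *-assoc    = *-assoc
    ; *-identity = *-identityˡ , λ x → trans (*-comm x 1#) (*-identityˡ x)
    ; distrib    = distribˡ , λ x y z →
        trans (*-comm (y + z) x)
          (trans (distribˡ x y z) (cong₂ _+_ (*-comm x y) (*-comm x z)))
    }
  ; *-comm = *-comm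
  }
  where open RingLaws

ℚ[i]-commutativeRing : CommutativeRing 0ℓ 0ℓ
ℚ[i]-commutativeRing = record { isCommutativeRing = ℚ[i]-isCommutativeRing }

module ℚ[i]-Solver =
  RingSolver (ACR.fromCommutativeRing ℚ[i]-commutativeRing) _≟_

norm : ℚ[i] → ℚ
norm (a +i b) = a ℚ.* a ℚ.+ b ℚ.* b

private
  sq-pos : ∀ a → a ≢ 0ℚ → 0ℚ ℚ.< a ℚ.* a
  sq-pos a a≢0 with ℚ.<-cmp a 0ℚ
  ... | tri< a<0 _ _ = subst (ℚ._< a ℚ.* a) (ℚ.*-zeroˡ a)
                         (ℚ.*-monoˡ-<-neg a {{ℚ.negative a<0}} a<0)
  ... | tri≈ _ a≡0 _ = contradiction a≡0 a≢0
  ... | tri> _ _ a>0 = subst (ℚ._< a ℚ.* a) (ℚ.*-zeroˡ a)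
                         (ℚ.*-monoˡ-<-pos a {{ℚ.positive a>0}} a>0)

  sq-nonneg : ∀ a → 0ℚ ℚ.≤ a ℚ.* a
  sq-nonneg a with a ℚ.≟ 0ℚ
  ... | yes refl = ℚ.≤-refl
  ... | no  a≢0  = ℚ.<⇒≤ (sq-pos a a≢0)

norm-nonZero : ∀ {z} → z ≢ 0# → ℚ.NonZero (norm z)
norm-nonZero {a +i b} z≢0 with a ℚ.≟ 0ℚ | b ℚ.≟ 0ℚ
... | yes refl | yes refl = contradiction refl z≢0
... | no a≢0 | _ = ℚ.≢-nonZero λ eq →
  ℚ.<⇒≢ (ℚ.+-mono-<-≤ (sq-pos a a≢0) (sq-nonneg b)) (sym eq)
... | yes _ | no b≢0 = ℚ.≢-nonZero λ eq →
  ℚ.<⇒≢ (ℚ.+-mono-≤-< (sq-nonneg a) (sq-pos b b≢0)) (sym eq)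

inv : (z : ℚ[i]) → .(z ≢ 0#) → ℚ[i]
inv z@(a +i b) z≢0 = (a ℚ.* n⁻¹) +i ((ℚ.- b) ℚ.* n⁻¹)
  where n⁻¹ = ℚ.1/_ (norm z) {{norm-nonZero z≢0}}

*-inverseʳ : ∀ z .(z≢0 : z ≢ 0#) → z * inv z z≢0 ≡ 1#
*-inverseʳ z@(a +i b) z≢0 = cong₂ _+i_
  (trans
    (solve 3 (λ a b n → a :* (a :* n) :- b :* ((:- b) :* n) :=
                        (a :* a :+ b :* b) :* n) refl a b n⁻¹)
    (ℚ.*-inverseʳ (norm z) {{norm-nonZero z≢0}}))
  (solve 3 (λ a b n → a :* ((:- b) :* n) :+ b :* (a :* n) := con 0ℚ) refl a b n⁻¹)
  where
  open ℚSolver.+-*-Solver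
  n⁻¹ = ℚ.1/_ (norm z) {{norm-nonZero z≢0}}

------------------------------------------------------------------------
-- The group of ℚ(i)-rational points of y² = x³ + ax + b

OnCurve : (a b x y : ℚ[i]) → Set
OnCurve a b x y = y * y ≡ x * x * x + a * x + b

-- The proof that a point lies on the curve is irrelevant, so _≡_ on
-- points is equality of coordinates.
data Point (a b : ℚ[i]) : Set where
  ∞   : Point a b
  aff : (x y : ℚ[i]) .(on : OnCurve a b x y) → Point a b

private
  module Lemmas where
    open ℚ[i]-Solver

    cancel : ∀ d z → d ≢ 0# → d * z ≡ 0# → z ≡ 0#
    cancel d z d≢0 dz≡0 =
      trans (solve 1 (λ z → z := con 1# :* z) refl z)
      (trans (cong (_* z) (sym (*-inverseʳ d d≢0)))
      (trans (solve 3 (λ d e z → (d :* e) :* z := e :* (d :* z)) refl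
                d (inv d d≢0) z)
      (trans (cong (inv d d≢0 *_) dz≡0)
             (solve 1 (λ e → e :* con 0# := con 0#) refl (inv d d≢0)))))

    div-spec : ∀ d n .(d≢0 : d ≢ 0#) → (n * inv d d≢0) * d ≡ n
    div-spec d n d≢0 =
      trans (solve 3 (λ n e d → (n :* e) :* d := n :* (d :* e)) refl
               n (inv d d≢0) d)
      (trans (cong (n *_) (*-inverseʳ d d≢0))
             (solve 1 (λ n → n :* con 1# := n) refl n))

    move : ∀ {u v} → u ≡ v → u - v ≡ 0#
    move {u} refl = solve 1 (λ u → u :- u := con 0#) refl u

    unmove : ∀ {u v} → u - v ≡ 0# → u ≡ v
    unmove {u} {v} eq =
      trans (solve 2 (λ u v → u := (u :- v) :+ v) refl u v)
      (trans (cong (_+ v) eq) (solve 1 (λ v → con 0# :+ v := v) refl v))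

    neg-on : ∀ {a b x y} → OnCurve a b x y → OnCurve a b x (- y)
    neg-on {y = y} on =
      trans (solve 1 (λ y → (:- y) :* (:- y) := y :* y) refl y) on

    -- Substituting the line of slope m through (x₁ , y₁) into
    -- x³ + ax + b - y² gives
    -- (x - x₁)(x - x₂)(x - (m² - x₁ - x₂)) + α (x - x₁) + β,
    -- where β is the value at (x₁ , y₁).
    α : (a x₁ y₁ x₂ m : ℚ[i]) → ℚ[i]
    α a x₁ y₁ x₂ m = a - (m * (y₁ - m * x₁) + m * (y₁ - m * x₁))
                   - (x₁ * x₂ + (x₁ + x₂) * (m * m - x₁ - x₂))

    third-on : ∀ {a b x₁ y₁ x₂ m} → OnCurve a b x₁ y₁ → α a x₁ y₁ x₂ m ≡ 0# →
               let x₃ = m * m - x₁ - x₂ in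
               OnCurve a b x₃ (m * (x₁ - x₃) - y₁)
    third-on {a} {b} {x₁} {y₁} {x₂} {m} on α≡0 = unmove
      (trans
        (solve 6 (λ a b x₁ y₁ x₂ m →
          let x₃ = m :* m :- x₁ :- x₂
              y₃ = m :* (x₁ :- x₃) :- y₁
              c  = m :* (y₁ :- m :* x₁)
              α  = a :- (c :+ c) :- (x₁ :* x₂ :+ (x₁ :+ x₂) :* x₃)
          in y₃ :* y₃ :- (x₃ :* x₃ :* x₃ :+ a :* x₃ :+ b) :=
             (y₁ :* y₁ :- (x₁ :* x₁ :* x₁ :+ a :* x₁ :+ b)) :+ α :* (x₁ :- x₃))
          refl a b x₁ y₁ x₂ m)
        (trans
          (cong₂ (λ β α → β + α * (x₁ - (m * m - x₁ - x₂))) (move on) α≡0)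
          (solve 1 (λ z → con 0# :+ con 0# :* z := con 0#) refl
             (x₁ - (m * m - x₁ - x₂)))))

    secant-α : ∀ {a b x₁ y₁ x₂ y₂ m : ℚ[i]} →
               OnCurve a b x₁ y₁ → OnCurve a b x₂ y₂ → x₂ - x₁ ≢ 0# →
               m * (x₂ - x₁) ≡ y₂ - y₁ → α a x₁ y₁ x₂ m ≡ 0#
    secant-α {a} {b} {x₁} {y₁} {x₂} {y₂} {m} on₁ on₂ d≢0 slope =
      cancel (x₂ - x₁) _ d≢0
        (trans
          (solve 7 (λ a b x₁ y₁ x₂ y₂ m →
            let c = m :* (y₁ :- m :* x₁)
                α = a :- (c :+ c)
                    :- (x₁ :* x₂ :+ (x₁ :+ x₂) :* (m :* m :- x₁ :- x₂))
            in (x₂ :- x₁) :* α :=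
               (y₁ :* y₁ :- (x₁ :* x₁ :* x₁ :+ a :* x₁ :+ b))
               :- (y₂ :* y₂ :- (x₂ :* x₂ :* x₂ :+ a :* x₂ :+ b))
               :- (m :* (x₂ :- x₁) :- (y₂ :- y₁))
                  :* (m :* (x₂ :- x₁) :+ y₁ :+ y₂))
            refl a b x₁ y₁ x₂ y₂ m)
          (trans
            (cong₂ (λ u v → u - v - (m * (x₂ - x₁) - (y₂ - y₁)) * (m * (x₂ - x₁) + y₁ + y₂))
               (move on₁) (move on₂))
            (trans
              (cong (λ u → 0# - 0# - u * (m * (x₂ - x₁) + y₁ + y₂)) (move slope))
              (solve 1 (λ z → con 0# :- con 0# :- con 0# :* z := con 0#) refl
                 (m * (x₂ - x₁) + y₁ + y₂)))))

    tangent-α : ∀ {a b x₁ y₁ x₂ y₂ m} →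
                OnCurve a b x₁ y₁ → OnCurve a b x₂ y₂ →
                x₁ ≡ x₂ → y₁ + y₂ ≢ 0# →
                m * (y₁ + y₂) ≡ x₁ * x₁ + x₁ * x₁ + x₁ * x₁ + a →
                α a x₁ y₁ x₂ m ≡ 0#
    tangent-α {a} {b} {x} {y₁} {_} {y₂} {m} on₁ on₂ refl s≢0 slope =
      trans
        (solve 5 (λ a x y₁ y₂ m →
          let c = m :* (y₁ :- m :* x)
          in a :- (c :+ c) :- (x :* x :+ (x :+ x) :* (m :* m :- x :- x)) :=
             m :* (y₂ :- y₁)
             :- (m :* (y₁ :+ y₂) :- (x :* x :+ x :* x :+ x :* x :+ a)))
          refl a x y₁ y₂ m)
        (trans
          (cong₂ (λ u v → m * u - v) y₂-y₁≡0 (move slope))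
          (solve 1 (λ m → m :* con 0# :- con 0# := con 0#) refl m))
      where
      y₂-y₁≡0 : y₂ - y₁ ≡ 0#
      y₂-y₁≡0 = cancel (y₁ + y₂) (y₂ - y₁) s≢0
        (trans
          (solve 2 (λ y₁ y₂ → (y₁ :+ y₂) :* (y₂ :- y₁) := y₂ :* y₂ :- y₁ :* y₁)
             refl y₁ y₂)
          (move (trans on₂ (sym on₁))))

neg : ∀ {a b} → Point a b → Point a b
neg ∞                  = ∞
neg {a} {b} (aff x y on) = aff x (- y) (Lemmas.neg-on {a} {b} {x} {y} on)

infixl 6 _⊕_

-- The chord-tangent law.
_⊕_ : ∀ {a b} → Point a b → Point a b → Point a b
∞ ⊕ Q = Q
P@(aff _ _ _) ⊕ ∞ = P
_⊕_ {a} {b} (aff x₁ y₁ on₁) (aff x₂ y₂ on₂) with x₁ ≟ x₂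
... | no x₁≢x₂ = aff x₃ (m * (x₁ - x₃) - y₁)
    (third-on {a} {b} {x₁} {y₁} {x₂} {m} on₁
      (secant-α {a} {b} {x₁} {y₁} {x₂} {y₂} {m} on₁ on₂ d≢0 (div-spec (x₂ - x₁) (y₂ - y₁) d≢0)))
  where
  open Lemmas
  d≢0 : x₂ - x₁ ≢ 0#
  d≢0 eq = x₁≢x₂ (sym (unmove eq))
  m  = (y₂ - y₁) * inv (x₂ - x₁) d≢0
  x₃ = m * m - x₁ - x₂
... | yes x₁≡x₂ with (y₁ + y₂) ≟ 0#
...   | yes _  = ∞
-- In this case y₁ = y₂, so m = (3x₁² + a) / 2y₁ is the tangent slope.
...   | no s≢0 = aff x₃ (m * (x₁ - x₃) - y₁)
    (third-on {a} {b} {x₁} {y₁} {x₂} {m} on₁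
      (tangent-α {a} {b} {x₁} {y₁} {x₂} {y₂} {m} on₁ on₂ x₁≡x₂ s≢0
        (div-spec (y₁ + y₂) (x₁ * x₁ + x₁ * x₁ + x₁ * x₁ + a) s≢0)))
  where
  open Lemmas
  m  = (x₁ * x₁ + x₁ * x₁ + x₁ * x₁ + a) * inv (y₁ + y₂) s≢0
  x₃ = m * m - x₁ - x₂

-- The curve is an elliptic curve when 4a³ + 27b² ≠ 0.
MordellWeil : (a b : ℚ[i]) → RawGroup 0ℓ 0ℓ
MordellWeil a b = record
  { Carrier = Point a b
  ; _≈_     = _≡_
  ; _∙_     = _⊕_
  ; ε       = ∞
  ; _⁻¹     = neg
  }

-- E_{p,q}(ℚ(i)), where E_{p,q} is y² = x³ - pqx.
E⟨_,_⟩ : ℕ → ℕ → RawGroup 0ℓ 0ℓ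
E⟨ p , q ⟩ = MordellWeil (fromℤ (ℤ.- (+ (p ℕ.* q)))) 0#

{-# OPTIONS --safe #-}

-- If x = x₁ + i x₂ with x₂ ≢ 0, the line through P = (x , y) and its conjugate
-- meets the curve again in a rational point, and so does the corresponding line
-- for i · P = (- x , i y).  Hence, once the origin is known to be the only affine
-- point over ℚ, it is the only one over ℚ(i), and every point is killed by 2.
--
-- Over ℚ this is Fermat's descent through the isogenous curve y² = x³ + 4 p q x.
-- A point gives a solution of d u⁴ = d′ e⁴ ± r² with d d′ = p q.  The classes of the
-- torsion points lead to u⁴ = v² + p q e⁴, and factoring u⁴ - v² gives a smaller
-- solution of this equation or a solution of one of seven other quartics.  Each
-- condition on p and q rules these seven out modulo 16, by the symbol (p / q), or by
-- the quadratic characters of -1 and 2.  Nonresidues come from a descent on the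
-- modulus; square roots of -1 and 2 come from the parity of the number of pairs
-- {x , - x} under the involution x ↦ ± a / x.

module Submission where

-- The twist of `y² = x³ + a x` by -1 is the same curve, so the rank over `ℚ(i)` is twice the rank
-- over `ℚ`; this is why the rational points suffice. Congruences cannot dispose of
-- `u⁴ = v² + p q e⁴`, since the torsion points give it solutions with `e = 0`. It needs an infinite
-- descent, with `e` in the role of a height. The seven other quartics are excluded locally, at 2,
-- `p` or `q`. The constants in the conditions come from short lists of residues modulo 16: squares
-- are 0, 1, 4, 9, fourth powers are 0, 1, and doubled squares are 0, 2, 8. Products congruent to 13
-- and differences congruent to 8 or 12 are chosen to miss these lists. Neither the isogeny nor the
-- group law over `ℚ` is used: both are replaced by splitting products of coprime natural numbers,
-- with every equation arranged so that no subtraction occurs.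

module NaturalNumbers where

  open import Data.Empty using (⊥)
  open import Data.Nat.Base using (ℕ; zero; suc; _*_; _+_; _<_; s≤s; z≤n)
  import Data.Nat.Base as ℕ
  open import Data.Nat.Coprimality using (Coprime; coprime-divisor)
  import Data.Nat.Coprimality as Coprime
  open import Data.Nat.Divisibility
  open import Data.Nat.GCD using (gcd; gcd[m,n]∣m; gcd[m,n]∣n; gcd[m,n]≡0⇒m≡0; gcd[m,n]≡0⇒n≡0)
  open import Data.Nat.Induction using (<-wellFounded; Acc; acc)
  open import Data.Nat.Primality
    using (Prime; euclidsLemma; prime⇒nonZero; prime⇒nonTrivial; prime⇒irreducible; prime[2])
  import Data.Nat.Properties as ℕ
  import Data.Nat.Tactic.RingSolver as ℕ-Solver
  open import Data.Product.Base using (∃; _×_; _,_)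
  open import Data.Sum.Base using (_⊎_; inj₁; inj₂; [_,_]′; reduce)
  open import Function.Base using (_∘_)
  open import Relation.Binary.PropositionalEquality
  open import Relation.Nullary using (¬_; contradiction; yes; no)

  -- Coprime factors of squares and of multiples of fourth powers

  coprime-∣ˡ : ∀ {d m n} → d ∣ m → Coprime m n → Coprime d n
  coprime-∣ˡ d∣m c (e∣d , e∣n) = c (∣-trans e∣d d∣m , e∣n)

  coprime-* : ∀ {m n o} → Coprime m o → Coprime n o → Coprime (m * n) o
  coprime-* cₘ cₙ (d∣mn , d∣o) =
    cₙ (coprime-divisor (coprime-∣ˡ d∣o (Coprime.sym cₘ)) d∣mn , d∣o)

  coprime-√ : ∀ {m n} → Coprime (m * m) (n * n) → Coprime m n
  coprime-√ {m} {n} c =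
    coprime-∣ˡ (m∣m*n m) (Coprime.sym (coprime-∣ˡ (m∣m*n n) (Coprime.sym c)))

  gcd-split : ∀ m n → ∃ λ g → ∃ λ m′ → ∃ λ n′ →
              m ≡ m′ * g × n ≡ n′ * g × Coprime m′ n′
  gcd-split m n with gcd m n ℕ.≟ 0
  ... | yes g≡0 = 0 , 1 , 1 , gcd[m,n]≡0⇒m≡0 {m} {n} g≡0 , gcd[m,n]≡0⇒n≡0 m {n} g≡0 ,
                  Coprime.1-coprimeTo 1
  ... | no g≢0 = gcd m n , quotient g∣m , quotient g∣n ,
                 _∣_.equality g∣m , _∣_.equality g∣n ,
                 subst₂ Coprime (n/m≡quotient g∣m) (n/m≡quotient g∣n) (Coprime.coprime-/gcd m n)
    where
    instance _ = ℕ.≢-nonZero g≢0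
    g∣m = gcd[m,n]∣m m n
    g∣n = gcd[m,n]∣n m n

  -- Dividing out the gcd leaves coprime `m′` and `n′` with `m′² ∣ n′²`, which forces `m′ = 1`.
  m²∣n²⇒m∣n : ∀ {m n} → m * m ∣ n * n → m ∣ n
  m²∣n²⇒m∣n {m} {n} m²∣n² with gcd-split m n
  ... | zero , m′ , n′ , refl , refl , _ =
      subst (_∣ n′ * 0) (trans (ℕ.*-zeroʳ n′) (sym (ℕ.*-zeroʳ m′))) ∣-refl
  ... | g@(suc _) , m′ , n′ , refl , refl , c = *-monoˡ-∣ g (subst (_∣ n′) (sym m′≡1) (1∣ n′))
    where
    m′²∣n′² : m′ * m′ ∣ n′ * n′
    m′²∣n′² = *-cancelʳ-∣ (g * g) (subst₂ _∣_ (lem m′ g) (lem n′ g) m²∣n²)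
      where
      lem : ∀ x y → (x * y) * (x * y) ≡ (x * x) * (y * y)
      lem = ℕ-Solver.solve-∀
    m′≡1 : m′ ≡ 1
    m′≡1 = c (∣-refl , coprime-divisor c (∣-trans (m∣m*n m′) m′²∣n′²))

  -- The root of `a` is `f = gcd a e`. In `a′ b = e′² f` the factor `a′` is coprime to `e′`, so
  -- `a ∣ f²`; and `f`, a divisor of `a`, is coprime to `b`, so `f² ∣ a`.
  coprime-*≡□ : ∀ {a b e} → Coprime a b → a * b ≡ e * e →
                ∃ λ f → ∃ λ g → a ≡ f * f × b ≡ g * g × f * g ≡ e
  coprime-*≡□ {a} {b} {e} c ab≡e² with gcd-split a e
  ... | zero , a′ , e′ , a≡0 , e≡0 , _ =
    -- A zero gcd means `a = 0`; then `b` divides both coprime factors and equals 1.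
    0 , 1 , a≡0′ , c (b∣a , ∣-refl) , sym (trans e≡0 (ℕ.*-zeroʳ e′))
    where
    a≡0′ = trans a≡0 (ℕ.*-zeroʳ a′)
    b∣a : b ∣ a
    b∣a = subst (b ∣_) (sym a≡0′) (b ∣0)
  ... | f@(suc _) , a′ , e′ , refl , refl , c′ = f , e′ , a≡f² , b≡e′² , ℕ.*-comm f e′
    where
    lem₁ : ∀ a f b → a * f * b ≡ a * b * f
    lem₁ = ℕ-Solver.solve-∀
    lem₂ : ∀ e f → (e * f) * (e * f) ≡ e * e * f * f
    lem₂ = ℕ-Solver.solve-∀
    a′b≡e′²f : a′ * b ≡ e′ * e′ * f
    a′b≡e′²f = ℕ.*-cancelʳ-≡ (a′ * b) (e′ * e′ * f) f
      (trans (sym (lem₁ a′ f b)) (trans ab≡e² (lem₂ e′ f)))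
    a∣f² : a′ * f ∣ f * f
    a∣f² = *-monoˡ-∣ f (coprime-divisor (Coprime.sym (coprime-* (Coprime.sym c′) (Coprime.sym c′)))
      (divides b (trans (sym a′b≡e′²f) (ℕ.*-comm a′ b))))
    f⊥b = coprime-∣ˡ {f} {a′ * f} (n∣m*n a′) c
    f²∣a : f * f ∣ a′ * f
    f²∣a = coprime-divisor (coprime-* f⊥b f⊥b)
      (divides (e′ * e′) (trans (ℕ.*-comm b (a′ * f))
        (trans ab≡e² (trans (lem₂ e′ f) (ℕ.*-assoc (e′ * e′) f f)))))
    a≡f² = ∣-antisym a∣f² f²∣a
    b≡e′² : b ≡ e′ * e′
    b≡e′² = ℕ.*-cancelˡ-≡ b (e′ * e′) (f * f)
      (trans (cong (_* b) (sym a≡f²)) (trans ab≡e² (trans (lem₂ e′ f)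
        (trans (ℕ.*-assoc (e′ * e′) f f) (ℕ.*-comm (e′ * e′) (f * f))))))

  data Factor (p q : ℕ) : ℕ → ℕ → Set where
    1·pq : Factor p q 1 (p * q)
    p·q  : Factor p q p q
    q·p  : Factor p q q p
    pq·1 : Factor p q (p * q) 1

  factor-*≡ : ∀ {p q D D′} → Factor p q D D′ → D * D′ ≡ p * q
  factor-*≡ {p} {q} 1·pq = ℕ.*-identityˡ (p * q)
  factor-*≡ p·q = refl
  factor-*≡ {p} {q} q·p = ℕ.*-comm q p
  factor-*≡ {p} {q} pq·1 = ℕ.*-identityʳ (p * q)

  -- The side that receives `p` is encoded by the pair `c`, `d` instead of two separate conclusions,
  -- so that the outcomes for two primes can be multiplied.
  split-prime : ∀ {p s t X} → Prime p → Coprime s t → s * t ≡ p * X →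
    ∃ λ c → ∃ λ d → ∃ λ s′ → ∃ λ t′ → (c ≡ p × d ≡ 1 ⊎ c ≡ 1 × d ≡ p) ×
    s ≡ c * s′ × t ≡ d * t′ × Coprime s′ t′ × s′ * t′ ≡ X
  split-prime {p} {s} {t} {X} pp c st≡pX
    with euclidsLemma s t pp (divides X (trans st≡pX (ℕ.*-comm p X)))
  ... | inj₁ (divides s′ refl) =
    p , 1 , s′ , t , inj₁ (refl , refl) , ℕ.*-comm s′ p , sym (ℕ.*-identityˡ t) ,
    coprime-∣ˡ (m∣m*n p) c ,
    ℕ.*-cancelˡ-≡ _ _ p (trans (lem p s′ t) st≡pX)
    where
    instance _ = prime⇒nonZero pp
    lem : ∀ p s t → p * (s * t) ≡ s * p * t
    lem = ℕ-Solver.solve-∀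
  ... | inj₂ (divides t′ refl) =
    1 , p , s , t′ , inj₂ (refl , refl) , sym (ℕ.*-identityˡ s) , ℕ.*-comm t′ p ,
    Coprime.sym (coprime-∣ˡ (m∣m*n p) (Coprime.sym c)) ,
    ℕ.*-cancelˡ-≡ _ _ p (trans (lem p s t′) st≡pX)
    where
    instance _ = prime⇒nonZero pp
    lem : ∀ p s t → p * (s * t) ≡ s * (t * p)
    lem = ℕ-Solver.solve-∀

  split-pq : ∀ {p q s t X} → Prime p → Prime q → Coprime s t → s * t ≡ p * q * X →
    ∃ λ D → ∃ λ D′ → ∃ λ s′ → ∃ λ t′ → Factor p q D D′ ×
    s ≡ D * s′ × t ≡ D′ * t′ × Coprime s′ t′ × s′ * t′ ≡ X
  split-pq {p} {q} {X = X} pp qp c st≡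
    with split-prime pp c (trans st≡ (ℕ.*-assoc p q X))
  ... | c₁ , d₁ , s₁ , t₁ , side₁ , refl , refl , c′ , s₁t₁≡ with split-prime qp c′ s₁t₁≡
  ... | c₂ , d₂ , s₂ , t₂ , side₂ , refl , refl , c″ , s₂t₂≡ =
    c₁ * c₂ , d₁ * d₂ , s₂ , t₂ , factor side₁ side₂ ,
    sym (ℕ.*-assoc c₁ c₂ s₂) , sym (ℕ.*-assoc d₁ d₂ t₂) , c″ , s₂t₂≡
    where
    factor : ∀ {c₁ d₁ c₂ d₂} → c₁ ≡ p × d₁ ≡ 1 ⊎ c₁ ≡ 1 × d₁ ≡ p →
             c₂ ≡ q × d₂ ≡ 1 ⊎ c₂ ≡ 1 × d₂ ≡ q → Factor p q (c₁ * c₂) (d₁ * d₂)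
    factor (inj₁ (refl , refl)) (inj₁ (refl , refl)) = pq·1
    factor (inj₁ (refl , refl)) (inj₂ (refl , refl)) =
      subst₂ (Factor p q) (sym (ℕ.*-identityʳ p)) (sym (ℕ.*-identityˡ q)) p·q
    factor (inj₂ (refl , refl)) (inj₁ (refl , refl)) =
      subst₂ (Factor p q) (sym (ℕ.*-identityˡ q)) (sym (ℕ.*-identityʳ p)) q·p
    factor (inj₂ (refl , refl)) (inj₂ (refl , refl)) = 1·pq

  Split⁴ : (p q s t e : ℕ) → Set
  Split⁴ p q s t e = ∃ λ D → ∃ λ D′ → ∃ λ f → ∃ λ g → Factor p q D D′ ×
    s ≡ D * (f * f * (f * f)) × t ≡ D′ * (g * g * (g * g)) × f * g ≡ e × Coprime f g

  -- Once each prime has gone to one side, a coprime factorisation of `e⁴` remains, and roots are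
  -- extracted twice.
  coprime-*≡pq⁴ : ∀ {p q s t e} → Prime p → Prime q → Coprime s t →
    s * t ≡ p * q * (e * e * (e * e)) → Split⁴ p q s t e
  coprime-*≡pq⁴ {e = e} pp qp c st≡ with split-pq pp qp c st≡
  ... | D , D′ , s′ , t′ , DD′ , s≡ , t≡ , c′ , s′t′≡ with coprime-*≡□ {e = e * e} c′ s′t′≡
  ... | f , g , refl , refl , fg≡ with coprime-*≡□ {f} {g} {e} (coprime-√ c′) fg≡
  ... | f′ , g′ , refl , refl , fg≡′ =
      D , D′ , f′ , g′ , DD′ , s≡ , t≡ , fg≡′ , coprime-√ (coprime-√ c′)

  -- The factorisation of `u² - w²` without subtraction: `r` is `u - w`, and `r + 2 w` is `u + w`.
  □-difference : ∀ {u w X} → u * u ≡ w * w + X → ∃ λ r → u ≡ w + r × r * (r + 2 * w) ≡ X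
  □-difference {u} {w} {X} eq with w ℕ.≤? u
  ... | no w≰u = contradiction (ℕ.*-mono-< u<w u<w)
                   (ℕ.≤⇒≯ (subst (w * w ℕ.≤_) (sym eq) (ℕ.m≤m+n (w * w) X)))
    where u<w = ℕ.≰⇒> w≰u
  ... | yes w≤u with r , refl ← ℕ.m≤n⇒∃[o]m+o≡n w≤u =
    r , refl , ℕ.+-cancelˡ-≡ (w * w) _ _ (trans (lem w r) eq)
    where
    lem : ∀ w r → w * w + r * (r + 2 * w) ≡ (w + r) * (w + r)
    lem = ℕ-Solver.solve-∀

  ∣m+n∣n⇒∣m : ∀ {d m n} → d ∣ m + n → d ∣ n → d ∣ m
  ∣m+n∣n⇒∣m {d} {m} {n} d∣m+n = ∣m+n∣m⇒∣n (subst (d ∣_) (ℕ.+-comm m n) d∣m+n)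

  ∣n⇒∣m*n⁴ : ∀ {d n} m → d ∣ n → d ∣ m * (n * n * (n * n))
  ∣n⇒∣m*n⁴ {d} {n} m d∣n = ∣n⇒∣m*n m (∣m⇒∣m*n (n * n) (∣m⇒∣m*n n d∣n))

  2∤⇒coprime : ∀ {d} → ¬ 2 ∣ d → Coprime d 2
  2∤⇒coprime 2∤d (e∣d , e∣2) with prime⇒irreducible prime[2] e∣2
  ... | inj₁ e≡1  = e≡1
  ... | inj₂ refl = contradiction e∣d 2∤d

  prime-∣⇒≡ : ∀ {p q} → Prime p → Prime q → p ∣ q → p ≡ q
  prime-∣⇒≡ pp qp p∣q with prime⇒irreducible qp p∣q
  ... | inj₁ refl = contradiction (prime⇒nonTrivial pp) λ ()
  ... | inj₂ p≡q  = p≡q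

  prime∤⇒coprime : ∀ {p n} → Prime p → ¬ p ∣ n → Coprime p n
  prime∤⇒coprime pp p∤n (d∣p , d∣n) with prime⇒irreducible pp d∣p
  ... | inj₁ d≡1  = d≡1
  ... | inj₂ refl = contradiction d∣n p∤n

  module _ {p q : ℕ} (pp : Prime p) (qp : Prime q) (p≢q : p ≢ q) where

    private instance
      p≢0 = prime⇒nonZero pp
      q≢0 = prime⇒nonZero qp

    -- If `p ∣ h`, then `p² ∣ p q` and `p ∣ q`, against `p ≢ q`. So `h` is coprime to `p`, and
    -- likewise to `q`.
    pq-squarefree : ∀ {h} → h * h ∣ p * q → h ≡ 1
    pq-squarefree {h} h²∣pq = h⊥q (∣-refl , coprime-divisor h⊥p (∣-trans (m∣m*n h) h²∣pq))
      where
      h⊥p : Coprime h p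
      h⊥p = Coprime.sym (prime∤⇒coprime pp λ p∣h →
        p≢q (prime-∣⇒≡ pp qp (*-cancelˡ-∣ p (∣-trans (*-pres-∣ p∣h p∣h) h²∣pq))))
      h⊥q : Coprime h q
      h⊥q = Coprime.sym (prime∤⇒coprime qp λ q∣h →
        p≢q (sym (prime-∣⇒≡ qp pp (*-cancelʳ-∣ q (∣-trans (*-pres-∣ q∣h q∣h) h²∣pq)))))

    -- `d²` divides `s t`, and coprimality to `e` pushes it into the squarefree `p q`.
    common-divisor≡1 : ∀ {s t e d} → s * t ≡ p * q * (e * e * (e * e)) → Coprime d e →
                       d ∣ s → d ∣ t → d ≡ 1
    common-divisor≡1 {s} {t} {e} {d} st≡ d⊥e d∣s d∣t = pq-squarefree
      (coprime-divisor d²⊥e⁴ (subst (d * d ∣_) (trans st≡ (ℕ.*-comm (p * q) _)) (*-pres-∣ d∣s d∣t)))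
      where
      d²⊥e² : Coprime (d * d) (e * e)
      d²⊥e² = Coprime.sym (coprime-* (Coprime.sym d²⊥e) (Coprime.sym d²⊥e))
        where d²⊥e = coprime-* d⊥e d⊥e
      d²⊥e⁴ : Coprime (d * d) (e * e * (e * e))
      d²⊥e⁴ = Coprime.sym (coprime-* (Coprime.sym d²⊥e²) (Coprime.sym d²⊥e²))

  -- The Eᵢ are homogeneous spaces of y² = x³ - p q x, the Gᵢ those of the isogenous
  -- curve y² = x³ + 4 p q x.
  record NoQuartics (p q : ℕ) : Set where
    field
      E₁ : ∀ {a b w} → Coprime a b → a * a * (a * a) + w * w ≢ p * q * (b * b * (b * b))
      E₂ : ∀ {a b w} → Coprime a b → p * (a * a * (a * a)) + w * w ≢ q * (b * b * (b * b))
      E₃ : ∀ {a b w} → Coprime a b → q * (a * a * (a * a)) + w * w ≢ p * (b * b * (b * b))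
      G₁ : ∀ {f g u} → Coprime f g → ¬ 2 ∣ f → ¬ 2 ∣ g →
           f * f * (f * f) + p * q * (g * g * (g * g)) ≢ 2 * (u * u)
      G₂ : ∀ {f g u} → Coprime f g → ¬ 2 ∣ f → ¬ 2 ∣ g →
           p * (f * f * (f * f)) + q * (g * g * (g * g)) ≢ 2 * (u * u)
      G₃ : ∀ {f g u} → Coprime f g → ¬ 2 ∣ f →
           p * (f * f * (f * f)) + 4 * (q * (g * g * (g * g))) ≢ u * u
      G₄ : ∀ {f g u} → Coprime f g → ¬ 2 ∣ f →
           q * (f * f * (f * f)) + 4 * (p * (g * g * (g * g))) ≢ u * u

  -- Infinite descent on `u⁴ = v² + p q e⁴`

  module Descent {p q : ℕ} (pp : Prime p) (qp : Prime q) (p≢q : p ≢ q)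
    (2∤p : ¬ 2 ∣ p) (2∤q : ¬ 2 ∣ q) (nq : NoQuartics p q) where

    open NoQuartics nq

    private instance
      p≢0 = prime⇒nonZero pp
      q≢0 = prime⇒nonZero qp

    2∤pq : ¬ 2 ∣ p * q
    2∤pq = [ 2∤p , 2∤q ]′ ∘ euclidsLemma p q prime[2]

    2∣pqn⇒2∣n : ∀ {n} → 2 ∣ p * q * n → 2 ∣ n
    2∣pqn⇒2∣n {n} = [ (λ 2∣pq → contradiction 2∣pq 2∤pq) , (λ 2∣n → 2∣n) ]′
      ∘ euclidsLemma (p * q) n prime[2]

    2∣n²⇒2∣n : ∀ {n} → 2 ∣ n * n → 2 ∣ n
    2∣n²⇒2∣n {n} = reduce ∘ euclidsLemma n n prime[2]

    -- A new solution of the descent equation, with `b` for `u`, `w` for `v` and `a` for `e`. The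
    -- condition `a b = g` is what bounds `a`.
    Quartic : ℕ → ℕ → Set
    Quartic w g = ∃ λ a → ∃ λ b →
      a * b ≡ g × Coprime a b × b * b * (b * b) ≡ w * w + p * q * (a * a * (a * a))

    -- Of the four ways to split p q between the coprime factors r and r + w², three are
    -- excluded and the fourth is again a solution of the descent equation.
    quartic : ∀ {r w g} → r * (r + w * w) ≡ p * q * (g * g * (g * g)) → Coprime r (r + w * w) →
      Quartic w g
    quartic {r} {w} {g} eq c with coprime-*≡pq⁴ {e = g} pp qp c eq
    ... | _ , _ , a , b , factor , r≡ , r+w²≡ , ab≡g , a⊥b = go factor r≡ r+w²≡
      where
      go : ∀ {D D′} → Factor p q D D′ → r ≡ D * (a * a * (a * a)) →
        r + w * w ≡ D′ * (b * b * (b * b)) → Quartic w g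
      go 1·pq refl eq = contradiction (trans (cong (_+ w * w) (sym (ℕ.*-identityˡ _))) eq)
          (E₁ {a} {b} {w} a⊥b)
      go p·q  refl eq = contradiction eq (E₂ {a} {b} {w} a⊥b)
      go q·p  refl eq = contradiction eq (E₃ {a} {b} {w} a⊥b)
      go pq·1 refl eq = a , b , ab≡g , a⊥b ,
        trans (sym (ℕ.*-identityˡ _)) (trans (sym eq) (ℕ.+-comm _ (w * w)))

    private
      NoSolution : ℕ → Set
      NoSolution e = ∀ {u v} → e ≢ 0 → Coprime u e →
          u * u * (u * u) ≢ v * v + p * q * (e * e * (e * e))

      -- Divisibility alone gives `a ≤ c (a b)`; strictness comes from the factor 2 of the even `e`.
      smaller : ∀ {a b c e} → e ≡ c * (a * b) * 2 → e ≢ 0 → a < e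
      smaller {a = zero} {b} {c} refl e≢0 =
          contradiction (trans (cong (_* 2) (ℕ.*-zeroʳ c)) refl) e≢0
      smaller {a@(suc _)} {zero} {c} refl e≢0 =
        contradiction (cong (_* 2) (trans (cong (c *_) (ℕ.*-zeroʳ a)) (ℕ.*-zeroʳ c))) e≢0
      smaller {b = suc _} {c = zero} refl e≢0 = contradiction refl e≢0
      smaller {a@(suc _)} {b@(suc _)} {c@(suc _)} refl _ = ℕ.≤-<-trans
        (∣⇒≤ {{_}} (∣-trans (m∣m*n b) (n∣m*n c))) (ℕ.m<m*n (c * (a * b)) 2 (s≤s (s≤s z≤n)))

      -- The factors are `u² - v` and `u² + v`. A common divisor is odd, so it divides `v` and `u²`
      -- and is coprime to `e`. The sum of the factors is `2 u²`, which is an instance of `G₁` or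
      -- `G₂`.
      odd-case : ∀ {s v u e} → ¬ 2 ∣ s → s * (s + 2 * v) ≡ p * q * (e * e * (e * e)) →
                 u * u ≡ v + s → Coprime u e → ⊥
      odd-case {s} {v} {u} {e} 2∤s st≡ u²≡ u⊥e with coprime-*≡pq⁴ {e = e} pp qp s⊥t st≡
        where
        s⊥t : Coprime s (s + 2 * v)
        s⊥t {d} (d∣s , d∣t) = common-divisor≡1 pp qp p≢q {e = e} st≡
          (coprime-∣ˡ (subst (d ∣_) (sym u²≡) (∣m∣n⇒∣m+n d∣v d∣s)) (coprime-* u⊥e u⊥e))
          d∣s d∣t
          where
          d∣v : d ∣ v
          d∣v = coprime-divisor (2∤⇒coprime λ 2∣d → 2∤s (∣-trans 2∣d d∣s)) (∣m+n∣m⇒∣n d∣t d∣s)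
      ... | D , D′ , f , g , factor , s≡ , t≡ , _ , f⊥g = go factor s≡ t≡
        where
        sum≡ : ∀ {x y} → s ≡ x → s + 2 * v ≡ y → x + y ≡ 2 * (u * u)
        sum≡ refl refl = trans (lem s v) (cong (2 *_) (sym u²≡))
          where
          lem : ∀ s v → s + (s + 2 * v) ≡ 2 * (v + s)
          lem = ℕ-Solver.solve-∀
        2∤f : ¬ 2 ∣ f
        2∤f 2∣f = 2∤s (subst (2 ∣_) (sym s≡) (∣n⇒∣m*n⁴ D 2∣f))
        2∤g : ¬ 2 ∣ g
        2∤g 2∣g = 2∤s (∣m+n∣n⇒∣m (subst (2 ∣_) (sym t≡) (∣n⇒∣m*n⁴ D′ 2∣g)) (m∣m*n v))
        go : ∀ {D D′} → Factor p q D D′ → s ≡ D * (f * f * (f * f)) →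
          s + 2 * v ≡ D′ * (g * g * (g * g)) → ⊥
        go 1·pq eq₁ eq₂ = G₁ {f} {g} {u} f⊥g 2∤f 2∤g (sum≡ (trans eq₁ (ℕ.*-identityˡ _)) eq₂)
        go p·q  eq₁ eq₂ = G₂ {f} {g} {u} f⊥g 2∤f 2∤g (sum≡ eq₁ eq₂)
        go q·p  eq₁ eq₂ = G₂ {g} {f} {u} (Coprime.sym f⊥g) 2∤g 2∤f
            (trans (ℕ.+-comm (p * _) _) (sum≡ eq₁ eq₂))
        go pq·1 eq₁ eq₂ = G₁ {g} {f} {u} (Coprime.sym f⊥g) 2∤g 2∤f
          (trans (ℕ.+-comm _ (p * q * _)) (sum≡ eq₁ (trans eq₂ (ℕ.*-identityˡ _))))

      -- `x` and `y` are `(u² - v) / 2` and `(u² + v) / 2`, in the order that makes `x` even. As `y`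
      -- is then odd, 4 divides `x`. Splittings that separate `p` from `q` are `G₃` and `G₄`; in the
      -- other two, `u²` exceeds a square by a multiple of a fourth power, and the descent
      -- continues.
      even-case : ∀ {x y u e} → (∀ {a} → a < e * 2 → NoSolution a) → e * 2 ≢ 0 → 2 ∣ x →
                  Coprime x y → x * y ≡ p * q * (4 * (e * e * (e * e))) → u * u ≡ x + y → ⊥
      even-case {x} {y} {u} {e} ih e≢0 2∣x x⊥y xy≡ u²≡ = go 4∣x
        where
        2⊥y : Coprime 2 y
        2⊥y = coprime-∣ˡ 2∣x x⊥y
        4∣x : 4 ∣ x
        4∣x = coprime-divisor (coprime-* 2⊥y 2⊥y)
          (subst (4 ∣_) (trans (sym xy≡) (ℕ.*-comm x y))
            (∣n⇒∣m*n (p * q) (m∣m*n (e * e * (e * e)))))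
        lem-x : ∀ x y → 4 * (x * y) ≡ x * 4 * y
        lem-x = ℕ-Solver.solve-∀
        lem-n : ∀ n x → n * (4 * x) ≡ 4 * (n * x)
        lem-n = ℕ-Solver.solve-∀

        go : 4 ∣ x → ⊥
        go (divides x′ refl) = finish′
            (coprime-*≡pq⁴ {s = x′} {t = y} {e = e} pp qp (coprime-∣ˡ (m∣m*n 4) x⊥y)
          (ℕ.*-cancelˡ-≡ (x′ * y) (p * q * (e * e * (e * e))) 4
            (trans (lem-x x′ y) (trans xy≡ (lem-n (p * q) (e * e * (e * e)))))))
          where
          finish′ : Split⁴ p q x′ y e → ⊥
          finish′ (D , D′ , g , f , factor , x′≡ , y≡ , refl , g⊥f) = finish factor x′≡ y≡
            where
            2∤f : ¬ 2 ∣ f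
            2∤f 2∣f = contradiction (2⊥y (∣-refl , subst (2 ∣_) (sym y≡) (∣n⇒∣m*n⁴ D′ 2∣f))) λ ()
            sum≡ : ∀ {X Y} → x′ ≡ X → y ≡ Y → Y + 4 * X ≡ u * u
            sum≡ refl refl = trans (lem x′ y) (sym u²≡)
              where
              lem : ∀ x y → y + 4 * x ≡ x * 4 + y
              lem = ℕ-Solver.solve-∀
            fourth : ℕ → ℕ
            fourth z = z * z * (z * z)
            N = p * q

            descend : ∀ {c w g} → c * g * 2 ≡ e * 2 → Quartic w g → ⊥
            descend {c} {w} e≡ (a , b , refl , a⊥b , eq′) =
              ih (subst (a <_) e≡ (smaller {a} {b} {c} refl ce≢0)) {b} {w} a≢0 (Coprime.sym a⊥b) eq′
              where
              ce≢0 : c * (a * b) * 2 ≢ 0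
              ce≢0 = subst (_≢ 0) (sym e≡) e≢0
              a≢0 : a ≢ 0
              a≢0 refl = ce≢0 (cong (_* 2) (ℕ.*-zeroʳ c))

            -- The square to split off is `(2 g²)²`. Since `2 (2 g²) = (2 g)²`, the new `w` is
            -- `2 g`.
            case-1·pq : 4 * fourth g + N * fourth f ≡ u * u → ⊥
            case-1·pq eq = go′ (□-difference {u} {2 * (g * g)} {N * fourth f}
              (trans (sym eq) (cong (_+ N * fourth f) (lem₁ g))))
              where
              lem₁ : ∀ g → 4 * (g * g * (g * g)) ≡ 2 * (g * g) * (2 * (g * g))
              lem₁ = ℕ-Solver.solve-∀
              lem₂ : ∀ g → 2 * (2 * (g * g)) ≡ 2 * g * (2 * g)
              lem₂ = ℕ-Solver.solve-∀
              go′ : (∃ λ r → u ≡ 2 * (g * g) + r × r * (r + 2 * (2 * (g * g))) ≡ N * fourth f) → ⊥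
              go′ (r , _ , r≡) = descend {g} {2 * g} {f} refl (quartic {r} {2 * g} {f} r≡′ r⊥)
                where
                r≡′ : r * (r + 2 * g * (2 * g)) ≡ N * fourth f
                r≡′ = trans (cong (λ z → r * (r + z)) (sym (lem₂ g))) r≡
                2∤r : ¬ 2 ∣ r
                2∤r 2∣r = 2∤f (2∣n²⇒2∣n {f} (2∣n²⇒2∣n {f * f} (2∣pqn⇒2∣n {fourth f}
                  (subst (2 ∣_) r≡ (∣m⇒∣m*n (r + 2 * (2 * (g * g))) 2∣r)))))
                r⊥ : Coprime r (r + 2 * g * (2 * g))
                r⊥ {d} (d∣r , d∣t) = common-divisor≡1 pp qp p≢q {e = f} r≡′
                  (coprime-∣ˡ d∣g² (coprime-* g⊥f g⊥f)) d∣r d∣t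
                  where
                  d⊥2 : Coprime d 2
                  d⊥2 = 2∤⇒coprime λ 2∣d → 2∤r (∣-trans 2∣d d∣r)
                  d∣g² : d ∣ g * g
                  d∣g² = coprime-divisor d⊥2 (coprime-divisor d⊥2
                    (subst (d ∣_) (sym (lem₂ g)) (∣m+n∣m⇒∣n d∣t d∣r)))

            -- The square is now `(f²)²`. Here `r` is even, and halving it turns
            -- `r (r + 2 f²) = 4 p q g⁴` into the required shape with `w = f`.
            case-pq·1 : fourth f + 4 * (N * fourth g) ≡ u * u → ⊥
            case-pq·1 eq = go′ (□-difference {u} {f * f} {4 * (N * fourth g)} (sym eq))
              where
              lem : ∀ r f → 4 * (r * (r + f * f)) ≡ r * 2 * (r * 2 + 2 * (f * f))
              lem = ℕ-Solver.solve-∀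
              go′ : (∃ λ r → u ≡ f * f + r × r * (r + 2 * (f * f)) ≡ 4 * (N * fourth g)) → ⊥
              go′ (r , _ , r≡) = halve 2∣r r≡
                where
                2∣r : 2 ∣ r
                2∣r = [ (λ z → z) , (λ 2∣t → ∣m+n∣n⇒∣m 2∣t (m∣m*n (f * f))) ]′
                  (euclidsLemma r (r + 2 * (f * f)) prime[2]
                    (subst (2 ∣_) (sym r≡) (∣m⇒∣m*n {2} {4} (N * fourth g) (divides 2 refl))))
                halve : ∀ {r} → 2 ∣ r → r * (r + 2 * (f * f)) ≡ 4 * (N * fourth g) → ⊥
                halve (divides r′ refl) r≡ = descend {f} {f} {g} (cong (_* 2) (ℕ.*-comm f g))
                  (quartic {r′} {f} {g} r′≡ r′⊥)
                  where
                  r′≡ : r′ * (r′ + f * f) ≡ N * fourth g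
                  r′≡ = ℕ.*-cancelˡ-≡ (r′ * (r′ + f * f)) (N * fourth g) 4 (trans (lem r′ f) r≡)
                  r′⊥ : Coprime r′ (r′ + f * f)
                  r′⊥ {d} (d∣r , d∣t) = common-divisor≡1 pp qp p≢q {e = g} r′≡
                    (coprime-∣ˡ (∣m+n∣m⇒∣n d∣t d∣r)
                      (coprime-* (Coprime.sym g⊥f) (Coprime.sym g⊥f))) d∣r d∣t

            finish : ∀ {D D′} → Factor p q D D′ → x′ ≡ D * fourth g → y ≡ D′ * fourth f → ⊥
            finish 1·pq eq₁ eq₂ = case-1·pq
                (trans (ℕ.+-comm (4 * fourth g) _) (sum≡ (trans eq₁ (ℕ.*-identityˡ _)) eq₂))
            finish p·q  eq₁ eq₂ = G₄ {f} {g} {u} (Coprime.sym g⊥f) 2∤f (sum≡ eq₁ eq₂)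
            finish q·p  eq₁ eq₂ = G₃ {f} {g} {u} (Coprime.sym g⊥f) 2∤f (sum≡ eq₁ eq₂)
            finish pq·1 eq₁ eq₂ = case-pq·1 (sum≡ eq₁ (trans eq₂ (ℕ.*-identityˡ _)))

      -- If `s = 2 s′` is even, then so is `e`, because `p q` is odd. The halves `s′` and `s′ + v`
      -- are coprime since their sum is `u²`, and one of them is even since their product is.
      step : ∀ e → (∀ {a} → a < e → NoSolution a) → NoSolution e
      step e ih {u} {v} e≢0 u⊥e eq with □-difference {u * u} {v} eq
      ... | s , u²≡ , st≡ with 2 ∣? s
      ... | no 2∤s = odd-case {s} {v} {u} {e} 2∤s st≡ u²≡ u⊥e
      ... | yes (divides s′ refl) = halve (2∣n²⇒2∣n (2∣n²⇒2∣n (2∣pqn⇒2∣n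
              (subst (2 ∣_) st≡ (∣m⇒∣m*n _ (n∣m*n s′))))))
        where
        lem₁ : ∀ s v → 4 * (s * (s + v)) ≡ s * 2 * (s * 2 + 2 * v)
        lem₁ = ℕ-Solver.solve-∀
        u²≡′ : u * u ≡ s′ + (s′ + v)
        u²≡′ = trans u²≡ (lem s′ v)
          where
          lem : ∀ s v → v + s * 2 ≡ s + (s + v)
          lem = ℕ-Solver.solve-∀
        s⊥t : Coprime s′ (s′ + v)
        s⊥t {d} (d∣s , d∣t) = common-divisor≡1 pp qp p≢q {e = e} st≡
          (coprime-∣ˡ (subst (d ∣_) (sym u²≡′) (∣m∣n⇒∣m+n d∣s d∣t)) (coprime-* u⊥e u⊥e))
          (∣m⇒∣m*n 2 d∣s) (subst (d ∣_) (lem s′ v) (∣m⇒∣m*n 2 d∣t))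
          where
          lem : ∀ s v → (s + v) * 2 ≡ s * 2 + 2 * v
          lem = ℕ-Solver.solve-∀
        halve : 2 ∣ e → ⊥
        halve (divides e′ refl) = [ case-s , case-t ]′
          (euclidsLemma s′ (s′ + v) prime[2] (subst (2 ∣_) (sym st≡′)
            (∣n⇒∣m*n (p * q) (∣m⇒∣m*n (e′ * e′ * (e′ * e′)) (divides 2 refl)))))
          where
          lem₂ : ∀ n e → n * (e * 2 * (e * 2) * (e * 2 * (e * 2))) ≡
            4 * (n * (4 * (e * e * (e * e))))
          lem₂ = ℕ-Solver.solve-∀
          st≡′ : s′ * (s′ + v) ≡ p * q * (4 * (e′ * e′ * (e′ * e′)))
          st≡′ = ℕ.*-cancelˡ-≡ (s′ * (s′ + v)) (p * q * (4 * (e′ * e′ * (e′ * e′)))) 4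
            (trans (lem₁ s′ v) (trans st≡ (lem₂ (p * q) e′)))
          case-s : 2 ∣ s′ → ⊥
          case-s 2∣s = even-case {s′} {s′ + v} {u} {e′} ih e≢0 2∣s s⊥t st≡′ u²≡′
          case-t : 2 ∣ s′ + v → ⊥
          case-t 2∣t = even-case {s′ + v} {s′} {u} {e′} ih e≢0 2∣t (Coprime.sym s⊥t)
            (trans (ℕ.*-comm (s′ + v) s′) st≡′) (trans u²≡′ (ℕ.+-comm s′ (s′ + v)))

      rec : ∀ {e} → Acc _<_ e → NoSolution e
      rec {e} (acc rs) {u} {v} = step e (λ a<e {u} {v} → rec (rs a<e) {u} {v}) {u} {v}

    no-solution : ∀ {u v e} → e ≢ 0 → Coprime u e →
      u * u * (u * u) ≢ v * v + p * q * (e * e * (e * e))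
    no-solution {u} {v} {e} = rec (<-wellFounded e) {u} {v}

  -- Square classes of a rational abscissa

  module IntegralPoints {p q : ℕ} (pp : Prime p) (qp : Prime q) (p≢q : p ≢ q)
    (2∤p : ¬ 2 ∣ p) (2∤q : ¬ 2 ∣ q) (nq : NoQuartics p q) where

    open NoQuartics nq
    open Descent pp qp p≢q 2∤p 2∤q nq using (no-solution)

    -- Here `a / c` is the absolute value of the abscissa and `t` that of `a² - p q c²`; `g` is the
    -- class of `a / c` modulo squares.
    Decomposition : (a c t : ℕ) → Set
    Decomposition a c t = ∃ λ g → ∃ λ g′ → ∃ λ u → ∃ λ e → ∃ λ r → Factor p q g g′ ×
      a ≡ g * (u * u) × c ≡ e * e × t ≡ g * (r * r) × Coprime u e

    -- A common divisor of `g` and its cofactor has its square dividing `p q`, so the two are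
    -- coprime. Splitting with `X = 1` then leaves only units.
    factor : ∀ {g} → g ∣ p * q → ∃ λ g′ → Factor p q g g′
    factor {g} (divides g′ pq≡g′g) = go (split-pq {X = 1} pp qp g⊥g′
        (trans (ℕ.*-comm g g′) (trans (sym pq≡g′g) (sym (ℕ.*-identityʳ (p * q))))))
      where
      g⊥g′ : Coprime g g′
      g⊥g′ {d} (d∣g , d∣g′) = pq-squarefree pp qp p≢q
          (subst (d * d ∣_) (sym pq≡g′g) (*-pres-∣ d∣g′ d∣g))
      go : (∃ λ D → ∃ λ D′ → ∃ λ s′ → ∃ λ t′ → Factor p q D D′ ×
           g ≡ D * s′ × g′ ≡ D′ * t′ × Coprime s′ t′ × s′ * t′ ≡ 1) → ∃ λ g′ → Factor p q g g′
      go (D , D′ , s′ , t′ , DD′ , g≡ , _ , _ , s′t′≡1) = D′ , subst (λ g → Factor p q g D′)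
        (sym (trans g≡ (trans (cong (D *_) (ℕ.m*n≡1⇒m≡1 s′ t′ s′t′≡1)) (ℕ.*-identityʳ D)))) DD′

    -- `c` is coprime to `a t`, so both are squares. The gcd of `a` and `t` divides `p q c²` by
    -- `common` and is coprime to `c`, hence divides `p q`; removing it leaves coprime factors of a
    -- square.
    decompose : ∀ {a c t w} → a ≢ 0 → Coprime a c → Coprime t c →
                (∀ {d} → d ∣ a → d ∣ t → d ∣ p * q * (c * c)) → w * w ≡ c * (a * t) →
                  Decomposition a c t
    decompose {a} {c} {t} {w} a≢0 a⊥c t⊥c common w²≡ =
      with-roots (coprime-*≡□ {c} {a * t} {w} (Coprime.sym (coprime-* a⊥c t⊥c)) (sym w²≡))
      where
      with-roots : (∃ λ e → ∃ λ m → c ≡ e * e × a * t ≡ m * m × e * m ≡ w) → Decomposition a c t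
      with-roots (e , m , c≡e² , at≡m² , _) = with-gcd (gcd-split a t)
        where
        with-gcd : (∃ λ g → ∃ λ a′ → ∃ λ t′ → a ≡ a′ * g × t ≡ t′ * g × Coprime a′ t′) →
          Decomposition a c t
        with-gcd (zero , a′ , _ , a≡ , _) = contradiction (trans a≡ (ℕ.*-zeroʳ a′)) a≢0
        with-gcd (g@(suc _) , a′ , t′ , a≡ , t≡ , a′⊥t′) =
            with-factor (factor g∣pq) (m²∣n²⇒m∣n g²∣m²)
          where
          g∣a : g ∣ a
          g∣a = divides a′ a≡
          lem : ∀ a t g → (a * g) * (t * g) ≡ (a * t) * (g * g)
          lem = ℕ-Solver.solve-∀
          m²≡ : m * m ≡ (a′ * t′) * (g * g)
          m²≡ = trans (sym at≡m²) (trans (cong₂ _*_ a≡ t≡) (lem a′ t′ g))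
          g²∣m² : g * g ∣ m * m
          g²∣m² = divides (a′ * t′) m²≡
          g∣pq : g ∣ p * q
          g∣pq = coprime-divisor {m = g}
              (Coprime.sym (coprime-* (Coprime.sym g⊥c) (Coprime.sym g⊥c)))
            (subst (g ∣_) (ℕ.*-comm (p * q) (c * c)) (common g∣a (divides t′ t≡)))
            where g⊥c = coprime-∣ˡ g∣a a⊥c
          with-factor : (∃ λ g′ → Factor p q g g′) → g ∣ m → Decomposition a c t
          with-factor (g′ , gg′) (divides m′ m≡) =
              finish (coprime-*≡□ {a′} {t′} {m′} a′⊥t′ a′t′≡m′²)
            where
            a′t′≡m′² : a′ * t′ ≡ m′ * m′
            a′t′≡m′² = ℕ.*-cancelʳ-≡ (a′ * t′) (m′ * m′) (g * g)
              (trans (sym m²≡) (trans (cong₂ _*_ m≡ m≡) (lem m′ m′ g)))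
            finish : (∃ λ u → ∃ λ r → a′ ≡ u * u × t′ ≡ r * r × u * r ≡ m′) → Decomposition a c t
            finish (u , r , a′≡ , t′≡ , _) = g , g′ , u , e , r , gg′ ,
              a≡gu² , c≡e² , trans t≡ (trans (cong (_* g) t′≡) (ℕ.*-comm (r * r) g)) ,
              coprime-√ (subst (Coprime (u * u)) c≡e² (coprime-∣ˡ (divides g a≡gu²) a⊥c))
              where
              a≡gu² : a ≡ g * (u * u)
              a≡gu² = trans a≡ (trans (cong (_* g) a′≡) (ℕ.*-comm (u * u) g))

    nonzero-factors : ∀ {g g′} → Factor p q g g′ → g ≢ 0
    nonzero-factors {g} {g′} gg′ refl =
        ℕ.≢-nonZero⁻¹ (p * q) {{ℕ.m*n≢0 p q {{prime⇒nonZero pp}} {{prime⇒nonZero qp}}}}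
      (sym (factor-*≡ gg′))

    private
      fourth : ℕ → ℕ
      fourth z = z * z * (z * z)

      cancel : ∀ {g x y} → g ≢ 0 → g * x ≡ g * y → x ≡ y
      cancel {g} g≢0 = ℕ.*-cancelˡ-≡ _ _ g {{ℕ.≢-nonZero g≢0}}

      lem-a : ∀ g u → g * (g * (u * u * (u * u))) ≡ g * (u * u) * (g * (u * u))
      lem-a = ℕ-Solver.solve-∀
      lem-b : ∀ g g′ e r → g * g′ * (e * e * (e * e)) + g * (r * r) ≡
        g * (g′ * (e * e * (e * e)) + r * r)
      lem-b = ℕ-Solver.solve-∀
      lem-c : ∀ g u r → g * (u * u) * (g * (u * u)) + g * (r * r) ≡
        g * (g * (u * u * (u * u)) + r * r)
      lem-c = ℕ-Solver.solve-∀

    -- Dividing `a² = p q c² + t` by `g` gives `g u⁴ = g′ e⁴ + r²`: the descent equation for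
    -- `g = 1`, and one of the `Eᵢ` for the other classes.
    no-positive : ∀ {a c t w} → a ≢ 0 → c ≢ 0 → Coprime a c → a * a ≡ p * q * (c * c) + t →
                  w * w ≢ c * (a * t)
    no-positive {a} {c} {t} {w} a≢0 c≢0 a⊥c a²≡ w²≡ =
        go (decompose {a} {c} {t} {w} a≢0 a⊥c t⊥c common w²≡) a²≡
      where
      t⊥c : Coprime t c
      t⊥c {d} (d∣t , d∣c) = coprime-* a⊥c a⊥c
        (subst (d ∣_) (sym a²≡) (∣m∣n⇒∣m+n (∣n⇒∣m*n (p * q) (∣m⇒∣m*n c d∣c)) d∣t) , d∣c)
      common : ∀ {d} → d ∣ a → d ∣ t → d ∣ p * q * (c * c)
      common {d} d∣a d∣t = ∣m+n∣n⇒∣m (subst (d ∣_) a²≡ (∣m⇒∣m*n a d∣a)) d∣t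
      go : Decomposition a c t → a * a ≡ p * q * (c * c) + t → ⊥
      go (g , g′ , u , e , r , gg′ , refl , refl , refl , u⊥e) a²≡ = finish gg′
        (cancel (nonzero-factors gg′) (trans (lem-a g u) (trans a²≡
          (trans (cong (λ n → n * (e * e * (e * e)) + g * (r * r)) (sym (factor-*≡ gg′)))
            (lem-b g g′ e r)))))
        where
        e≢0 : e ≢ 0
        e≢0 refl = c≢0 refl
        finish : ∀ {g g′} → Factor p q g g′ → g * fourth u ≡ g′ * fourth e + r * r → ⊥
        finish 1·pq eq = no-solution {u} {r} {e} e≢0 u⊥e
          (trans (sym (ℕ.*-identityˡ (fourth u))) (trans eq (ℕ.+-comm (p * q * fourth e) (r * r))))
        finish p·q  eq = E₃ {e} {u} {r} (Coprime.sym u⊥e) (sym eq)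
        finish q·p  eq = E₂ {e} {u} {r} (Coprime.sym u⊥e) (sym eq)
        finish pq·1 eq = E₁ {e} {u} {r} (Coprime.sym u⊥e)
          (trans (cong (_+ r * r) (sym (ℕ.*-identityˡ (fourth e)))) (sym eq))

    -- Division by `g` now gives `g′ e⁴ = g u⁴ + r²`. The descent equation occurs for `g = p q`,
    -- with `u` and `e` exchanged, so the nonzero variable has to be `u`.
    no-negative : ∀ {a c t w} → a ≢ 0 → Coprime a c → p * q * (c * c) ≡ a * a + t →
                  w * w ≢ c * (a * t)
    no-negative {a} {c} {t} {w} a≢0 a⊥c c²≡ w²≡ =
        go (decompose {a} {c} {t} {w} a≢0 a⊥c t⊥c common w²≡) c²≡
      where
      t⊥c : Coprime t c
      t⊥c {d} (d∣t , d∣c) = coprime-* a⊥c a⊥c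
        (∣m+n∣n⇒∣m (subst (d ∣_) c²≡ (∣n⇒∣m*n (p * q) (∣m⇒∣m*n c d∣c))) d∣t , d∣c)
      common : ∀ {d} → d ∣ a → d ∣ t → d ∣ p * q * (c * c)
      common {d} d∣a d∣t = subst (d ∣_) (sym c²≡) (∣m∣n⇒∣m+n (∣m⇒∣m*n a d∣a) d∣t)
      go : Decomposition a c t → p * q * (c * c) ≡ a * a + t → ⊥
      go (g , g′ , u , e , r , gg′ , refl , refl , refl , u⊥e) c²≡ = finish gg′
        (cancel (nonzero-factors gg′) (trans (sym (ℕ.*-assoc g g′ (fourth e)))
          (trans (cong (_* fourth e) (factor-*≡ gg′)) (trans c²≡ (lem-c g u r)))))
        where
        u≢0 : u ≢ 0
        u≢0 refl = a≢0 (ℕ.*-zeroʳ g)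
        finish : ∀ {g g′} → Factor p q g g′ → g′ * fourth e ≡ g * fourth u + r * r → ⊥
        finish 1·pq eq = E₁ {u} {e} {r} u⊥e
            (trans (cong (_+ r * r) (sym (ℕ.*-identityˡ (fourth u)))) (sym eq))
        finish p·q  eq = E₂ {u} {e} {r} u⊥e (sym eq)
        finish q·p  eq = E₃ {u} {e} {r} u⊥e (sym eq)
        finish pq·1 eq = no-solution {e} {r} {u} u≢0 (Coprime.sym u⊥e)
          (trans (sym (ℕ.*-identityˡ (fourth e))) (trans eq (ℕ.+-comm (p * q * fourth u) (r * r))))

module QuadraticResidues where

  open import Data.Empty using (⊥)
  import Data.Fin.Base as Fin
  import Data.Fin.Properties as Fin
  open import Data.Integer.Base using (ℤ; +_; -[1+_]; _+_; _*_; _-_; -_; 0ℤ; 1ℤ; -1ℤ)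
  import Data.Integer.Base as ℤ
  open import Data.Integer.DivMod using (_%ℕ_; _/ℕ_; a≡a%ℕn+[a/ℕn]*n; n%ℕd<d)
  import Data.Integer.Divisibility as Unsigned
  open import Data.Integer.Divisibility.Signed
  import Data.Integer.Properties as ℤ
  import Data.Integer.Tactic.RingSolver as ℤ-Solver
  open import Data.List.Base using ([]; _∷_; length; applyUpTo; _++_)
  open import Data.List.Membership.Propositional using (_∈_)
  open import Data.List.Membership.Propositional.Properties using (∈-∃++; ∈-applyUpTo⁺; ∈-applyUpTo⁻)
  open import Data.List.Properties using (length-applyUpTo)
  open import Data.List.Relation.Binary.Permutation.Propositional using (↭-sym; ↭⇒↭ₛ)
  open import Data.List.Relation.Binary.Permutation.Propositional.Properties using (shift; ∈-resp-↭; ↭-length)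
  import Data.List.Relation.Binary.Permutation.Setoid.Properties as Permutation
  import Data.List.Relation.Unary.All as All
  open import Data.List.Relation.Unary.AllPairs using ([]; _∷_)
  open import Data.List.Relation.Unary.Any using (here; there)
  open import Data.List.Relation.Unary.Unique.Propositional using (Unique)
  open import Data.List.Relation.Unary.Unique.Propositional.Properties using (applyUpTo⁺₁)
  open import Data.Nat.Base using (ℕ; zero; suc; NonZero; s≤s; z≤n; _%_; _/_; _<_; _≤_)
  import Data.Nat.Base as ℕ
  open import Data.Nat.Coprimality using (Coprime; coprime-Bézout)
  import Data.Nat.Coprimality as Coprime
  open import Data.Nat.DivMod
    using (%-distribˡ-+; %-distribˡ-*; m%n<n; m%n%n≡m%n; m∣n⇒o%n%m≡o%m; m%n≤m; m≡m%n+[m/n]*n)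
  import Data.Nat.Divisibility as ℕ
  open import Data.Nat.GCD using (module Bézout)
  open import Data.Nat.Induction using (<-wellFounded; Acc; acc)
  open import Data.Nat.Primality using (Prime; euclidsLemma; prime⇒nonZero; prime⇒nonTrivial; prime[2])
  import Data.Nat.Properties as ℕ
  import Data.Nat.Tactic.RingSolver as ℕ-Solver
  open import Data.Product.Base using (∃; _×_; _,_; proj₁; proj₂)
  open import Data.Sum.Base using (_⊎_; inj₁; inj₂; [_,_]′; reduce)
  open import Defs using (_≅_[mod_]; _≅?_[mod_]; legendre)
  open import Function.Base using (_∘_)
  open import Relation.Binary.PropositionalEquality
  open import Relation.Nullary using (Dec; ¬_; contradiction; yes; no)
  open import Relation.Nullary.Decidable using (from-yes; _→-dec_; _⊎-dec_; _×-dec_; ¬?)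
  open NaturalNumbers

  -- Reduction of equations modulo a prime, and pairings on finite lists

  euclidsLemmaℤ : ∀ {q} → Prime q → ∀ a b → + q ∣ a * b → + q ∣ a ⊎ + q ∣ b
  euclidsLemmaℤ {q} qp a b q∣ab
    with euclidsLemma ℤ.∣ a ∣ ℤ.∣ b ∣ qp (subst (q ℕ.∣_) (ℤ.abs-* a b) (∣⇒∣ᵤ q∣ab))
  ... | inj₁ q∣a = inj₁ (∣ᵤ⇒∣ q∣a)
  ... | inj₂ q∣b = inj₂ (∣ᵤ⇒∣ q∣b)

  prime∣□⇒∣ : ∀ {q} → Prime q → ∀ a → + q ∣ a * a → + q ∣ a
  prime∣□⇒∣ qp a = reduce ∘ euclidsLemmaℤ qp a a

  inverse-mod : ∀ {q} → Prime q → ∀ a → ¬ + q ∣ a → ∃ λ z → + q ∣ a * z - 1ℤ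
  inverse-mod {q} qp a q∤a = signed a (coprime-Bézout (prime∤⇒coprime qp (q∤a ∘ ∣ᵤ⇒∣)))
    where
    lift : ∀ x y m n → 1 ℕ.+ y ℕ.* n ≡ x ℕ.* m → 1ℤ + + y * + n ≡ + x * + m
    lift x y m n eq = trans (cong (λ z → 1ℤ + z) (sym (ℤ.pos-* y n)))
        (trans (cong +_ eq) (ℤ.pos-* x m))
    natural : ∀ {n} → Bézout.Identity 1 q n → ∃ λ z → + q ∣ + n * z - 1ℤ
    natural {n} (Bézout.+- x y eq) = - + y , divides (- + x)
      (trans (lem (+ n) (+ y)) (trans (cong -_ (lift x y q n eq)) (ℤ.neg-distribˡ-* (+ x) (+ q))))
      where
      lem : ∀ n y → n * (- y) - 1ℤ ≡ - (1ℤ + y * n)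
      lem = ℤ-Solver.solve-∀
    natural {n} (Bézout.-+ x y eq) = + y , divides (+ x)
      (trans (cong (_- 1ℤ) (trans (ℤ.*-comm (+ n) (+ y)) (sym (lift y x n q eq))))
        (lem (+ x * + q)))
      where
      lem : ∀ z → 1ℤ + z - 1ℤ ≡ z
      lem = ℤ-Solver.solve-∀
    signed : ∀ a → Bézout.Identity 1 q ℤ.∣ a ∣ → ∃ λ z → + q ∣ a * z - 1ℤ
    signed (+ n)    b = natural b
    signed -[1+ n ] b with natural b
    ... | z , q∣ = - z , subst (λ y → + q ∣ y - 1ℤ) (lem (+ suc n) z) q∣
      where
      lem : ∀ a z → a * z ≡ (- a) * (- z)
      lem = ℤ-Solver.solve-∀

  -- Multiplying by `z²`, with `z` inverse to `a`, turns the quotient `w / a` into the integer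
  -- `w z`.
  divide-square : ∀ {q} → Prime q → ∀ e c {w a} → ¬ + q ∣ a →
    + q ∣ e * (w * w) - c * (a * a) → ∃ λ x → + q ∣ e * (x * x) - c
  divide-square {q} qp e c {w} {a} q∤a q∣ = go (inverse-mod qp a q∤a)
    where
    go : (∃ λ z → + q ∣ a * z - 1ℤ) → ∃ λ x → + q ∣ e * (x * x) - c
    go (z , q∣az-1) = w * z , subst (+ q ∣_) (lem e c w a z)
      (∣m∣n⇒∣m+n (∣m⇒∣m*n (z * z) q∣) (∣n⇒∣m*n (c * (a * z + 1ℤ)) q∣az-1))
      where
      lem : ∀ e c w a z → (e * (w * w) - c * (a * a)) * (z * z) + c * (a * z + 1ℤ) * (a * z - 1ℤ) ≡
                          e * ((w * z) * (w * z)) - c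
      lem = ℤ-Solver.solve-∀

  -- If `q ∣ a`, then `q ∣ w`, so `q²` divides `q m b²` and `q ∣ b`, which is excluded. Hence `a` is
  -- invertible and the equation modulo `q` can be divided by `a²`.
  local-square : ∀ {q} → Prime q → ∀ e c m {w a b} →
    e * (w * w) ≡ c * (a * a) + + q * (m * (b * b)) →
    ¬ (+ q ∣ a × + q ∣ b) → ¬ + q ∣ e → ¬ + q ∣ m →
    ∃ λ x → + q ∣ e * (x * x) - c
  local-square {q} qp e c m {w} {a} {b} eq q∤ab q∤e q∤m =
    divide-square qp e c {w} {a} q∤a
        (subst (+ q ∣_) (trans (lem (c * (a * a)) (+ q * (m * (b * b))))
          (cong (_- c * (a * a)) (sym eq))) q∣qm)
    where
    instance _ = prime⇒nonZero qp
    q∣qm : + q ∣ + q * (m * (b * b))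
    q∣qm = ∣m⇒∣m*n (m * (b * b)) ∣-refl
    lem : ∀ x y → y ≡ x + y - x
    lem = ℤ-Solver.solve-∀
    q∤a : ¬ + q ∣ a
    q∤a q∣a = q∤ab (q∣a , q∣b q∣a q∣w)
      where
      q∣w : + q ∣ w
      q∣w with euclidsLemmaℤ qp e (w * w) (subst (+ q ∣_) (sym eq)
        (∣m∣n⇒∣m+n (∣n⇒∣m*n c (∣m⇒∣m*n a q∣a)) q∣qm))
      ... | inj₁ q∣e = contradiction q∣e q∤e
      ... | inj₂ q∣w² = prime∣□⇒∣ qp w q∣w²
      q∣b : + q ∣ a → + q ∣ w → + q ∣ b
      q∣b (divides a′ refl) (divides w′ refl) with euclidsLemmaℤ qp m (b * b)
        (divides (e * (w′ * w′) - c * (a′ * a′)) (ℤ.*-cancelˡ-≡ (+ q) _ _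
          (trans (lem₁ (+ q) m b (c * (a′ * + q * (a′ * + q))))
            (trans (cong (_- c * (a′ * + q * (a′ * + q))) (sym eq))
            (lem₂ e w′ c a′ (+ q))))))
        where
        lem₁ : ∀ q m b x → q * (m * (b * b)) ≡ x + q * (m * (b * b)) - x
        lem₁ = ℤ-Solver.solve-∀
        lem₂ : ∀ e w c a q → e * (w * q * (w * q)) - c * (a * q * (a * q)) ≡
          q * ((e * (w * w) - c * (a * a)) * q)
        lem₂ = ℤ-Solver.solve-∀
      ... | inj₁ q∣m = contradiction q∣m q∤m
      ... | inj₂ q∣b² = prime∣□⇒∣ qp b q∣b²

  -- The head and its partner are removed together; uniqueness of partners keeps the rest closed.
  -- The bound `n` drives the recursion, because the remaining list is not a subterm.
  perfect-matching : ∀ {A : Set} (R : A → A → Set) → (∀ {x y} → R x y → R y x) →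
    ∀ n xs → length xs ℕ.≤ n → Unique xs →
    (∀ {x y z} → y ∈ xs → z ∈ xs → R x y → R x z → y ≡ z) →
    (∀ {x} → x ∈ xs → ∃ λ y → y ∈ xs × R x y) → (∀ {x} → x ∈ xs → ¬ R x x) → 2 ℕ.∣ length xs
  perfect-matching R R-sym _ [] _ _ _ _ _ = 2 ℕ.∣0
  perfect-matching R R-sym (suc n) (x ∷ xs) (s≤s xs≤n) (x∉xs ∷ uniq) functional total irrefl
    with total (here refl)
  ... | y , here refl , Rxy = contradiction Rxy (irrefl (here refl))
  ... | y , there y∈xs , Rxy with ∈-∃++ y∈xs
  ... | as , bs , refl with (as ++ bs) | shift y as bs
  ... | zs | xs↭ = subst (2 ℕ.∣_) (cong suc (sym (↭-length xs↭)))
    (ℕ.∣m∣n⇒∣m+n ℕ.∣-refl (perfect-matching R R-sym n zs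
      (ℕ.≤-trans (ℕ.n≤1+n _) (subst (ℕ._≤ n) (↭-length xs↭) xs≤n)) uniq-zs
      (λ y∈ z∈ → functional (⊆ y∈) (⊆ z∈)) total′ (irrefl ∘ ⊆)))
    where
    uniq-y∷zs : Unique (y ∷ zs)
    uniq-y∷zs = Permutation.Unique-resp-↭ (setoid _) (↭⇒↭ₛ xs↭) uniq
    uniq-zs : Unique zs
    uniq-zs with uniq-y∷zs
    ... | _ ∷ u = u
    y∉zs : ∀ {z} → z ∈ zs → y ≢ z
    y∉zs z∈ with uniq-y∷zs
    ... | y≢ ∷ _ = All.lookup y≢ z∈
    ⊆ : ∀ {z} → z ∈ zs → z ∈ x ∷ as ++ y ∷ bs
    ⊆ z∈ = there (∈-resp-↭ (↭-sym xs↭) (there z∈))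
    total′ : ∀ {z} → z ∈ zs → ∃ λ w → w ∈ zs × R z w
    total′ {z} z∈ with total (⊆ z∈)
    ... | w , here refl , Rzw = contradiction (functional (there y∈xs) (⊆ z∈) Rxy (R-sym Rzw))
        (y∉zs z∈)
    ... | w , there w∈ , Rzw with ∈-resp-↭ xs↭ w∈
    ... | here refl = contradiction (functional (here refl) (⊆ z∈) (R-sym Rxy) (R-sym Rzw))
          (All.lookup x∉xs (∈-resp-↭ (↭-sym xs↭) (there z∈)))
    ... | there w∈zs = w , w∈zs , Rzw

  -- Nonresidues by descent on the modulus

  infix 4 _≋_[%_]
  _≋_[%_] : ℕ → ℕ → (d : ℕ) .{{_ : NonZero d}} → Set
  m ≋ n [% d ] = m % d ≡ n % d

  module _ {d : ℕ} .{{_ : NonZero d}} where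

    %-≡ : ∀ m → m % d ≋ m [% d ]
    %-≡ m = m%n%n≡m%n m d

    +-≡% : ∀ {m n o r} → m ≋ n [% d ] → o ≋ r [% d ] → m ℕ.+ o ≋ n ℕ.+ r [% d ]
    +-≡% {m} {n} {o} {r} m≡n o≡r = trans (%-distribˡ-+ m o d)
      (trans (cong₂ (λ x y → (x ℕ.+ y) % d) m≡n o≡r) (sym (%-distribˡ-+ n r d)))

    *-≡% : ∀ {m n o r} → m ≋ n [% d ] → o ≋ r [% d ] → m ℕ.* o ≋ n ℕ.* r [% d ]
    *-≡% {m} {n} {o} {r} m≡n o≡r = trans (%-distribˡ-* m o d)
      (trans (cong₂ (λ x y → (x ℕ.* y) % d) m≡n o≡r) (sym (%-distribˡ-* n r d)))

  -- A negative quotient would give `c₂ = x² + c₁ + (k + 1) n`, hence `n ≤ c₂ ≤ 2`. Writing the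
  -- constant as `c₂ - c₁` lets either sign be moved to its own side of an equation in `ℕ`.
  nat-square : ∀ {n c₁ c₂ x} → 3 ≤ n → c₂ ≤ 2 → + n ∣ + x * + x - (+ c₂ - + c₁) →
               ∃ λ k → x ℕ.* x ℕ.+ c₁ ≡ n ℕ.* k ℕ.+ c₂
  nat-square {n} {c₁} {c₂} {x} 3≤n c₂≤2 (divides (+ k) eq) = k , ℤ.+-injective (begin
    + (x ℕ.* x ℕ.+ c₁)                     ≡⟨ cong (λ z → z + + c₁) (ℤ.pos-* x x) ⟩
    + x * + x + + c₁                       ≡⟨ lem (+ x * + x) (+ c₁) (+ c₂) ⟩
    + x * + x - (+ c₂ - + c₁) + + c₂       ≡⟨ cong (λ z → z + + c₂)
        (trans eq (ℤ.*-comm (+ k) (+ n))) ⟩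
    + n * + k + + c₂                       ≡⟨ cong (λ z → z + + c₂) (sym (ℤ.pos-* n k)) ⟩
    + (n ℕ.* k ℕ.+ c₂)                     ∎)
    where
    open ≡-Reasoning
    lem : ∀ x c d → x + c ≡ x - (d - c) + d
    lem = ℤ-Solver.solve-∀
  nat-square {n} {c₁} {c₂} {x} 3≤n c₂≤2 (divides -[1+ k ] eq) =
    contradiction (ℕ.≤-trans 3≤n (ℕ.≤-trans n≤c₂ c₂≤2)) λ { (s≤s (s≤s ())) }
    where
    lem : ∀ x c d n k → d ≡ x + c + k * n - (x - (d - c) - (- k) * n)
    lem = ℤ-Solver.solve-∀
    lem′ : ∀ z → z - 0ℤ ≡ z
    lem′ = ℤ-Solver.solve-∀
    c₂≡ : c₂ ≡ x ℕ.* x ℕ.+ c₁ ℕ.+ suc k ℕ.* n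
    c₂≡ = ℤ.+-injective (trans (lem (+ x * + x) (+ c₁) (+ c₂) (+ n) (+ suc k))
      (trans (cong (λ z → + x * + x + + c₁ + + suc k * + n - z) (ℤ.i≡j⇒i-j≡0 eq))
      (trans (lem′ _) (cong₂ (λ y z → y + + c₁ + z) (sym (ℤ.pos-* x x))
        (sym (ℤ.pos-* (suc k) n))))))
    n≤c₂ : n ≤ c₂
    n≤c₂ = subst (n ≤_) (sym c₂≡)
        (ℕ.≤-trans (ℕ.m≤m+n n (k ℕ.* n)) (ℕ.m≤n+m (n ℕ.+ k ℕ.* n) (x ℕ.* x ℕ.+ c₁)))

  cofactor< : ∀ {n k x c₁ c₂} → 3 ≤ n → c₁ ≤ 2 → x < n → x ℕ.* x ℕ.+ c₁ ≡ n ℕ.* k ℕ.+ c₂ → k < n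
  cofactor< {n} {k} {x} {c₁} {c₂} 3≤n c₁≤2 x<n eq = ℕ.*-cancelˡ-< n k n (begin-strict
    n ℕ.* k              ≤⟨ ℕ.m≤m+n _ c₂ ⟩
    n ℕ.* k ℕ.+ c₂       ≡⟨ sym eq ⟩
    x ℕ.* x ℕ.+ c₁       ≤⟨ ℕ.+-monoʳ-≤ (x ℕ.* x) c₁≤2 ⟩
    x ℕ.* x ℕ.+ 2        <⟨ ℕ.+-monoʳ-< (x ℕ.* x) 3≤n ⟩
    x ℕ.* x ℕ.+ n        ≤⟨ ℕ.+-monoˡ-≤ n (ℕ.*-monoʳ-≤ x (ℕ.<⇒≤ x<n)) ⟩
    x ℕ.* n ℕ.+ n        ≡⟨ ℕ.+-comm _ n ⟩
    suc x ℕ.* n          ≤⟨ ℕ.*-monoˡ-≤ n x<n ⟩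
    n ℕ.* n              ∎)
    where open ℕ.≤-Reasoning

  -- A root x of x² ≡ c modulo n can be taken below n with x ≡ b modulo 2.  Then the
  -- cofactor (x² - c) / n is smaller than n and, like n, congruent to a₁ or a₂ modulo 8.
  -- Here c is c₂ - c₁.
  module NonResidue (b a₁ a₂ c₁ c₂ : ℕ) (3≤a₁ : 3 ≤ a₁) (3≤a₂ : 3 ≤ a₂)
    (odd-a₁ : a₁ % 2 ≡ 1) (odd-a₂ : a₂ % 2 ≡ 1) (c₁≤2 : c₁ ≤ 2) (c₂≤2 : c₂ ≤ 2)
    (c∤ : ∀ {n} → + n ∣ + c₂ - + c₁ → n ≤ 2)
    (parity : ∀ {r} → r < 2 → ∀ {s} → s < 2 → (r ℕ.+ s) % 2 ≡ 1 → r ≡ b ⊎ s ≡ b)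
    (table : ∀ {x} → x < 8 → ∀ {n} → n < 8 → ∀ {k} → k < 8 → x % 2 ≡ b → n ≡ a₁ ⊎ n ≡ a₂ →
             x ℕ.* x ℕ.+ c₁ ≋ n ℕ.* k ℕ.+ c₂ [% 8 ] → k ≡ a₁ ⊎ k ≡ a₂)
    where

    Bad : ℕ → Set
    Bad n = n % 8 ≡ a₁ ⊎ n % 8 ≡ a₂

    3≤bad : ∀ {n} → Bad n → 3 ≤ n
    3≤bad {n} bad = ℕ.≤-trans ([ (λ e → subst (3 ≤_) (sym e) 3≤a₁) ,
        (λ e → subst (3 ≤_) (sym e) 3≤a₂) ]′ bad) (m%n≤m n 8)

    odd : ∀ {n} → Bad n → n % 2 ≡ 1
    odd {n} bad = trans (sym (m∣n⇒o%n%m≡o%m 2 8 n (ℕ.divides 4 refl)))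
      ([ (λ e → trans (cong (_% 2) e) odd-a₁) , (λ e → trans (cong (_% 2) e) odd-a₂) ]′ bad)

    cofactor-bad : ∀ {x n k} → x % 2 ≡ b → Bad n → x ℕ.* x ℕ.+ c₁ ≡ n ℕ.* k ℕ.+ c₂ → Bad k
    cofactor-bad {x} {n} {k} x≡b bad eq = table (m%n<n x 8) (m%n<n n 8) (m%n<n k 8)
      (trans (m∣n⇒o%n%m≡o%m 2 8 x (ℕ.divides 4 refl)) x≡b) bad
      (trans (residues x x c₁) (trans (cong (_% 8) eq) (sym (residues n k c₂))))
      where
      residues : ∀ m n c → (m % 8) ℕ.* (n % 8) ℕ.+ c ≋ m ℕ.* n ℕ.+ c [% 8 ]
      residues m n c = +-≡% {m = (m % 8) ℕ.* (n % 8)} {n = m ℕ.* n} {o = c} {r = c}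
        (*-≡% {m = m % 8} {n = m} {o = n % 8} {r = n} (%-≡ m) (%-≡ n)) refl

    SmallRoot : ℕ → Set
    SmallRoot n = ∃ λ r → r < n × r % 2 ≡ b × + n ∣ + r * + r - (+ c₂ - + c₁)

    -- Both `r` and `n - r` are roots, and one has parity `b` because `n` is odd. The value `r = 0`
    -- would make `n` divide the constant; excluding it keeps `n - r` below `n`.
    small-root : ∀ {n} → Bad n → ∀ r t → r < n →
      + n ∣ (+ r + t * + n) * (+ r + t * + n) - (+ c₂ - + c₁) →
                 SmallRoot n
    small-root {n} bad r t r<n n∣ = choose (parity (m%n<n r 2) (m%n<n (n ℕ.∸ r) 2)
      (trans (sym (%-distribˡ-+ r (n ℕ.∸ r) 2))
        (trans (cong (_% 2) (ℕ.m+[n∸m]≡n (ℕ.<⇒≤ r<n))) (odd {n} bad))))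
      where
      n∣r : + n ∣ + r * + r - (+ c₂ - + c₁)
      n∣r = subst (+ n ∣_) (lem (+ r) t (+ n) (+ c₂ - + c₁))
        (∣m∣n⇒∣m-n n∣ (∣m⇒∣m*n (t * (+ r + + r + t * + n)) ∣-refl))
        where
        lem : ∀ r t n c → (r + t * n) * (r + t * n) - c - n * (t * (r + r + t * n)) ≡ r * r - c
        lem = ℤ-Solver.solve-∀
      r≢0 : r ≢ 0
      r≢0 refl = ℕ.<⇒≱ (3≤bad {n} bad) (c∤ (subst (+ n ∣_) (lem (+ c₂ - + c₁)) (∣m⇒∣-m n∣r)))
        where
        lem : ∀ c → - (0ℤ * 0ℤ - c) ≡ c
        lem = ℤ-Solver.solve-∀
      n∸r<n : n ℕ.∸ r < n
      n∸r<n = ℕ.∸-monoʳ-< {n} {r} {0} (ℕ.n≢0⇒n>0 r≢0) (ℕ.<⇒≤ r<n)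
      n∣n∸r : + n ∣ + (n ℕ.∸ r) * + (n ℕ.∸ r) - (+ c₂ - + c₁)
      n∣n∸r = subst (+ n ∣_) (trans (lem (+ r) (+ n) (+ c₂ - + c₁))
          (cong (λ s → s * s - (+ c₂ - + c₁)) n-r≡))
          (∣m∣n⇒∣m+n n∣r (∣m⇒∣m*n (+ n - + r - + r) ∣-refl))
        where
        n-r≡ : + n - + r ≡ + (n ℕ.∸ r)
        n-r≡ = trans (ℤ.m-n≡m⊖n n r) (ℤ.⊖-≥ (ℕ.<⇒≤ r<n))
        lem : ∀ r n c → r * r - c + n * (n - r - r) ≡ (n - r) * (n - r) - c
        lem = ℤ-Solver.solve-∀
      choose : r % 2 ≡ b ⊎ (n ℕ.∸ r) % 2 ≡ b → SmallRoot n
      choose (inj₁ r≡b) = r , r<n , r≡b , n∣r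
      choose (inj₂ s≡b) = n ℕ.∸ r , n∸r<n , s≡b , n∣n∸r

    -- Modulus and cofactor exchange roles: `k` divides `r² - c` with quotient `n`, so `r` is a root
    -- modulo the smaller `k`.
    rec : ∀ {n} → Acc _<_ n → Bad n → ∀ x → ¬ + n ∣ x * x - (+ c₂ - + c₁)
    rec {n} (acc rs) bad x n∣ with small-root bad (x %ℕ n) (x /ℕ n) (n%ℕd<d x n)
      (subst (λ x → + n ∣ x * x - (+ c₂ - + c₁)) (a≡a%ℕn+[a/ℕn]*n x n) n∣)
      where instance _ = ℕ.>-nonZero (ℕ.≤-trans (s≤s z≤n) (3≤bad {n} bad))
    ... | r , r<n , r≡b , n∣r with nat-square {n} {c₁} {c₂} {r} (3≤bad {n} bad) c₂≤2 n∣r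
    ... | k , eq = rec (rs (cofactor< {n} {k} {r} {c₁} {c₂} (3≤bad {n} bad) c₁≤2 r<n eq))
        (cofactor-bad {r} {n} {k} r≡b bad eq) (+ r)
      (divides (+ n) (trans (lem (+ r * + r) (+ c₁) (+ c₂))
        (trans (cong (λ z → z - + c₂)
          (trans (cong (λ z → z + + c₁) (sym (ℤ.pos-* r r)))
            (trans (cong +_ eq) (cong (λ z → z + + c₂) (ℤ.pos-* n k)))))
          (lem″ (+ n * + k) (+ c₂)))))
      where
      lem : ∀ r c d → r - (d - c) ≡ r + c - d
      lem = ℤ-Solver.solve-∀
      lem″ : ∀ z d → z + d - d ≡ z
      lem″ = ℤ-Solver.solve-∀

    non-residue : ∀ {n} → Bad n → ∀ x → ¬ + n ∣ x * x - (+ c₂ - + c₁)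
    non-residue {n} = rec (<-wellFounded n)

  table? : ∀ b a₁ a₂ c₁ c₂ → _
  table? b a₁ a₂ c₁ c₂ =
    ℕ.allUpTo? (λ x → ℕ.allUpTo? (λ n → ℕ.allUpTo? (λ k →
      (x % 2 ℕ.≟ b) →-dec ((n ℕ.≟ a₁) ⊎-dec (n ℕ.≟ a₂)) →-dec
      ((x ℕ.* x ℕ.+ c₁) % 8 ℕ.≟ (n ℕ.* k ℕ.+ c₂) % 8) →-dec ((k ℕ.≟ a₁) ⊎-dec (k ℕ.≟ a₂))) 8) 8) 8

  parity? : ∀ b → _
  parity? b = ℕ.allUpTo? (λ r →
      ℕ.allUpTo? (λ s → ((r ℕ.+ s) % 2 ℕ.≟ 1) →-dec ((r ℕ.≟ b) ⊎-dec (s ℕ.≟ b))) 2) 2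

  -- For even `x` the number `x² + 1` is 1 modulo 4, so a divisor that is 3 modulo 4 has a cofactor
  -- of the same kind.
  -1-nonresidue : ∀ {n} → n % 4 ≡ 3 → ∀ x → ¬ + n ∣ x * x - -1ℤ
  -1-nonresidue {n} n≡3 = non-residue
      (from-3 (m%n<n n 8) (trans (m∣n⇒o%n%m≡o%m 4 8 n (ℕ.divides 2 refl)) n≡3))
    where
    open NonResidue 0 3 7 1 0 (ℕ.≤ᵇ⇒≤ 3 3 _) (ℕ.≤ᵇ⇒≤ 3 7 _) refl refl (ℕ.≤ᵇ⇒≤ 1 2 _) z≤n
      (λ n∣ → ℕ.≤-trans (ℕ.∣⇒≤ (∣⇒∣ᵤ n∣)) (ℕ.≤ᵇ⇒≤ 1 2 _)) (from-yes (parity? 0))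
        (from-yes (table? 0 3 7 1 0))
    from-3 : ∀ {r} → r < 8 → r % 4 ≡ 3 → r ≡ 3 ⊎ r ≡ 7
    from-3 = from-yes (ℕ.allUpTo? (λ r → (r % 4 ℕ.≟ 3) →-dec ((r ℕ.≟ 3) ⊎-dec (r ℕ.≟ 7))) 8)

  -- For odd `x` the number `x² - 2` is 7 modulo 8. As `3 · 5 ≡ 7`, divisors in the classes 3 and 5
  -- come with cofactors in 5 and 3.
  2-nonresidue : ∀ {n} → n % 8 ≡ 3 ⊎ n % 8 ≡ 5 → ∀ x → ¬ + n ∣ x * x - + 2
  2-nonresidue = non-residue
    where
    open NonResidue 1 3 5 0 2 (ℕ.≤ᵇ⇒≤ 3 3 _) (ℕ.≤ᵇ⇒≤ 3 5 _) refl refl z≤n (ℕ.≤ᵇ⇒≤ 2 2 _)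
      (λ n∣ → ℕ.∣⇒≤ (∣⇒∣ᵤ n∣)) (from-yes (parity? 1)) (from-yes (table? 1 3 5 0 2))

  -- For odd `x` the number `x² + 2` is 3 modulo 8, and `5 · 7 ≡ 3`.
  -2-nonresidue : ∀ {n} → n % 8 ≡ 5 ⊎ n % 8 ≡ 7 → ∀ x → ¬ + n ∣ x * x - - + 2
  -2-nonresidue = non-residue
    where
    open NonResidue 1 5 7 2 0 (ℕ.≤ᵇ⇒≤ 3 5 _) (ℕ.≤ᵇ⇒≤ 3 7 _) refl refl (ℕ.≤ᵇ⇒≤ 2 2 _) z≤n
      (λ n∣ → ℕ.∣⇒≤ (∣⇒∣ᵤ n∣)) (from-yes (parity? 1)) (from-yes (table? 1 5 7 2 0))

  -- Square roots from a pairing of the residues up to sign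

  prime∤small : ∀ {q n} → 0 < n → n < q → ¬ + q ∣ + n
  prime∤small {q} {n} 0<n n<q q∣n = ℕ.<⇒≱ n<q (ℕ.∣⇒≤ {{ℕ.>-nonZero 0<n}} (∣⇒∣ᵤ q∣n))

  residue-injective : ∀ {q y z} → y < q → z < q → + q ∣ + y - + z → y ≡ z
  residue-injective {q} {y} {z} y<q z<q q∣y-z =
    [ (λ y≤z → sym (go y≤z z<q (subst (+ q ∣_) (lem (+ y) (+ z)) (∣m⇒∣-m q∣y-z)))) ,
        (λ z≤y → go z≤y y<q q∣y-z) ]′ (ℕ.≤-total y z)
    where
    lem : ∀ y z → - (y - z) ≡ z - y
    lem = ℤ-Solver.solve-∀
    go : ∀ {m n} → m ≤ n → n < q → + q ∣ + n - + m → n ≡ m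
    go {m} {n} m≤n n<q q∣ with ℕ.m≤n⇒∃[o]m+o≡n m≤n
    ... | zero , refl = ℕ.+-identityʳ m
    ... | suc o , refl = contradiction (subst (+ q ∣_) (lem′ (+ m) (+ suc o)) q∣)
            (prime∤small (s≤s z≤n) (ℕ.≤-<-trans (ℕ.m≤n+m (suc o) m) n<q))
      where
      lem′ : ∀ m o → m + o - m ≡ o
      lem′ = ℤ-Solver.solve-∀

  -- The nonzero residues up to sign are 1, …, h, and x ↦ ± a / x is an
  -- involution on them.
  module HalfSystem {q h : ℕ} (qp : Prime q) (q≡ : q ≡ suc (h ℕ.+ h)) (a : ℤ)
    (q∤a : ¬ + q ∣ a) where

    private instance _ = prime⇒nonZero qp

    R : ℕ → ℕ → Set
    R x y = + q ∣ + x * + y - a ⊎ + q ∣ + x * + y + a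

    R-sym : ∀ {x y} → R x y → R y x
    R-sym {x} {y} = subst (λ z → + q ∣ z - a ⊎ + q ∣ z + a) (ℤ.*-comm (+ x) (+ y))

    h<q : h < q
    h<q = subst (h <_) (sym q≡) (s≤s (ℕ.m≤m+n h h))

    +<q : ∀ {y z} → y ≤ h → z ≤ h → y ℕ.+ z < q
    +<q y≤h z≤h = subst (_ <_) (sym q≡) (s≤s (ℕ.+-mono-≤ y≤h z≤h))

    half-residue : ∀ b → ¬ + q ∣ b → ∃ λ y → 1 ≤ y × y ≤ h × (+ q ∣ b - + y ⊎ + q ∣ b + + y)
    half-residue b q∤b = go (b %ℕ q) (b /ℕ q) (n%ℕd<d b q) (a≡a%ℕn+[a/ℕn]*n b q)
      where
      go : ∀ r t → r < q → b ≡ + r + t * + q → ∃ λ y →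
        1 ≤ y × y ≤ h × (+ q ∣ b - + y ⊎ + q ∣ b + + y)
      go r t r<q b≡ with r ℕ.≤? h
      ... | yes r≤h = r , ℕ.n≢0⇒n>0 (λ { refl → q∤b (divides t (trans b≡ (ℤ.+-identityˡ _))) }) ,
          r≤h ,
        inj₁ (divides t (trans (cong (_- + r) b≡) (lem (+ r) (t * + q))))
        where
        lem : ∀ r t → r + t - r ≡ t
        lem = ℤ-Solver.solve-∀
      ... | no r≰h = q ℕ.∸ r , ℕ.m<n⇒0<n∸m r<q , q-r≤h ,
        inj₂ (divides (t + 1ℤ) (trans (cong₂ _+_ b≡ (sym q-r≡)) (lem (+ r) t (+ q))))
        where
        lem : ∀ r t q → r + t * q + (q - r) ≡ (t + 1ℤ) * q
        lem = ℤ-Solver.solve-∀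
        q-r≡ : + q - + r ≡ + (q ℕ.∸ r)
        q-r≡ = trans (ℤ.m-n≡m⊖n q r) (ℤ.⊖-≥ (ℕ.<⇒≤ r<q))
        q-r≤h : q ℕ.∸ r ≤ h
        q-r≤h = ℕ.m≤n+o⇒m∸n≤o q r (subst (_≤ r ℕ.+ h) (sym q≡) (ℕ.+-monoˡ-≤ h (ℕ.≰⇒> r≰h)))

    total : ∀ {x} → 1 ≤ x → x ≤ h → ∃ λ y → 1 ≤ y × y ≤ h × R x y
    total {x} 1≤x x≤h = invert (inverse-mod qp (+ x) (prime∤small 1≤x (ℕ.≤-<-trans x≤h h<q)))
      where
      invert : (∃ λ z → + q ∣ + x * z - 1ℤ) → ∃ λ y → 1 ≤ y × y ≤ h × R x y
      invert (z , q∣) = finish (half-residue (z * a) q∤za)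
        where
        lem₁ : ∀ x z a → x * (z * a) - (x * z - 1ℤ) * a ≡ a
        lem₁ = ℤ-Solver.solve-∀
        lem₂ : ∀ x z a y → (x * z - 1ℤ) * a - x * (z * a - y) ≡ x * y - a
        lem₂ = ℤ-Solver.solve-∀
        lem₃ : ∀ x z a y → x * (z * a + y) - (x * z - 1ℤ) * a ≡ x * y + a
        lem₃ = ℤ-Solver.solve-∀
        q∤za : ¬ + q ∣ z * a
        q∤za q∣za = q∤a (subst (+ q ∣_) (lem₁ (+ x) z a)
            (∣m∣n⇒∣m-n (∣n⇒∣m*n (+ x) q∣za) (∣m⇒∣m*n a q∣)))
        finish : (∃ λ y → 1 ≤ y × y ≤ h × (+ q ∣ z * a - + y ⊎ + q ∣ z * a + + y)) → ∃ λ y →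
          1 ≤ y × y ≤ h × R x y
        finish (y , 1≤y , y≤h , inj₁ q∣′) = y , 1≤y , y≤h ,
          inj₁ (subst (+ q ∣_) (lem₂ (+ x) z a (+ y))
              (∣m∣n⇒∣m-n (∣m⇒∣m*n a q∣) (∣n⇒∣m*n (+ x) q∣′)))
        finish (y , 1≤y , y≤h , inj₂ q∣′) = y , 1≤y , y≤h ,
          inj₂ (subst (+ q ∣_) (lem₃ (+ x) z a (+ y))
              (∣m∣n⇒∣m-n (∣n⇒∣m*n (+ x) q∣′) (∣m⇒∣m*n a q∣)))

    -- Cancelling `x` leaves `y ≡ z` or `y ≡ - z`, and the latter is impossible because
    -- `0 < y + z < q`.
    functional : ∀ {x y z} → 1 ≤ y → y ≤ h → z ≤ h → R x y → R x z → y ≡ z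
    functional {x} {y} {z} 1≤y y≤h z≤h = go
      where
      q∤x : R x y → ¬ + q ∣ + x
      q∤x (inj₁ q∣) q∣x = q∤a (subst (+ q ∣_) (lem (+ x * + y) a)
          (∣m∣n⇒∣m-n (∣m⇒∣m*n (+ y) q∣x) q∣))
        where
        lem : ∀ z a → z - (z - a) ≡ a
        lem = ℤ-Solver.solve-∀
      q∤x (inj₂ q∣) q∣x = q∤a (subst (+ q ∣_) (lem (+ x * + y) a)
          (∣m∣n⇒∣m-n q∣ (∣m⇒∣m*n (+ y) q∣x)))
        where
        lem : ∀ z a → z + a - z ≡ a
        lem = ℤ-Solver.solve-∀
      cancel : R x y → ∀ {w} → + q ∣ + x * w → + q ∣ w
      cancel Rxy {w} q∣ = [ (λ q∣x → contradiction q∣x (q∤x Rxy)) , (λ q∣w → q∣w) ]′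
          (euclidsLemmaℤ qp (+ x) w q∣)
      same : + q ∣ + y - + z → y ≡ z
      same = residue-injective (ℕ.≤-<-trans y≤h h<q) (ℕ.≤-<-trans z≤h h<q)
      opposite : + q ∣ + y + + z → y ≡ z
      opposite q∣ = contradiction q∣ (prime∤small (ℕ.≤-trans 1≤y (ℕ.m≤m+n y z)) (+<q y≤h z≤h))
      lem₁₁ : ∀ x y z a → x * y - a - (x * z - a) ≡ x * (y - z)
      lem₁₁ = ℤ-Solver.solve-∀
      lem₁₂ : ∀ x y z a → x * y - a + (x * z + a) ≡ x * (y + z)
      lem₁₂ = ℤ-Solver.solve-∀
      lem₂₁ : ∀ x y z a → x * y + a + (x * z - a) ≡ x * (y + z)
      lem₂₁ = ℤ-Solver.solve-∀
      lem₂₂ : ∀ x y z a → x * y + a - (x * z + a) ≡ x * (y - z)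
      lem₂₂ = ℤ-Solver.solve-∀
      go : R x y → R x z → y ≡ z
      go r@(inj₁ ∣y) (inj₁ ∣z) =
          same (cancel r (subst (+ q ∣_) (lem₁₁ (+ x) (+ y) (+ z) a) (∣m∣n⇒∣m-n ∣y ∣z)))
      go r@(inj₁ ∣y) (inj₂ ∣z) =
          opposite (cancel r (subst (+ q ∣_) (lem₁₂ (+ x) (+ y) (+ z) a) (∣m∣n⇒∣m+n ∣y ∣z)))
      go r@(inj₂ ∣y) (inj₁ ∣z) =
          opposite (cancel r (subst (+ q ∣_) (lem₂₁ (+ x) (+ y) (+ z) a) (∣m∣n⇒∣m+n ∣y ∣z)))
      go r@(inj₂ ∣y) (inj₂ ∣z) =
          same (cancel r (subst (+ q ∣_) (lem₂₂ (+ x) (+ y) (+ z) a) (∣m∣n⇒∣m-n ∣y ∣z)))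

    -- The lower end `l` is variable so that the element 1, a fixed point when `a = 1`, can be left
    -- out.
    even-interval : ∀ l n → 1 ≤ l → l ℕ.+ n ≡ suc h →
      (∀ {x y} → l ≤ x → x ≤ h → 1 ≤ y → y ≤ h → R x y → l ≤ y) →
      (∀ {x} → l ≤ x → x ≤ h → ¬ R x x) → 2 ℕ.∣ n
    even-interval l n 1≤l l+n≡ closed irrefl = subst (2 ℕ.∣_) (length-applyUpTo (l ℕ.+_) n)
      (perfect-matching R (λ {x} {y} → R-sym {x} {y}) _ xs ℕ.≤-refl
        (applyUpTo⁺₁ (l ℕ.+_) n (λ i<j _ → ℕ.<⇒≢ (ℕ.+-monoʳ-< l i<j)))
        (λ {x} {y} {z} y∈ z∈ → functional {x} {y} {z} (ℕ.≤-trans 1≤l (proj₁ (∈⇒ y∈)))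
          (proj₂ (∈⇒ y∈)) (proj₂ (∈⇒ z∈)))
        total′ (λ x∈ → irrefl (proj₁ (∈⇒ x∈)) (proj₂ (∈⇒ x∈))))
      where
      xs = applyUpTo (l ℕ.+_) n
      ∈⇒ : ∀ {x} → x ∈ xs → l ≤ x × x ≤ h
      ∈⇒ x∈ with ∈-applyUpTo⁻ (l ℕ.+_) x∈
      ... | i , i<n , refl = ℕ.m≤m+n l i , ℕ.≤-pred (subst (l ℕ.+ i <_) l+n≡ (ℕ.+-monoʳ-< l i<n))
      ⇒∈ : ∀ {x} → l ≤ x → x ≤ h → x ∈ xs
      ⇒∈ l≤x x≤h with ℕ.m≤n⇒∃[o]m+o≡n l≤x
      ... | i , refl = ∈-applyUpTo⁺ (l ℕ.+_)
          (ℕ.+-cancelˡ-< l i n (subst (l ℕ.+ i <_) (sym l+n≡) (s≤s x≤h)))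
      total′ : ∀ {x} → x ∈ xs → ∃ λ y → y ∈ xs × R x y
      total′ {x} x∈ = go (∈⇒ x∈) (total (ℕ.≤-trans 1≤l (proj₁ (∈⇒ x∈))) (proj₂ (∈⇒ x∈)))
        where
        go : l ≤ x × x ≤ h → (∃ λ y → 1 ≤ y × y ≤ h × R x y) → ∃ λ y → y ∈ xs × R x y
        go (l≤x , x≤h) (y , 1≤y , y≤h , Rxy) = y , ⇒∈ (closed {x} {y} l≤x x≤h 1≤y y≤h Rxy) y≤h , Rxy

  2∤1+2n : ∀ n → ¬ 2 ℕ.∣ suc (n ℕ.* 2)
  2∤1+2n n 2∣ = contradiction (ℕ.∣m+n∣m⇒∣n (subst (2 ℕ.∣_) (ℕ.+-comm 1 (n ℕ.* 2)) 2∣) (ℕ.n∣m*n n)) λ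
      { (ℕ.divides (suc _) ()) ; (ℕ.divides zero ()) }

  -- There are `(q - 1) / 2` residues up to sign, an odd number when `q` is 3 modulo 4. So the
  -- involution has a fixed point, which is a square root of `a` or of `- a`.
  ±-residue : ∀ {q} → Prime q → q % 4 ≡ 3 → ∀ a → ¬ + q ∣ a →
              (∀ x → ¬ + q ∣ x * x - a) → (∀ x → ¬ + q ∣ x * x + a) → ⊥
  ±-residue {q} qp q≡3 a q∤a -a∤ +a∤ =
      2∤1+2n (q / 4) (even-interval 1 _ ℕ.≤-refl refl (λ _ _ 1≤y _ _ → 1≤y)
      (λ {x} _ _ → [ -a∤ (+ x) , +a∤ (+ x) ]′))
    where
    lem : ∀ t → 3 ℕ.+ t ℕ.* 4 ≡ suc (suc (t ℕ.* 2) ℕ.+ suc (t ℕ.* 2))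
    lem = ℕ-Solver.solve-∀
    open HalfSystem {q} {suc ((q / 4) ℕ.* 2)} qp
      (trans (m≡m%n+[m/n]*n q 4) (trans (cong (ℕ._+ (q / 4) ℕ.* 4) q≡3) (lem (q / 4)))) a q∤a

  -- With `a = 1` the only residue up to sign with square 1 is 1 itself. Without it `(q - 3) / 2`
  -- remain, an odd number when `q` is 1 modulo 4, so there is another fixed point and its square is
  -- -1.
  -1-residue : ∀ {q} → Prime q → q % 4 ≡ 1 → (∀ x → ¬ + q ∣ x * x + 1ℤ) → ⊥
  -1-residue {q} qp q≡1 +1∤ = go (q / 4) (trans (m≡m%n+[m/n]*n q 4) (cong (ℕ._+ (q / 4) ℕ.* 4) q≡1))
    where
    instance _ = prime⇒nonTrivial qp
    1<q : 1 < q
    1<q = ℕ.nonTrivial⇒n>1 q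
    q∤1 : ¬ + q ∣ 1ℤ
    q∤1 = prime∤small (s≤s z≤n) 1<q
    lem : ∀ t → 1 ℕ.+ suc t ℕ.* 4 ≡ suc (suc (suc (t ℕ.* 2)) ℕ.+ suc (suc (t ℕ.* 2)))
    lem = ℕ-Solver.solve-∀
    go : ∀ t → q ≡ 1 ℕ.+ t ℕ.* 4 → ⊥
    go zero    q≡ = ℕ.<⇒≢ 1<q (sym q≡)
    go (suc t) q≡ = 2∤1+2n t (even-interval 2 _ (s≤s z≤n) refl closed irrefl)
      where
      open HalfSystem {q} {suc (suc (t ℕ.* 2))} qp (trans q≡ (lem t)) 1ℤ q∤1
      h = suc (suc (t ℕ.* 2))
      x-1∤ : ∀ {x} → 2 ≤ x → x ≤ h → ¬ + q ∣ + x - 1ℤ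
      x-1∤ {suc x} (s≤s 1≤x) x≤h q∣ = prime∤small 1≤x (ℕ.<-trans (ℕ.n<1+n x) (ℕ.≤-<-trans x≤h h<q))
          (subst (+ q ∣_) (lem′ (+ x)) q∣)
        where
        lem′ : ∀ x → 1ℤ + x - 1ℤ ≡ x
        lem′ = ℤ-Solver.solve-∀
      x+1∤ : ∀ {x} → x ≤ h → ¬ + q ∣ + x + 1ℤ
      x+1∤ {x} x≤h = prime∤small (ℕ.m≤n+m 1 x) (+<q x≤h (s≤s z≤n))
      -- A partner 1 would force `x ≡ 1` or `x ≡ -1`.
      closed : ∀ {x y} → 2 ≤ x → x ≤ h → 1 ≤ y → y ≤ h → R x y → 2 ≤ y
      closed {x} {suc (suc y)} _ _ _ _ _ = s≤s (s≤s z≤n)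
      closed {x} {1} 2≤x x≤h _ _ (inj₁ q∣) =
          contradiction (subst (λ z → + q ∣ z - 1ℤ) (ℤ.*-identityʳ (+ x)) q∣) (x-1∤ 2≤x x≤h)
      closed {x} {1} 2≤x x≤h _ _ (inj₂ q∣) =
          contradiction (subst (λ z → + q ∣ z + 1ℤ) (ℤ.*-identityʳ (+ x)) q∣) (x+1∤ x≤h)
      irrefl : ∀ {x} → 2 ≤ x → x ≤ h → ¬ R x x
      irrefl {x} 2≤x x≤h (inj₂ q∣) = +1∤ (+ x) q∣
      irrefl {x} 2≤x x≤h (inj₁ q∣) = [ x-1∤ 2≤x x≤h , x+1∤ x≤h ]′
        (euclidsLemmaℤ qp (+ x - 1ℤ) (+ x + 1ℤ) (subst (+ q ∣_) (lem′ (+ x)) q∣))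
        where
        lem′ : ∀ x → x * x - 1ℤ ≡ (x - 1ℤ) * (x + 1ℤ)
        lem′ = ℤ-Solver.solve-∀

  -- Congruences as equal remainders; Legendre symbols as square conditions

  ≅⇒≡% : ∀ {a b m} .{{_ : NonZero m}} → + a ≅ + b [mod m ] → a ≋ b [% m ]
  ≅⇒≡% {a} {b} {m} a≅b = residue-injective (m%n<n a m) (m%n<n b m)
    (subst (+ m ∣_) (trans (cong₂ (λ x y → x - y - (+ (a / m) - + (b / m)) * + m) (split a)
      (split b))
        (lem (+ (a % m)) (+ (b % m)) (+ (a / m)) (+ (b / m)) (+ m)))
      (∣m∣n⇒∣m-n (∣ᵤ⇒∣ {+ m} {+ a - + b} a≅b) (∣n⇒∣m*n (+ (a / m) - + (b / m)) ∣-refl)))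
    where
    split : ∀ a → + a ≡ + (a % m) + + (a / m) * + m
    split a = trans (cong +_ (m≡m%n+[m/n]*n a m)) (cong (λ z → + (a % m) + z) (ℤ.pos-* (a / m) m))
    lem : ∀ r s k l m → (r + k * m) - (s + l * m) - (k - l) * m ≡ r - s
    lem = ℤ-Solver.solve-∀

  ≡%⇒≅ : ∀ {a b m} .{{_ : NonZero m}} → a ≋ b [% m ] → + a ≅ + b [mod m ]
  ≡%⇒≅ {a} {b} {m} a≡b = ∣⇒∣ᵤ (divides (+ (a / m) - + (b / m))
    (trans (cong₂ _-_ (split a) (split b))
      (trans (cong (λ r → + r + + (a / m) * + m - (+ (b % m) + + (b / m) * + m)) a≡b)
      (lem (+ (b % m)) (+ (a / m)) (+ (b / m)) (+ m)))))
    where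
    split : ∀ a → + a ≡ + (a % m) + + (a / m) * + m
    split a = trans (cong +_ (m≡m%n+[m/n]*n a m)) (cong (λ z → + (a % m) + z) (ℤ.pos-* (a / m) m))
    lem : ∀ r k l m → (r + k * m) - (r + l * m) ≡ (k - l) * m
    lem = ℤ-Solver.solve-∀

  difference-≡% : ∀ {a b c m} .{{_ : NonZero m}} → (+ a - + b) ≅ + c [mod m ] → a ≋ b ℕ.+ c [% m ]
  difference-≡% {a} {b} {c} {m} d =
      ≅⇒≡% {a} {b ℕ.+ c} (subst (λ z → + m Unsigned.∣ z) (lem (+ a) (+ b) (+ c)) d)
    where
    lem : ∀ a b c → a - b - c ≡ a - (b + c)
    lem = ℤ-Solver.solve-∀

  -- The symbol is defined by a search among the residues below `q`, so an arbitrary root has to be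
  -- reduced modulo `q` first.
  legendre≡-1 : ∀ {a q} → .{{NonZero q}} → legendre a q ≡ -1ℤ → ∀ x → ¬ + q ∣ x * x - a
  legendre≡-1 {a} {q} eq x q∣ with a ≅? + 0 [mod q ]
  ... | no _ with Fin.any? {n = q} (λ x → + (Fin.toℕ x ℕ.* Fin.toℕ x) ≅? a [mod q ])
  ... | no none = none (Fin.fromℕ< r<q , ∣⇒∣ᵤ
      (subst (λ r → + q ∣ + (r ℕ.* r) - a) (sym (Fin.toℕ-fromℕ< r<q)) q∣r))
    where
    r = x %ℕ q
    t = x /ℕ q
    r<q = n%ℕd<d x q
    lem : ∀ r t q a → (r + t * q) * (r + t * q) - a - (t * (r + r + t * q)) * q ≡ r * r - a
    lem = ℤ-Solver.solve-∀
    q∣r : + q ∣ + (r ℕ.* r) - a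
    q∣r = subst (+ q ∣_) (trans
        (cong (λ x → x * x - a - (t * (+ r + + r + t * + q)) * + q) (a≡a%ℕn+[a/ℕn]*n x q))
      (trans (lem (+ r) t (+ q) a) (cong (_- a) (sym (ℤ.pos-* r r)))))
      (∣m∣n⇒∣m-n q∣ (∣n⇒∣m*n (t * (+ r + + r + t * + q)) ∣-refl))

  legendre≡1 : ∀ {a q} → legendre a q ≡ 1ℤ → ∃ λ x → + q ∣ x * x - a
  legendre≡1 {a} {q} eq with a ≅? + 0 [mod q ]
  ... | no _ with Fin.any? {n = q} (λ x → + (Fin.toℕ x ℕ.* Fin.toℕ x) ≅? a [mod q ])
  ... | yes (x , q∣) = + Fin.toℕ x , subst (λ z → + q ∣ z - a) (ℤ.pos-* (Fin.toℕ x) (Fin.toℕ x))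
      (∣ᵤ⇒∣ q∣)

  -- The quartics modulo 16

  fourth%16 : ∀ a → a ℕ.* a ℕ.* (a ℕ.* a) ≋ a % 2 [% 16 ]
  fourth%16 a = trans (sym (reduce₄ a))
      (trans (table (m%n<n a 16)) (cong (_% 16) (m∣n⇒o%n%m≡o%m 2 16 a (ℕ.divides 8 refl))))
    where
    reduce₄ : ∀ a → (a % 16) ℕ.* (a % 16) ℕ.* ((a % 16) ℕ.* (a % 16)) ≋ a ℕ.* a ℕ.* (a ℕ.* a) [% 16 ]
    reduce₄ a = *-≡% {m = r ℕ.* r} {n = a ℕ.* a} {o = r ℕ.* r} {r = a ℕ.* a} r² r²
      where
      r = a % 16
      r² : r ℕ.* r ≋ a ℕ.* a [% 16 ]
      r² = *-≡% {m = r} {n = a} {o = r} {r = a} (%-≡ a) (%-≡ a)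
    -- 16 is the largest power of 2 modulo which every fourth power is 0 or 1.
    table : ∀ {r} → r < 16 → r ℕ.* r ℕ.* (r ℕ.* r) ≋ r % 2 [% 16 ]
    table = from-yes (ℕ.allUpTo? (λ r → (r ℕ.* r ℕ.* (r ℕ.* r)) % 16 ℕ.≟ (r % 2) % 16) 16)

  square%16 : ∀ w → (w % 16) ℕ.* (w % 16) ≋ w ℕ.* w [% 16 ]
  square%16 w = *-≡% {m = w % 16} {n = w} {o = w % 16} {r = w} (%-≡ w) (%-≡ w)

  odd⇒%2≡1 : ∀ {n} → ¬ 2 ℕ.∣ n → n % 2 ≡ 1
  odd⇒%2≡1 {n} 2∤n with n % 2 | m%n<n n 2 | ℕ.m%n≡0⇒n∣m n 2
  ... | 0 | _ | 2∣n = contradiction (2∣n refl) 2∤n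
  ... | 1 | _ | _ = refl
  ... | suc (suc _) | s≤s (s≤s ()) | _

  term%16 : ∀ {D A} a → a ℕ.* a ℕ.* (a ℕ.* a) ≋ A [% 16 ] →
    (D % 16) ℕ.* A ≋ D ℕ.* (a ℕ.* a ℕ.* (a ℕ.* a)) [% 16 ]
  term%16 {D} {A} a a⁴≡A = *-≡% {m = D % 16} {n = D} {o = A} {r = a ℕ.* a ℕ.* (a ℕ.* a)} (%-≡ D)
      (sym a⁴≡A)

  -- A and B stand for the fourth powers a⁴ and b⁴, which are 0 or 1 modulo 16.
  NoQuartic₁₆ : ℕ → ℕ → Set
  NoQuartic₁₆ P Q = ∀ {A} → A < 2 → ∀ {B} → B < 2 → A ℕ.+ B ≢ 0 → ∀ {w} → w < 16 →
    ¬ (P ℕ.* A ℕ.+ w ℕ.* w ≋ Q ℕ.* B [% 16 ])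

  noQuartic₁₆? : ∀ P Q → Dec (NoQuartic₁₆ P Q)
  noQuartic₁₆? P Q = ℕ.allUpTo? (λ A → ℕ.allUpTo? (λ B → ¬? (A ℕ.+ B ℕ.≟ 0) →-dec
    ℕ.allUpTo? (λ w → ¬? ((P ℕ.* A ℕ.+ w ℕ.* w) % 16 ℕ.≟ (Q ℕ.* B) % 16)) 16) 2) 2

  noQuartic : ∀ {D D′ a b w} → NoQuartic₁₆ (D % 16) (D′ % 16) → Coprime a b →
    D ℕ.* (a ℕ.* a ℕ.* (a ℕ.* a)) ℕ.+ w ℕ.* w ≢ D′ ℕ.* (b ℕ.* b ℕ.* (b ℕ.* b))
  noQuartic {D} {D′} {a} {b} {w} excluded a⊥b eq =
    excluded (m%n<n a 2) (m%n<n b 2) not-both-even (m%n<n w 16) (trans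
      (+-≡% {m = (D % 16) ℕ.* (a % 2)} {n = D ℕ.* (a ℕ.* a ℕ.* (a ℕ.* a))}
        {o = (w % 16) ℕ.* (w % 16)} {r = w ℕ.* w}
        (term%16 {D} a (fourth%16 a)) (square%16 w))
      (trans (cong (_% 16) eq) (sym (term%16 {D′} b (fourth%16 b)))))
    where
    -- Coprimality enters only here: `A = B = 0` would admit `w = 0`.
    not-both-even : a % 2 ℕ.+ b % 2 ≢ 0
    not-both-even sum≡0 with () ← a⊥b {2}
      ( ℕ.m%n≡0⇒n∣m a 2 (ℕ.m+n≡0⇒m≡0 (a % 2) sum≡0)
      , ℕ.m%n≡0⇒n∣m b 2 (ℕ.m+n≡0⇒n≡0 (a % 2) sum≡0))

  -- In `G₁` and `G₂` both variables are odd, so the factors `1` stand for their fourth powers.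
  NoDouble₁₆ : ℕ → ℕ → Set
  NoDouble₁₆ P Q = ∀ {u} → u < 16 → ¬ (P ℕ.* 1 ℕ.+ Q ℕ.* 1 ≋ 2 ℕ.* (u ℕ.* u) [% 16 ])

  noDouble₁₆? : ∀ P Q → Dec (NoDouble₁₆ P Q)
  noDouble₁₆? P Q = ℕ.allUpTo? (λ u → ¬? ((P ℕ.* 1 ℕ.+ Q ℕ.* 1) % 16 ℕ.≟ (2 ℕ.* (u ℕ.* u)) % 16)) 16

  odd-fourth%16 : ∀ {a} → ¬ 2 ℕ.∣ a → a ℕ.* a ℕ.* (a ℕ.* a) ≋ 1 [% 16 ]
  odd-fourth%16 {a} 2∤a = trans (fourth%16 a) (cong (_% 16) (odd⇒%2≡1 2∤a))

  noDouble : ∀ {D D′ f g u} → NoDouble₁₆ (D % 16) (D′ % 16) → ¬ 2 ℕ.∣ f → ¬ 2 ℕ.∣ g →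
    D ℕ.* (f ℕ.* f ℕ.* (f ℕ.* f)) ℕ.+ D′ ℕ.* (g ℕ.* g ℕ.* (g ℕ.* g)) ≢ 2 ℕ.* (u ℕ.* u)
  noDouble {D} {D′} {f} {g} {u} excluded 2∤f 2∤g eq = excluded (m%n<n u 16) (trans
      (+-≡% {m = (D % 16) ℕ.* 1} {n = D ℕ.* (f ℕ.* f ℕ.* (f ℕ.* f))} {o = (D′ % 16) ℕ.* 1}
        {r = D′ ℕ.* (g ℕ.* g ℕ.* (g ℕ.* g))}
        (term%16 {D} f (odd-fourth%16 2∤f)) (term%16 {D′} g (odd-fourth%16 2∤g)))
      (trans (cong (_% 16) eq) (sym
        (*-≡% {m = 2} {n = 2} {o = (u % 16) ℕ.* (u % 16)} {r = u ℕ.* u} refl (square%16 u)))))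

  -- Only `f` is known to be odd in `G₃` and `G₄`; `G` stands for `g⁴`.
  NoSquare₁₆ : ℕ → ℕ → Set
  NoSquare₁₆ P Q = ∀ {G} → G < 2 → ∀ {u} → u < 16 →
      ¬ (P ℕ.* 1 ℕ.+ 4 ℕ.* (Q ℕ.* G) ≋ u ℕ.* u [% 16 ])

  noSquare₁₆? : ∀ P Q → Dec (NoSquare₁₆ P Q)
  noSquare₁₆? P Q = ℕ.allUpTo?
      (λ G → ℕ.allUpTo? (λ u → ¬? ((P ℕ.* 1 ℕ.+ 4 ℕ.* (Q ℕ.* G)) % 16 ℕ.≟ (u ℕ.* u) % 16)) 16) 2

  noSquare : ∀ {D D′ f g u} → NoSquare₁₆ (D % 16) (D′ % 16) → ¬ 2 ℕ.∣ f →
    D ℕ.* (f ℕ.* f ℕ.* (f ℕ.* f)) ℕ.+ 4 ℕ.* (D′ ℕ.* (g ℕ.* g ℕ.* (g ℕ.* g))) ≢ u ℕ.* u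
  noSquare {D} {D′} {f} {g} {u} excluded 2∤f eq = excluded (m%n<n g 2) (m%n<n u 16) (trans
      (+-≡% {m = (D % 16) ℕ.* 1} {n = D ℕ.* (f ℕ.* f ℕ.* (f ℕ.* f))}
            {o = 4 ℕ.* ((D′ % 16) ℕ.* (g % 2))} {r = 4 ℕ.* (D′ ℕ.* (g ℕ.* g ℕ.* (g ℕ.* g)))}
        (term%16 {D} f (odd-fourth%16 2∤f))
        (*-≡% {m = 4} {n = 4} {o = (D′ % 16) ℕ.* (g % 2)} {r = D′ ℕ.* (g ℕ.* g ℕ.* (g ℕ.* g))} refl
          (term%16 {D′} g (fourth%16 g))))
      (trans (cong (_% 16) eq) (sym (square%16 u))))

  -- The quartics modulo `p` or `q`

  cast-□ : ∀ D A → + (D ℕ.* (A ℕ.* A)) ≡ + D * (+ A * + A)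
  cast-□ D A = trans (ℤ.pos-* D (A ℕ.* A)) (cong (+ D *_) (ℤ.pos-* A A))

  cast-sum : ∀ m n k → m ℕ.+ n ≡ k → + m + + n ≡ + k
  cast-sum m n k eq = trans (sym (ℤ.pos-+ m n)) (cong +_ eq)

  SquareMod : ℕ → ℤ → Set
  SquareMod l c = ∃ λ x → + l ∣ x * x - c

  -- `l` is the prime of reduction and `m` the other one, so that each lemma can be used at `p` and
  -- at `q`. Dropping the term divisible by `l` leaves a relation between two squares, and
  -- `local-square` applies with the squares of the coprime variables as its `a` and `b`.
  module Local {l m : ℕ} (lp : Prime l) (2∤l : ¬ 2 ℕ.∣ l) (mp : Prime m) (m≢l : m ≢ l) where

    1<l : 1 < l
    1<l = ℕ.nonTrivial⇒n>1 l {{prime⇒nonTrivial lp}}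

    l∤1 : ¬ + l ∣ 1ℤ
    l∤1 = prime∤small (s≤s z≤n) 1<l

    l∤-1 : ¬ + l ∣ -1ℤ
    l∤-1 = l∤1 ∘ ∣m⇒∣-m

    l∤2 : ¬ + l ∣ + 2
    l∤2 l∣2 = 2∤l (subst (2 ℕ.∣_) (sym (prime-∣⇒≡ lp prime[2] (∣⇒∣ᵤ l∣2))) ℕ.∣-refl)

    l∤4 : ¬ + l ∣ + 4
    l∤4 = l∤2 ∘ prime∣□⇒∣ lp (+ 2)

    l∤m : ¬ + l ∣ + m
    l∤m l∣m = m≢l (sym (prime-∣⇒≡ lp mp (∣⇒∣ᵤ l∣m)))

    □∤coprime : ∀ {a b} → Coprime a b → ¬ (+ l ∣ + (a ℕ.* a) × + l ∣ + (b ℕ.* b))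
    □∤coprime {a} {b} a⊥b (l∣a² , l∣b²) = ℕ.<⇒≢ 1<l (sym (a⊥b (root a l∣a² , root b l∣b²)))
      where
      root : ∀ a → + l ∣ + (a ℕ.* a) → l ℕ.∣ a
      root a l∣ = ∣⇒∣ᵤ (prime∣□⇒∣ lp (+ a) (subst (+ l ∣_) (ℤ.pos-* a a) l∣))

    monic : ∀ {c} → (∃ λ x → + l ∣ 1ℤ * (x * x) - c) → SquareMod l c
    monic {c} (x , l∣) = x , subst (λ z → + l ∣ z - c) (ℤ.*-identityˡ (x * x)) l∣

    E₁-local : ∀ {a b w} → Coprime a b →
      a ℕ.* a ℕ.* (a ℕ.* a) ℕ.+ w ℕ.* w ≡ m ℕ.* l ℕ.* (b ℕ.* b ℕ.* (b ℕ.* b)) →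
               SquareMod l -1ℤ
    E₁-local {a} {b} {w} a⊥b eq = monic {c = -1ℤ} (local-square lp 1ℤ -1ℤ (+ m) {+ w} {+ A} {+ B}
      (trans (lem₁ (+ A) (+ w)) (trans (cong (λ z → -1ℤ * (+ A * + A) + z) eq′)
        (lem₂ (-1ℤ * (+ A * + A)) (+ m) (+ l) (+ B))))
      (□∤coprime {a} {b} a⊥b) l∤1 l∤m)
      where
      A = a ℕ.* a
      B = b ℕ.* b
      lem₁ : ∀ A w → 1ℤ * (w * w) ≡ -1ℤ * (A * A) + (A * A + w * w)
      lem₁ = ℤ-Solver.solve-∀
      lem₂ : ∀ X m l B → X + m * l * (B * B) ≡ X + l * (m * (B * B))
      lem₂ = ℤ-Solver.solve-∀
      eq′ : + A * + A + + w * + w ≡ + m * + l * (+ B * + B)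
      eq′ = trans (cong₂ _+_ (sym (ℤ.pos-* A A)) (sym (ℤ.pos-* w w)))
        (trans (cast-sum (A ℕ.* A) (w ℕ.* w) (m ℕ.* l ℕ.* (B ℕ.* B)) eq)
        (trans (cast-□ (m ℕ.* l) B) (cong (_* (+ B * + B)) (ℤ.pos-* m l))))

    quartic-cast : ∀ D D′ A B w → D ℕ.* (A ℕ.* A) ℕ.+ w ℕ.* w ≡ D′ ℕ.* (B ℕ.* B) →
      + D * (+ A * + A) + + w * + w ≡ + D′ * (+ B * + B)
    quartic-cast D D′ A B w eq = trans (cong₂ _+_ (sym (cast-□ D A)) (sym (ℤ.pos-* w w)))
      (trans (cast-sum (D ℕ.* (A ℕ.* A)) (w ℕ.* w) (D′ ℕ.* (B ℕ.* B)) eq) (cast-□ D′ B))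

    E₂-local : ∀ {a b w} → Coprime a b →
      m ℕ.* (a ℕ.* a ℕ.* (a ℕ.* a)) ℕ.+ w ℕ.* w ≡ l ℕ.* (b ℕ.* b ℕ.* (b ℕ.* b)) →
          SquareMod l (- + m)
    E₂-local {a} {b} {w} a⊥b eq = monic (local-square lp 1ℤ (- + m) 1ℤ {+ w} {+ A} {+ B}
      (trans (lem (+ m) (+ A) (+ w))
        (trans (cong (λ z → - + m * (+ A * + A) + z) (quartic-cast m l A B w eq))
        (cong (λ z → - + m * (+ A * + A) + + l * z) (sym (ℤ.*-identityˡ (+ B * + B))))))
      (□∤coprime {a} {b} a⊥b) l∤1 l∤1)
      where
      A = a ℕ.* a
      B = b ℕ.* b
      lem : ∀ m A w → 1ℤ * (w * w) ≡ - m * (A * A) + (m * (A * A) + w * w)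
      lem = ℤ-Solver.solve-∀

    E₃-local : ∀ {a b w} → Coprime a b →
      l ℕ.* (a ℕ.* a ℕ.* (a ℕ.* a)) ℕ.+ w ℕ.* w ≡ m ℕ.* (b ℕ.* b ℕ.* (b ℕ.* b)) → SquareMod l (+ m)
    E₃-local {a} {b} {w} a⊥b eq = monic (local-square lp 1ℤ (+ m) -1ℤ {+ w} {+ B} {+ A}
      (trans (lem (+ l) (+ A) (+ w))
        (cong (λ z → z + + l * (-1ℤ * (+ A * + A))) (quartic-cast l m A B w eq)))
      (□∤coprime {b} {a} (Coprime.sym a⊥b)) l∤1 l∤-1)
      where
      A = a ℕ.* a
      B = b ℕ.* b
      lem : ∀ l A w → 1ℤ * (w * w) ≡ l * (A * A) + w * w + l * (-1ℤ * (A * A))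
      lem = ℤ-Solver.solve-∀

    G₁-local : ∀ {f g u} → Coprime f g →
      f ℕ.* f ℕ.* (f ℕ.* f) ℕ.+ m ℕ.* l ℕ.* (g ℕ.* g ℕ.* (g ℕ.* g)) ≡ 2 ℕ.* (u ℕ.* u) →
      ∃ λ x → + l ∣ + 2 * (x * x) - 1ℤ
    G₁-local {f} {g} {u} f⊥g eq = local-square lp (+ 2) 1ℤ (+ m) {+ u} {+ F} {+ G}
      (trans (sym (cast-□ 2 u)) (trans (cong +_ (sym eq))
        (trans (ℤ.pos-+ (F ℕ.* F) (m ℕ.* l ℕ.* (G ℕ.* G)))
        (trans (cong₂ _+_ (ℤ.pos-* F F)
          (trans (cast-□ (m ℕ.* l) G) (cong (_* (+ G * + G)) (ℤ.pos-* m l))))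
          (lem (+ F) (+ m) (+ l) (+ G))))))
      (□∤coprime {f} {g} f⊥g) l∤2 l∤m
      where
      F = f ℕ.* f
      G = g ℕ.* g
      lem : ∀ F m l G → F * F + m * l * (G * G) ≡ 1ℤ * (F * F) + l * (m * (G * G))
      lem = ℤ-Solver.solve-∀

    G₂-local : ∀ {f g u} → Coprime f g →
      m ℕ.* (f ℕ.* f ℕ.* (f ℕ.* f)) ℕ.+ l ℕ.* (g ℕ.* g ℕ.* (g ℕ.* g)) ≡ 2 ℕ.* (u ℕ.* u) →
      ∃ λ x → + l ∣ + 2 * (x * x) - + m
    G₂-local {f} {g} {u} f⊥g eq = local-square lp (+ 2) (+ m) 1ℤ {+ u} {+ F} {+ G}
      (trans (sym (cast-□ 2 u)) (trans (cong +_ (sym eq))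
        (trans (ℤ.pos-+ (m ℕ.* (F ℕ.* F)) (l ℕ.* (G ℕ.* G)))
        (cong₂ _+_ (cast-□ m F) (trans (cast-□ l G)
          (cong (+ l *_) (sym (ℤ.*-identityˡ (+ G * + G)))))))))
      (□∤coprime {f} {g} f⊥g) l∤2 l∤1
      where
      F = f ℕ.* f
      G = g ℕ.* g

    square-cast : ∀ D D′ F G u → D ℕ.* (F ℕ.* F) ℕ.+ 4 ℕ.* (D′ ℕ.* (G ℕ.* G)) ≡ u ℕ.* u →
      1ℤ * (+ u * + u) ≡ + D * (+ F * + F) + + 4 * (+ D′ * (+ G * + G))
    square-cast D D′ F G u eq =
        trans (ℤ.*-identityˡ (+ u * + u)) (trans (sym (ℤ.pos-* u u)) (trans (cong +_ (sym eq))
      (trans (ℤ.pos-+ (D ℕ.* (F ℕ.* F)) (4 ℕ.* (D′ ℕ.* (G ℕ.* G))))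
      (cong₂ _+_ (cast-□ D F) (trans (ℤ.pos-* 4 (D′ ℕ.* (G ℕ.* G)))
        (cong (+ 4 *_) (cast-□ D′ G)))))))

    G₃-local : ∀ {f g u} → Coprime f g →
      m ℕ.* (f ℕ.* f ℕ.* (f ℕ.* f)) ℕ.+ 4 ℕ.* (l ℕ.* (g ℕ.* g ℕ.* (g ℕ.* g))) ≡ u ℕ.* u →
      SquareMod l (+ m)
    G₃-local {f} {g} {u} f⊥g eq = monic (local-square lp 1ℤ (+ m) (+ 4) {+ u} {+ F} {+ G}
      (trans (square-cast m l F G u eq) (cong (λ z → + m * (+ F * + F) + z) (lem (+ l) (+ G))))
      (□∤coprime {f} {g} f⊥g) l∤1 l∤4)
      where
      F = f ℕ.* f
      G = g ℕ.* g
      lem : ∀ l G → + 4 * (l * (G * G)) ≡ l * (+ 4 * (G * G))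
      lem = ℤ-Solver.solve-∀

    -- Since `4 m g⁴ = m (2 g²)²`, the square to divide by is that of `2 G`. Oddness of `l`
    -- transfers divisibility from `2 G` to `G`.
    G₄-local : ∀ {f g u} → Coprime f g →
      l ℕ.* (f ℕ.* f ℕ.* (f ℕ.* f)) ℕ.+ 4 ℕ.* (m ℕ.* (g ℕ.* g ℕ.* (g ℕ.* g))) ≡ u ℕ.* u →
      SquareMod l (+ m)
    G₄-local {f} {g} {u} f⊥g eq = monic (local-square lp 1ℤ (+ m) 1ℤ {+ u} {+ 2 * + G} {+ F}
      (trans (square-cast l m F G u eq) (lem (+ l) (+ m) (+ F) (+ G)))
      (λ (l∣2G , l∣F) → □∤coprime {f} {g} f⊥g (l∣F , half l∣2G)) l∤1 l∤1)
      where
      F = f ℕ.* f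
      G = g ℕ.* g
      lem : ∀ l m F G → l * (F * F) + + 4 * (m * (G * G)) ≡
        m * (+ 2 * G * (+ 2 * G)) + l * (1ℤ * (F * F))
      lem = ℤ-Solver.solve-∀
      half : + l ∣ + 2 * + G → + l ∣ + G
      half l∣2G = [ (λ l∣2 → contradiction l∣2 l∤2) , (λ l∣G → l∣G) ]′
          (euclidsLemmaℤ lp (+ 2) (+ G) l∣2G)

  -- Exclusion of the seven quartics under each condition

  4∣16 : 4 ℕ.∣ 16
  4∣16 = ℕ.divides 4 refl

  8∣16 : 8 ℕ.∣ 16
  8∣16 = ℕ.divides 2 refl

  %16%4 : ∀ {n r} → n % 4 ≡ r → n % 16 % 4 ≡ r
  %16%4 {n} = trans (m∣n⇒o%n%m≡o%m 4 16 n 4∣16)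

  %16%8 : ∀ {n r} → n % 8 ≡ r → n % 16 % 8 ≡ r
  %16%8 {n} = trans (m∣n⇒o%n%m≡o%m 8 16 n 8∣16)

  -- tableᵢ is the 2-adic part of the i-th condition, with P and Q for p and q modulo 16.
  table₁ : ∀ {P} → P < 16 → ∀ {Q} → Q < 16 → P % 4 ≡ 1 → Q % 4 ≡ 1 → (P ℕ.* Q) % 16 ≡ 13 →
    NoQuartic₁₆ 1 ((P ℕ.* Q) % 16) × NoDouble₁₆ 1 ((P ℕ.* Q) % 16) × NoDouble₁₆ P Q
  table₁ = from-yes (ℕ.allUpTo? (λ P → ℕ.allUpTo? (λ Q →
    (P % 4 ℕ.≟ 1) →-dec (Q % 4 ℕ.≟ 1) →-dec ((P ℕ.* Q) % 16 ℕ.≟ 13) →-dec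
    (noQuartic₁₆? 1 ((P ℕ.* Q) % 16) ×-dec noDouble₁₆? 1
      ((P ℕ.* Q) % 16) ×-dec noDouble₁₆? P Q)) 16) 16)

  table₂ : ∀ {P} → P < 16 → ∀ {Q} → Q < 16 → P % 4 ≢ Q % 4 → ((P ℕ.* Q) % 16) % 8 ≡ 3 →
    NoDouble₁₆ 1 ((P ℕ.* Q) % 16) × NoDouble₁₆ P Q ×
    (Q % 4 ≡ 3 × NoQuartic₁₆ P Q ⊎ Q % 4 ≡ 1 × P % 4 ≡ 3)
  table₂ = from-yes (ℕ.allUpTo? (λ P → ℕ.allUpTo? (λ Q →
    ¬? (P % 4 ℕ.≟ Q % 4) →-dec (((P ℕ.* Q) % 16) % 8 ℕ.≟ 3) →-dec
    (noDouble₁₆? 1 ((P ℕ.* Q) % 16) ×-dec noDouble₁₆? P Q ×-dec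
    (((Q % 4 ℕ.≟ 3) ×-dec noQuartic₁₆? P Q) ⊎-dec ((Q % 4 ℕ.≟ 1) ×-dec (P % 4 ℕ.≟ 3))))) 16) 16)

  table₃ : ∀ {P} → P < 16 → ∀ {Q} → Q < 16 → Q % 8 ≡ 3 → P ≡ (Q ℕ.+ 8) % 16 ⊎ P ≡ (Q ℕ.+ 12) % 16 →
    NoQuartic₁₆ Q P × NoSquare₁₆ P Q × NoSquare₁₆ Q P × Q % 4 ≡ 3
  table₃ = from-yes (ℕ.allUpTo? (λ P → ℕ.allUpTo? (λ Q →
    (Q % 8 ℕ.≟ 3) →-dec ((P ℕ.≟ (Q ℕ.+ 8) % 16) ⊎-dec (P ℕ.≟ (Q ℕ.+ 12) % 16)) →-dec
    (noQuartic₁₆? Q P ×-dec noSquare₁₆? P Q ×-dec noSquare₁₆? Q P ×-dec (Q % 4 ℕ.≟ 3))) 16) 16)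

  table₄ : ∀ {P} → P < 16 → ∀ {Q} → Q < 16 → P % 8 ≡ 3 → Q ≡ (P ℕ.+ 8) % 16 ⊎ Q ≡ (P ℕ.+ 12) % 16 →
    NoQuartic₁₆ P Q × Q % 4 ≡ 3 × (NoDouble₁₆ P Q ⊎ Q % 8 ≡ 7)
  table₄ = from-yes (ℕ.allUpTo? (λ P → ℕ.allUpTo? (λ Q →
    (P % 8 ℕ.≟ 3) →-dec ((Q ℕ.≟ (P ℕ.+ 8) % 16) ⊎-dec (Q ℕ.≟ (P ℕ.+ 12) % 16)) →-dec
    (noQuartic₁₆? P Q ×-dec (Q % 4 ℕ.≟ 3) ×-dec (noDouble₁₆? P Q ⊎-dec (Q % 8 ℕ.≟ 7)))) 16) 16)

  module Cases {p q : ℕ} (pp : Prime p) (qp : Prime q) (2∤p : ¬ 2 ℕ.∣ p) (2∤q : ¬ 2 ℕ.∣ q)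
    (p≢q : p ≢ q) where

    private
      module Lq = Local {q} {p} qp 2∤q pp p≢q
      module Lp = Local {p} {q} pp 2∤p qp (p≢q ∘ sym)

    p*q%16 : p ℕ.* q % 16 ≡ ((p % 16) ℕ.* (q % 16)) % 16
    p*q%16 = %-distribˡ-* p q 16

    noQuartic-1-pq : NoQuartic₁₆ 1 (((p % 16) ℕ.* (q % 16)) % 16) → ∀ {a b w} → Coprime a b →
      a ℕ.* a ℕ.* (a ℕ.* a) ℕ.+ w ℕ.* w ≢ p ℕ.* q ℕ.* (b ℕ.* b ℕ.* (b ℕ.* b))
    noQuartic-1-pq excluded {a} {b} {w} a⊥b eq =
      noQuartic {1} {p ℕ.* q} {a} {b} {w} (subst (NoQuartic₁₆ 1) (sym p*q%16) excluded) a⊥b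
        (trans (cong (ℕ._+ w ℕ.* w) (ℕ.*-identityˡ _)) eq)

    noDouble-1-pq : NoDouble₁₆ 1 (((p % 16) ℕ.* (q % 16)) % 16) → ∀ {f g u} → ¬ 2 ℕ.∣ f →
      ¬ 2 ℕ.∣ g →
      f ℕ.* f ℕ.* (f ℕ.* f) ℕ.+ p ℕ.* q ℕ.* (g ℕ.* g ℕ.* (g ℕ.* g)) ≢ 2 ℕ.* (u ℕ.* u)
    noDouble-1-pq excluded {f} {g} {u} 2∤f 2∤g eq =
      noDouble {1} {p ℕ.* q} {f} {g} {u} (subst (NoDouble₁₆ 1) (sym p*q%16) excluded) 2∤f 2∤g
        (trans (cong (ℕ._+ p ℕ.* q ℕ.* (g ℕ.* g ℕ.* (g ℕ.* g))) (ℕ.*-identityˡ _)) eq)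

    private
      NonSquare : Set
      NonSquare = ∀ x → ¬ + q ∣ x * x - + p

      use : NonSquare → ¬ SquareMod q (+ p)
      use p∤□ (x , q∣) = p∤□ x q∣

      -- If -1 ≡ j² and x² ≡ -p, then (j x)² ≡ p.
      negate : NonSquare → q % 4 ≡ 1 → ¬ SquareMod q (- + p)
      negate p∤□ q≡1 (x , q∣) = -1-residue qp q≡1 λ j q∣j²+1 → p∤□ (j * x)
        (subst (+ q ∣_) (lem j x (+ p)) (∣m∣n⇒∣m-n (∣n⇒∣m*n (j * j) q∣) (∣n⇒∣m*n (+ p) q∣j²+1)))
        where
        lem : ∀ j x p → j * j * (x * x - - p) - p * (j * j + 1ℤ) ≡ j * x * (j * x) - p
        lem = ℤ-Solver.solve-∀

    -- `2 x² ≡ 1` would give `(2 x)² ≡ 2`.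
    half-nonresidue : ∀ {l} → l % 8 ≡ 3 → ¬ (∃ λ x → + l ∣ + 2 * (x * x) - 1ℤ)
    half-nonresidue {l} l≡3 (x , l∣) = 2-nonresidue {l} (inj₁ l≡3) (+ 2 * x)
      (subst (+ l ∣_) (lem x) (∣n⇒∣m*n (+ 2) l∣))
      where
      lem : ∀ x → + 2 * (+ 2 * (x * x) - 1ℤ) ≡ + 2 * x * (+ 2 * x) - + 2
      lem = ℤ-Solver.solve-∀

    -- As 16 divides `(p - 1) (q - 1)`, both `1 + p q` and `p + q` are 14 modulo 16, which is no
    -- doubled square. For `E₁`, none of 13, -1 and `13 - 1` is a square modulo 16. The other
    -- quartics would make `p` or `- p` a square modulo `q`, where -1 is a square.
    noQuartics₁ : p % 4 ≡ 1 → q % 4 ≡ 1 → p ℕ.* q % 16 ≡ 13 → NonSquare → NoQuartics p q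
    noQuartics₁ p≡1 q≡1 pq≡13 p∤□ =
        build (table₁ (m%n<n p 16) (m%n<n q 16) (%16%4 {p} p≡1) (%16%4 {q} q≡1)
          (trans (sym p*q%16) pq≡13))
      where
      build : _ → NoQuartics p q
      build (e₁ , g₁ , g₂) = record
        { E₁ = λ {a} {b} {w} → noQuartic-1-pq e₁ {a} {b} {w}
        ; E₂ = λ {a} {b} {w} a⊥b eq → negate p∤□ q≡1 (Lq.E₂-local {a} {b} {w} a⊥b eq)
        ; E₃ = λ {a} {b} {w} a⊥b eq → use p∤□ (Lq.E₃-local {a} {b} {w} a⊥b eq)
        ; G₁ = λ {f} {g} {u} _ → noDouble-1-pq g₁ {f} {g} {u}
        ; G₂ = λ {f} {g} {u} _ → noDouble {p} {q} {f} {g} {u} g₂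
        ; G₃ = λ {f} {g} {u} f⊥g _ eq → use p∤□ (Lq.G₃-local {f} {g} {u} f⊥g eq)
        ; G₄ = λ {f} {g} {u} f⊥g _ eq → use p∤□ (Lq.G₄-local {f} {g} {u} f⊥g eq)
        }

    E₁-at-q : q % 4 ≡ 3 → ∀ {a b w} → Coprime a b →
      a ℕ.* a ℕ.* (a ℕ.* a) ℕ.+ w ℕ.* w ≢ p ℕ.* q ℕ.* (b ℕ.* b ℕ.* (b ℕ.* b))
    E₁-at-q q≡3 {a} {b} {w} a⊥b eq = go (Lq.E₁-local {a} {b} {w} a⊥b eq)
      where
      go : ¬ SquareMod q -1ℤ
      go (x , q∣) = -1-nonresidue {q} q≡3 x q∣

    E₁-at-p : p % 4 ≡ 3 → ∀ {a b w} → Coprime a b →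
      a ℕ.* a ℕ.* (a ℕ.* a) ℕ.+ w ℕ.* w ≢ p ℕ.* q ℕ.* (b ℕ.* b ℕ.* (b ℕ.* b))
    E₁-at-p p≡3 {a} {b} {w} a⊥b eq = go (Lp.E₁-local {a} {b} {w} a⊥b
      (trans eq (cong (ℕ._* (b ℕ.* b ℕ.* (b ℕ.* b))) (ℕ.*-comm p q))))
      where
      go : ¬ SquareMod p -1ℤ
      go (x , p∣) = -1-nonresidue {p} p≡3 x p∣

    -- Both `1 + p q` and `p + q` are 4 modulo 8, unlike any doubled square. The prime that is 3
    -- modulo 4 excludes `E₁`, as -1 is not a square there. If this prime is `q`, then `E₂` fails
    -- modulo 4; otherwise -1 is a square modulo `q`, and `- p` is a nonresidue along with `p`.
    noQuartics₂ : p % 4 ≢ q % 4 → p ℕ.* q % 8 ≡ 3 → NonSquare → NoQuartics p q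
    noQuartics₂ p≢q%4 pq≡3 p∤□ = build (table₂ (m%n<n p 16) (m%n<n q 16)
      (λ eq → p≢q%4 (trans (sym (%16%4 {p} refl)) (trans eq (%16%4 {q} refl))))
      (trans (cong (_% 8) (sym p*q%16)) (%16%8 {p ℕ.* q} pq≡3)))
      where
      P = p % 16
      Q = q % 16
      E₁′ = ∀ {a b w} → Coprime a b →
            a ℕ.* a ℕ.* (a ℕ.* a) ℕ.+ w ℕ.* w ≢ p ℕ.* q ℕ.* (b ℕ.* b ℕ.* (b ℕ.* b))
      E₂′ = ∀ {a b w} → Coprime a b →
            p ℕ.* (a ℕ.* a ℕ.* (a ℕ.* a)) ℕ.+ w ℕ.* w ≢ q ℕ.* (b ℕ.* b ℕ.* (b ℕ.* b))
      by-side : Q % 4 ≡ 3 × NoQuartic₁₆ P Q ⊎ Q % 4 ≡ 1 × P % 4 ≡ 3 → E₁′ × E₂′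
      by-side (inj₁ (Q≡3 , e₂)) =
        (λ {a} {b} {w} → E₁-at-q (trans (sym (%16%4 {q} refl)) Q≡3) {a} {b} {w}) ,
        (λ {a} {b} {w} → noQuartic {p} {q} {a} {b} {w} e₂)
      by-side (inj₂ (Q≡1 , P≡3)) =
        (λ {a} {b} {w} → E₁-at-p (trans (sym (%16%4 {p} refl)) P≡3) {a} {b} {w}) ,
        (λ {a} {b} {w} a⊥b eq → negate p∤□ (trans (sym (%16%4 {q} refl)) Q≡1)
          (Lq.E₂-local {a} {b} {w} a⊥b eq))
      build : NoDouble₁₆ 1 ((P ℕ.* Q) % 16) × NoDouble₁₆ P Q ×
              (Q % 4 ≡ 3 × NoQuartic₁₆ P Q ⊎ Q % 4 ≡ 1 × P % 4 ≡ 3) → NoQuartics p q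
      build (g₁ , g₂ , side) = record
        { E₁ = λ {a} {b} {w} → proj₁ (by-side side) {a} {b} {w}
        ; E₂ = λ {a} {b} {w} → proj₂ (by-side side) {a} {b} {w}
        ; E₃ = λ {a} {b} {w} a⊥b eq → use p∤□ (Lq.E₃-local {a} {b} {w} a⊥b eq)
        ; G₁ = λ {f} {g} {u} _ → noDouble-1-pq g₁ {f} {g} {u}
        ; G₂ = λ {f} {g} {u} _ → noDouble {p} {q} {f} {g} {u} g₂
        ; G₃ = λ {f} {g} {u} f⊥g _ eq → use p∤□ (Lq.G₃-local {f} {g} {u} f⊥g eq)
        ; G₄ = λ {f} {g} {u} f⊥g _ eq → use p∤□ (Lq.G₄-local {f} {g} {u} f⊥g eq)
        }

    offsets : ∀ {m n} → m ≋ n ℕ.+ 8 [% 16 ] ⊎ m ≋ n ℕ.+ 12 [% 16 ] →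
              m % 16 ≡ (n % 16 ℕ.+ 8) % 16 ⊎ m % 16 ≡ (n % 16 ℕ.+ 12) % 16
    offsets {m} {n} = [ (λ e → inj₁ (trans e (%-distribˡ-+ n 8 16))) ,
        (λ e → inj₂ (trans e (%-distribˡ-+ n 12 16))) ]′

    -- Among the multiples of 4 modulo 16, the offsets 8 and 12 are the nonsquares; this excludes
    -- `E₃` when both variables are odd. As `p` is a square modulo `q`, `E₂` and `G₂` reduce to
    -- square roots of -1 and 2 modulo `q`, which do not exist for `q` congruent to 3 modulo 8. `G₃`
    -- and `G₄` fail modulo 4.
    noQuartics₃ : SquareMod q (+ p) → q % 8 ≡ 3 → p ≋ q ℕ.+ 8 [% 16 ] ⊎ p ≋ q ℕ.+ 12 [% 16 ] →
      NoQuartics p q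
    noQuartics₃ (z , q∣z²-p) q≡3 offset =
        build (table₃ (m%n<n p 16) (m%n<n q 16) (%16%8 {q} q≡3) (offsets {p} {q} offset))
      where
      P = p % 16
      Q = q % 16
      q∤z : ¬ + q ∣ z
      q∤z q∣z = Lq.l∤m (subst (+ q ∣_) (lem z (+ p)) (∣m∣n⇒∣m-n (∣n⇒∣m*n z q∣z) q∣z²-p))
        where
        lem : ∀ z p → z * z - (z * z - p) ≡ p
        lem = ℤ-Solver.solve-∀
      -p-nonresidue : q % 4 ≡ 3 → ¬ SquareMod q (- + p)
      -p-nonresidue q≡3′ (x , q∣) = go (divide-square qp 1ℤ -1ℤ {x} {z} q∤z
        (subst (+ q ∣_) (lem x z (+ p)) (∣m∣n⇒∣m+n q∣ q∣z²-p)))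
        where
        lem : ∀ x z p → x * x - - p + (z * z - p) ≡ 1ℤ * (x * x) - -1ℤ * (z * z)
        lem = ℤ-Solver.solve-∀
        go : ¬ (∃ λ y → + q ∣ 1ℤ * (y * y) - -1ℤ)
        go (y , q∣) = -1-nonresidue {q} q≡3′ y
            (subst (λ w → + q ∣ w - -1ℤ) (ℤ.*-identityˡ (y * y)) q∣)
      half-p-nonresidue : ¬ (∃ λ x → + q ∣ + 2 * (x * x) - + p)
      half-p-nonresidue (x , q∣) = half-nonresidue {q} q≡3 (divide-square qp (+ 2) 1ℤ {x} {z} q∤z
        (subst (+ q ∣_) (lem x z (+ p)) (∣m∣n⇒∣m-n q∣ q∣z²-p)))
        where
        lem : ∀ x z p → + 2 * (x * x) - p - (z * z - p) ≡ + 2 * (x * x) - 1ℤ * (z * z)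
        lem = ℤ-Solver.solve-∀
      build : NoQuartic₁₆ Q P × NoSquare₁₆ P Q × NoSquare₁₆ Q P × Q % 4 ≡ 3 → NoQuartics p q
      build (e₃ , g₃ , g₄ , Q≡3) = record
        { E₁ = λ {a} {b} {w} → E₁-at-q q%4≡3 {a} {b} {w}
        ; E₂ = λ {a} {b} {w} a⊥b eq → -p-nonresidue q%4≡3 (Lq.E₂-local {a} {b} {w} a⊥b eq)
        ; E₃ = λ {a} {b} {w} → noQuartic {q} {p} {a} {b} {w} e₃
        ; G₁ = λ {f} {g} {u} f⊥g _ _ eq → half-nonresidue {q} q≡3 (Lq.G₁-local {f} {g} {u} f⊥g eq)
        ; G₂ = λ {f} {g} {u} f⊥g _ _ eq → half-p-nonresidue (Lq.G₂-local {f} {g} {u} f⊥g eq)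
        ; G₃ = λ {f} {g} {u} _ → noSquare {p} {q} {f} {g} {u} g₃
        ; G₄ = λ {f} {g} {u} _ → noSquare {q} {p} {f} {g} {u} g₄
        }
        where q%4≡3 = trans (sym (%16%4 {q} refl)) Q≡3

    -- The offsets now exclude `E₂`. With offset 8, `p + q` is 14 modulo 16 and `G₂` fails there;
    -- with offset 12, `q` is 7 modulo 8 and `G₂` fails modulo `q`. `G₁` is reduced modulo `p`, the
    -- prime known to be 3 modulo 8.
    noQuartics₄ : NonSquare → p % 8 ≡ 3 → q ≋ p ℕ.+ 8 [% 16 ] ⊎ q ≋ p ℕ.+ 12 [% 16 ] →
      NoQuartics p q
    noQuartics₄ p∤□ p≡3 offset =
        build (table₄ (m%n<n p 16) (m%n<n q 16) (%16%8 {p} p≡3) (offsets {q} {p} offset))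
      where
      P = p % 16
      Q = q % 16
      -- One of 2 and -2 is a square modulo `q`, and -2 is not. With `h² ≡ 2`, the relation
      -- `2 x² ≡ p` becomes `(h x)² ≡ p`.
      half-p-nonresidue : q % 4 ≡ 3 → q % 8 ≡ 7 → ¬ (∃ λ x → + q ∣ + 2 * (x * x) - + p)
      half-p-nonresidue q%4≡3 q%8≡7 (x , q∣) = ±-residue qp q%4≡3 (+ 2) Lq.l∤2
        (λ h q∣h²-2 → p∤□ (h * x) (subst (+ q ∣_) (lem h x (+ p))
          (∣m∣n⇒∣m+n (∣m⇒∣m*n (x * x) q∣h²-2) q∣)))
        (-2-nonresidue {q} (inj₂ q%8≡7))
        where
        lem : ∀ h x p → (h * h - + 2) * (x * x) + (+ 2 * (x * x) - p) ≡ h * x * (h * x) - p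
        lem = ℤ-Solver.solve-∀
      build : NoQuartic₁₆ P Q × Q % 4 ≡ 3 × (NoDouble₁₆ P Q ⊎ Q % 8 ≡ 7) → NoQuartics p q
      build (e₂ , Q≡3 , side) = record
        { E₁ = λ {a} {b} {w} → E₁-at-q q%4≡3 {a} {b} {w}
        ; E₂ = λ {a} {b} {w} → noQuartic {p} {q} {a} {b} {w} e₂
        ; E₃ = λ {a} {b} {w} a⊥b eq → use p∤□ (Lq.E₃-local {a} {b} {w} a⊥b eq)
        ; G₁ = λ {f} {g} {u} f⊥g _ _ eq → half-nonresidue {p} p≡3 (Lp.G₁-local {f} {g} {u} f⊥g
                 (trans (cong (λ n → f ℕ.* f ℕ.* (f ℕ.* f) ℕ.+ n ℕ.* (g ℕ.* g ℕ.* (g ℕ.* g)))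
                   (ℕ.*-comm q p)) eq))
        ; G₂ = λ {f} {g} {u} → g₂ side {f} {g} {u}
        ; G₃ = λ {f} {g} {u} f⊥g _ eq → use p∤□ (Lq.G₃-local {f} {g} {u} f⊥g eq)
        ; G₄ = λ {f} {g} {u} f⊥g _ eq → use p∤□ (Lq.G₄-local {f} {g} {u} f⊥g eq)
        }
        where
        q%4≡3 = trans (sym (%16%4 {q} refl)) Q≡3
        g₂ : NoDouble₁₆ P Q ⊎ Q % 8 ≡ 7 → ∀ {f g u} → Coprime f g → ¬ 2 ℕ.∣ f → ¬ 2 ℕ.∣ g →
             p ℕ.* (f ℕ.* f ℕ.* (f ℕ.* f)) ℕ.+ q ℕ.* (g ℕ.* g ℕ.* (g ℕ.* g)) ≢ 2 ℕ.* (u ℕ.* u)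
        g₂ (inj₁ excluded) {f} {g} {u} _ = noDouble {p} {q} {f} {g} {u} excluded
        g₂ (inj₂ Q≡7) {f} {g} {u} f⊥g _ _ eq =
          half-p-nonresidue q%4≡3 (trans (sym (%16%8 {q} refl)) Q≡7)
              (Lq.G₂-local {f} {g} {u} f⊥g eq)

module RationalNumbers where

  open import Data.Empty using (⊥; ⊥-elim)
  open import Data.Integer.Base as ℤ using (ℤ; +_; -[1+_])
  import Data.Integer.Divisibility.Signed as ℤ
  import Data.Integer.Properties as ℤ
  import Data.Integer.Tactic.RingSolver as ℤ-Solver
  open import Data.Nat.Base using (ℕ; zero; suc; NonZero)
  import Data.Nat.Base as ℕ
  open import Data.Nat.Coprimality using (Coprime)
  import Data.Nat.Coprimality as Coprime
  import Data.Nat.Divisibility as ℕ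
  open import Data.Nat.Primality using (Prime; prime⇒nonZero)
  import Data.Nat.Properties as ℕ
  open import Data.Product.Base using (∃; _×_; _,_)
  open import Data.Rational.Base using (ℚ; mkℚ; 0ℚ; 1ℚ; _/_; _+_; _*_; _-_; -_; ↥_; ↧_; ↧ₙ_; toℚᵘ; 1/_)
  import Data.Rational.Base as ℚ
  import Data.Rational.Properties as ℚ
  open import Data.Rational.Solver using (module +-*-Solver)
  open import Data.Rational.Unnormalised.Base using (mkℚᵘ; *≡*)
  import Data.Rational.Unnormalised.Base as ℚᵘ
  import Data.Rational.Unnormalised.Properties as ℚᵘ
  open import Data.Sum.Base using (_⊎_; inj₁; inj₂)
  import Defs
  open import Defs using (_+i_; re; im; 0#; norm-nonZero; _≟_)
  open import Relation.Binary.PropositionalEquality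
  open import Relation.Nullary using (contradiction; ¬_; yes; no)
  open +-*-Solver using (solve; _:+_; _:*_; _:-_; :-_; _:=_; con)
  open NaturalNumbers

  -- Rational points

  ι : ℤ → ℚ
  ι n = n / 1

  ι-spec : ∀ n → toℚᵘ (ι n) ℚᵘ.≃ mkℚᵘ n 0
  ι-spec n = ℚ.toℚᵘ-fromℚᵘ (mkℚᵘ n 0)

  ι-* : ∀ m n → ι (m ℤ.* n) ≡ ι m * ι n
  ι-* m n = ℚ.toℚᵘ-injective (ℚᵘ.≃-trans (ι-spec (m ℤ.* n)) (ℚᵘ.≃-sym
    (ℚᵘ.≃-trans (ℚ.toℚᵘ-homo-* (ι m) (ι n)) (ℚᵘ.*-cong (ι-spec m) (ι-spec n)))))

  ι-*-cong : ∀ m n {x y} → ι m ≡ x → ι n ≡ y → ι (m ℤ.* n) ≡ x * y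
  ι-*-cong m n eq₁ eq₂ = trans (ι-* m n) (cong₂ _*_ eq₁ eq₂)

  ι-+ : ∀ m n → ι (m ℤ.+ n) ≡ ι m + ι n
  ι-+ m n = ℚ.toℚᵘ-injective (ℚᵘ.≃-trans (ι-spec (m ℤ.+ n)) (ℚᵘ.≃-sym
    (ℚᵘ.≃-trans (ℚ.toℚᵘ-homo-+ (ι m) (ι n)) (ℚᵘ.≃-trans (ℚᵘ.+-cong (ι-spec m) (ι-spec n)) sum))))
    where
    sum : mkℚᵘ m 0 ℚᵘ.+ mkℚᵘ n 0 ℚᵘ.≃ mkℚᵘ (m ℤ.+ n) 0
    sum = *≡* (lem m n)
      where
      lem : ∀ m n → (m ℤ.* + 1 ℤ.+ n ℤ.* + 1) ℤ.* + 1 ≡ (m ℤ.+ n) ℤ.* + 1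
      lem = ℤ-Solver.solve-∀

  ι-injective : ∀ {m n} → ι m ≡ ι n → m ≡ n
  ι-injective {m} {n} eq with ℚᵘ.≃-trans (ℚᵘ.≃-sym (ι-spec m))
      (ℚᵘ.≃-trans (ℚᵘ.≃-reflexive (cong toℚᵘ eq)) (ι-spec n))
  ... | *≡* m1≡n1 = trans (sym (ℤ.*-identityʳ m)) (trans m1≡n1 (ℤ.*-identityʳ n))

  *-denominator : ∀ x → x * ι (↧ x) ≡ ι (↥ x)
  *-denominator x@record{} = ℚ.toℚᵘ-injective (ℚᵘ.≃-trans (ℚ.toℚᵘ-homo-* x (ι (↧ x)))
    (ℚᵘ.≃-trans (ℚᵘ.*-cong (ℚᵘ.≃-refl {toℚᵘ x}) (ι-spec (↧ x)))
      (ℚᵘ.≃-trans (*≡* (lem (↥ x) (↧ x))) (ℚᵘ.≃-sym (ι-spec (↥ x))))))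
    where
    lem : ∀ a c → a ℤ.* c ℤ.* + 1 ≡ a ℤ.* (c ℤ.* + 1)
    lem = ℤ-Solver.solve-∀

  square≡∣∣² : ∀ w → w ℤ.* w ≡ + (ℤ.∣ w ∣ ℕ.* ℤ.∣ w ∣)
  square≡∣∣² (+ n)    = sym (ℤ.pos-* n n)
  square≡∣∣² -[1+ n ] = refl

  square≡-k⇒k≡0 : ∀ w k → w ℤ.* w ≡ ℤ.- + k → k ≡ 0
  square≡-k⇒k≡0 w zero    eq = refl
  square≡-k⇒k≡0 w (suc k) eq = contradiction (trans (sym (square≡∣∣² w)) eq) λ ()

  square≡+k⇒ : ∀ w k → w ℤ.* w ≡ + k → ℤ.∣ w ∣ ℕ.* ℤ.∣ w ∣ ≡ k
  square≡+k⇒ w k eq = ℤ.+-injective (trans (sym (square≡∣∣² w)) eq)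

  -- This removes the denominator of `y`: from `d² ∣ m²` follows `d ∣ m`.
  rational-square : ∀ d .{{_ : NonZero d}} {m K} → m ℤ.* m ≡ + d ℤ.* + d ℤ.* K → ∃ λ w → w ℤ.* w ≡ K
  rational-square d {m} {K} eq = go (ℤ.∣ᵤ⇒∣ {+ d} {m} (m²∣n²⇒m∣n d²∣m²))
    where
    d²∣m² : d ℕ.* d ℕ.∣ ℤ.∣ m ∣ ℕ.* ℤ.∣ m ∣
    d²∣m² = subst₂ ℕ._∣_ refl (ℤ.abs-* m m) (subst (λ z → d ℕ.* d ℕ.∣ ℤ.∣ z ∣) (sym eq)
      (subst (d ℕ.* d ℕ.∣_) (sym
        (trans (ℤ.abs-* (+ d ℤ.* + d) K)
          (cong (ℕ._* ℤ.∣ K ∣) (ℤ.abs-* (+ d) (+ d))))) (ℕ.m∣m*n ℤ.∣ K ∣)))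
    go : + d ℤ.∣ m → ∃ λ w → w ℤ.* w ≡ K
    go (ℤ.divides w refl) = w , ℤ.*-cancelˡ-≡ (+ d ℤ.* + d) (w ℤ.* w) K {{ℤ.i*j≢0 (+ d) (+ d)}}
        (trans (lem w (+ d)) eq)
      where
      lem : ∀ w d → d ℤ.* d ℤ.* (w ℤ.* w) ≡ w ℤ.* d ℤ.* (w ℤ.* d)
      lem = ℤ-Solver.solve-∀

  -- With x = a / c and y = m / d, the equation times c⁴ d² is an equation between integers.
  integral-equation : ∀ N x y → y * y ≡ x * x * x + ι N * x →
    ∃ λ w → w ℤ.* w ≡ ↧ x ℤ.* (↥ x ℤ.* (↥ x ℤ.* ↥ x ℤ.+ N ℤ.* (↧ x ℤ.* ↧ x)))
  integral-equation N x y on = rational-square (↧ₙ y) {↥ y ℤ.* (c ℤ.* c)}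
    (ι-injective (trans left (trans middle (sym right))))
    where
    a = ↥ x
    c = ↧ x
    d = ↧ y
    left : ι (↥ y ℤ.* (c ℤ.* c) ℤ.* (↥ y ℤ.* (c ℤ.* c))) ≡
      (y * ι d * (ι c * ι c)) * (y * ι d * (ι c * ι c))
    left = ι-*-cong (↥ y ℤ.* (c ℤ.* c)) (↥ y ℤ.* (c ℤ.* c)) root root
      where
      root : ι (↥ y ℤ.* (c ℤ.* c)) ≡ y * ι d * (ι c * ι c)
      root = ι-*-cong (↥ y) (c ℤ.* c) (sym (*-denominator y)) (ι-* c c)
    right : ι (d ℤ.* d ℤ.* (c ℤ.* (a ℤ.* (a ℤ.* a ℤ.+ N ℤ.* (c ℤ.* c))))) ≡
            ι d * ι d * (ι c * (x * ι c * (x * ι c * (x * ι c) + ι N * (ι c * ι c))))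
    right = ι-*-cong (d ℤ.* d) (c ℤ.* (a ℤ.* (a ℤ.* a ℤ.+ N ℤ.* (c ℤ.* c)))) (ι-* d d)
      (ι-*-cong c (a ℤ.* (a ℤ.* a ℤ.+ N ℤ.* (c ℤ.* c))) refl
      (ι-*-cong a (a ℤ.* a ℤ.+ N ℤ.* (c ℤ.* c)) ιa≡
      (trans (ι-+ (a ℤ.* a) (N ℤ.* (c ℤ.* c)))
        (cong₂ _+_ (ι-*-cong a a ιa≡ ιa≡) (ι-*-cong N (c ℤ.* c) refl (ι-* c c))))))
      where ιa≡ = sym (*-denominator x)
    middle : (y * ι d * (ι c * ι c)) * (y * ι d * (ι c * ι c)) ≡
             ι d * ι d * (ι c * (x * ι c * (x * ι c * (x * ι c) + ι N * (ι c * ι c))))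
    middle = trans (solve 3 (λ y d c →
        (y :* d :* (c :* c)) :* (y :* d :* (c :* c)) := y :* y :* (d :* d :* (c :* c :* (c :* c))))
        refl y (ι d) (ι c))
      (trans (cong (λ z → z * (ι d * ι d * (ι c * ι c * (ι c * ι c)))) on)
        (solve 4 (λ x d c n → (x :* x :* x :+ n :* x) :* (d :* d :* (c :* c :* (c :* c))) :=
                              d :* d :* (c :* (x :* c :*
                                  (x :* c :* (x :* c) :+ n :*
                                    (c :* c))))) refl x (ι d) (ι c) (ι N)))

  module RationalPoints {p q : ℕ} (pp : Prime p) (qp : Prime q) (p≢q : p ≢ q)
    (2∤p : ¬ 2 ℕ.∣ p) (2∤q : ¬ 2 ℕ.∣ q) (nq : NoQuartics p q) where

    open IntegralPoints pp qp p≢q 2∤p 2∤q nq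

    private
      N : ℕ
      N = p ℕ.* q

      product≡0⇒t≡0 : ∀ a c t → a ≢ 0 → c ≢ 0 → c ℕ.* (a ℕ.* t) ≡ 0 → t ≡ 0
      product≡0⇒t≡0 a c t a≢0 c≢0 eq with ℕ.m*n≡0⇒m≡0∨n≡0 c eq
      ... | inj₁ c≡0 = contradiction c≡0 c≢0
      ... | inj₂ at≡0 with ℕ.m*n≡0⇒m≡0∨n≡0 a at≡0
      ... | inj₁ a≡0 = contradiction a≡0 a≢0
      ... | inj₂ t≡0 = t≡0

      pos-cat : ∀ c a t → + (c ℕ.* (a ℕ.* t)) ≡ + c ℤ.* (+ a ℤ.* + t)
      pos-cat c a t = trans (ℤ.pos-* c (a ℕ.* t)) (cong (+ c ℤ.*_) (ℤ.pos-* a t))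

      pos-Nc² : ∀ c → + (N ℕ.* (c ℕ.* c)) ≡ + N ℤ.* (+ c ℤ.* + c)
      pos-Nc² c = trans (ℤ.pos-* N (c ℕ.* c)) (cong (+ N ℤ.*_) (ℤ.pos-* c c))

      above : ∀ a c t → a ℕ.* a ≡ N ℕ.* (c ℕ.* c) ℕ.+ t →
        + a ℤ.* + a ≡ + N ℤ.* (+ c ℤ.* + c) ℤ.+ + t
      above a c t eq = trans (sym (ℤ.pos-* a a)) (trans (cong +_ eq) (cong (ℤ._+ + t) (pos-Nc² c)))

      below : ∀ a c t → N ℕ.* (c ℕ.* c) ≡ a ℕ.* a ℕ.+ t →
        + N ℤ.* (+ c ℤ.* + c) ≡ + a ℤ.* + a ℤ.+ + t
      below a c t eq = trans (sym (pos-Nc² c)) (trans (cong +_ eq) (cong (ℤ._+ + t) (ℤ.pos-* a a)))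

    compare : ∀ a c → (∃ λ t → a ℕ.* a ≡ N ℕ.* (c ℕ.* c) ℕ.+ t) ⊎
      (∃ λ t → N ℕ.* (c ℕ.* c) ≡ a ℕ.* a ℕ.+ t)
    compare a c with ℕ.≤-total (N ℕ.* (c ℕ.* c)) (a ℕ.* a)
    ... | inj₁ le with t , eq ← ℕ.m≤n⇒∃[o]m+o≡n le = inj₁ (t , sym eq)
    ... | inj₂ le with t , eq ← ℕ.m≤n⇒∃[o]m+o≡n le = inj₂ (t , sym eq)

    -- If `a² ≤ N c²`, the right-hand side is `- c a t`, a square only for `t = 0`. What remains is
    -- `a² = N c²`, the instance `t = w = 0` of `no-positive`.
    no-positive-numerator : ∀ a c w → a ≢ 0 → c ≢ 0 → Coprime a c →
      w ℤ.* w ≢ + c ℤ.* (+ a ℤ.* (+ a ℤ.* + a ℤ.+ ℤ.- + N ℤ.* (+ c ℤ.* + c)))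
    no-positive-numerator a c w a≢0 c≢0 a⊥c eq = go (compare a c)
      where
      go : _ → ⊥
      go (inj₁ (t , a²≡)) = no-positive {a} {c} {t} {ℤ.∣ w ∣} a≢0 c≢0 a⊥c a²≡
          (square≡+k⇒ w (c ℕ.* (a ℕ.* t))
        (trans eq (trans (cong (λ z → + c ℤ.* (+ a ℤ.* (z ℤ.+ ℤ.- + N ℤ.* (+ c ℤ.* + c))))
          (above a c t a²≡))
          (trans (lem (+ a) (+ c) (+ t) (+ N)) (sym (pos-cat c a t))))))
        where
        lem : ∀ a c t N → c ℤ.* (a ℤ.* (N ℤ.* (c ℤ.* c) ℤ.+ t ℤ.+ ℤ.- N ℤ.* (c ℤ.* c))) ≡
          c ℤ.* (a ℤ.* t)
        lem = ℤ-Solver.solve-∀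
      go (inj₂ (t , c²≡)) = no-positive {a} {c} {0} {0} a≢0 c≢0 a⊥c
        (sym (trans (ℕ.+-identityʳ _)
          (trans c²≡ (trans (cong (a ℕ.* a ℕ.+_) t≡0) (ℕ.+-identityʳ _)))))
        (sym (trans (cong (c ℕ.*_) (ℕ.*-zeroʳ a)) (ℕ.*-zeroʳ c)))
        where
        lem₁ : ∀ a c N → c ℤ.* (a ℤ.* (a ℤ.* a ℤ.+ ℤ.- N ℤ.* (c ℤ.* c))) ≡
          c ℤ.* (a ℤ.* (a ℤ.* a ℤ.+ ℤ.- (N ℤ.* (c ℤ.* c))))
        lem₁ = ℤ-Solver.solve-∀
        lem₂ : ∀ a c t → c ℤ.* (a ℤ.* (a ℤ.* a ℤ.+ ℤ.- (a ℤ.* a ℤ.+ t))) ≡ ℤ.- (c ℤ.* (a ℤ.* t))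
        lem₂ = ℤ-Solver.solve-∀
        t≡0 : t ≡ 0
        t≡0 = product≡0⇒t≡0 a c t a≢0 c≢0
            (square≡-k⇒k≡0 w (c ℕ.* (a ℕ.* t)) (trans eq (trans (lem₁ (+ a) (+ c) (+ N))
          (trans (cong (λ z → + c ℤ.* (+ a ℤ.* (+ a ℤ.* + a ℤ.+ ℤ.- z))) (below a c t c²≡))
            (trans (lem₂ (+ a) (+ c) (+ t)) (cong ℤ.-_ (sym (pos-cat c a t))))))))

    -- The sign of the numerator reverses the two cases: `a² ≥ N c²` is now the one that degenerates
    -- to `t = 0`.
    no-negative-numerator : ∀ a c w → a ≢ 0 → c ≢ 0 → Coprime a c →
      w ℤ.* w ≢ + c ℤ.* (ℤ.- + a ℤ.* (ℤ.- + a ℤ.* ℤ.- + a ℤ.+ ℤ.- + N ℤ.* (+ c ℤ.* + c)))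
    no-negative-numerator a c w a≢0 c≢0 a⊥c eq = go (compare a c)
      where
      go : _ → ⊥
      go (inj₂ (t , c²≡)) = no-negative {a} {c} {t} {ℤ.∣ w ∣} a≢0 a⊥c c²≡
          (square≡+k⇒ w (c ℕ.* (a ℕ.* t))
        (trans eq (trans (lem₁ (+ a) (+ c) (+ N))
          (trans (cong (λ z → + c ℤ.* (+ a ℤ.* (z ℤ.- + a ℤ.* + a))) (below a c t c²≡))
          (trans (lem₂ (+ a) (+ c) (+ t)) (sym (pos-cat c a t)))))))
        where
        lem₁ : ∀ a c N → c ℤ.* (ℤ.- a ℤ.* (ℤ.- a ℤ.* ℤ.- a ℤ.+ ℤ.- N ℤ.* (c ℤ.* c))) ≡
          c ℤ.* (a ℤ.* (N ℤ.* (c ℤ.* c) ℤ.- a ℤ.* a))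
        lem₁ = ℤ-Solver.solve-∀
        lem₂ : ∀ a c t → c ℤ.* (a ℤ.* (a ℤ.* a ℤ.+ t ℤ.- a ℤ.* a)) ≡ c ℤ.* (a ℤ.* t)
        lem₂ = ℤ-Solver.solve-∀
      go (inj₁ (t , a²≡)) = no-negative {a} {c} {0} {0} a≢0 a⊥c
        (sym (trans (ℕ.+-identityʳ _)
          (trans a²≡ (trans (cong (N ℕ.* (c ℕ.* c) ℕ.+_) t≡0) (ℕ.+-identityʳ _)))))
        (sym (trans (cong (c ℕ.*_) (ℕ.*-zeroʳ a)) (ℕ.*-zeroʳ c)))
        where
        lem₁ : ∀ a c N → c ℤ.* (ℤ.- a ℤ.* (ℤ.- a ℤ.* ℤ.- a ℤ.+ ℤ.- N ℤ.* (c ℤ.* c))) ≡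
          c ℤ.* (a ℤ.* (N ℤ.* (c ℤ.* c) ℤ.- a ℤ.* a))
        lem₁ = ℤ-Solver.solve-∀
        lem₂ : ∀ a c t N → c ℤ.* (a ℤ.* (N ℤ.- (N ℤ.+ t))) ≡ ℤ.- (c ℤ.* (a ℤ.* t))
        lem₂ = ℤ-Solver.solve-∀
        t≡0 : t ≡ 0
        t≡0 = product≡0⇒t≡0 a c t a≢0 c≢0
            (square≡-k⇒k≡0 w (c ℕ.* (a ℕ.* t)) (trans eq (trans (lem₁ (+ a) (+ c) (+ N))
          (trans (cong (λ z → + c ℤ.* (+ a ℤ.* (+ N ℤ.* (+ c ℤ.* + c) ℤ.- z))) (above a c t a²≡))
            (trans (lem₂ (+ a) (+ c) (+ t) (+ N ℤ.* (+ c ℤ.* + c)))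
              (cong ℤ.-_ (sym (pos-cat c a t))))))))

    rational-point : ∀ x y → y * y ≡ x * x * x + ι (ℤ.- + N) * x → x ≡ 0ℚ
    rational-point x@(mkℚ a c-1 coprime) y on = go a refl (integral-equation (ℤ.- + N) x y on)
      where
      c = suc c-1
      a⊥c : Coprime ℤ.∣ a ∣ c
      a⊥c = Coprime.recompute coprime
      go : ∀ a′ → a ≡ a′ → (∃ λ w →
        w ℤ.* w ≡ + c ℤ.* (a ℤ.* (a ℤ.* a ℤ.+ ℤ.- + N ℤ.* (+ c ℤ.* + c)))) → x ≡ 0ℚ
      go (+ zero)  a≡ _ = ℚ.↥p≡0⇒p≡0 x a≡
      go (+ suc n) refl (w , w²≡) = ⊥-elim (no-positive-numerator (suc n) c w (λ ()) (λ ()) a⊥c w²≡)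
      go -[1+ n ]  refl (w , w²≡) = ⊥-elim (no-negative-numerator (suc n) c w (λ ()) (λ ()) a⊥c w²≡)

    -- By sign. This rules out points `(i x₂ , 0)` of order 2, for which `x₂² = - p q`.
    -pq-nonsquare : ∀ x → x * x ≢ ι (ℤ.- + N)
    -pq-nonsquare x eq = ℕ.m<n⇒n≢0 0<Nc² (square≡-k⇒k≡0 a (N ℕ.* (↧ₙ x ℕ.* ↧ₙ x)) a²≡)
      where
      a = ↥ x
      c = ↧ x
      instance
        _ = prime⇒nonZero pp
        _ = prime⇒nonZero qp
      0<Nc² : 0 ℕ.< N ℕ.* (↧ₙ x ℕ.* ↧ₙ x)
      0<Nc² = ℕ.>-nonZero⁻¹ _ {{ℕ.m*n≢0 N (↧ₙ x ℕ.* ↧ₙ x) {{ℕ.m*n≢0 p q}}}}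
      a²≡′ : ι (a ℤ.* a) ≡ ι (ℤ.- + N ℤ.* (c ℤ.* c))
      a²≡′ = trans (ι-*-cong a a (sym (*-denominator x)) (sym (*-denominator x)))
        (trans (solve 2 (λ x c → x :* c :* (x :* c) := x :* x :* (c :* c)) refl x (ι c))
        (trans (cong (_* (ι c * ι c)) eq) (sym (ι-*-cong (ℤ.- + N) (c ℤ.* c) refl (ι-* c c)))))
      a²≡ : a ℤ.* a ≡ ℤ.- + (N ℕ.* (↧ₙ x ℕ.* ↧ₙ x))
      a²≡ = trans (ι-injective {a ℤ.* a} {ℤ.- + N ℤ.* (c ℤ.* c)} a²≡′)
          (trans (sym (ℤ.neg-distribˡ-* (+ N) (c ℤ.* c)))
        (cong ℤ.-_ (sym (trans (ℤ.pos-* N (↧ₙ x ℕ.* ↧ₙ x))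
          (cong (+ N ℤ.*_) (ℤ.pos-* (↧ₙ x) (↧ₙ x)))))))

  -- Points over `ℚ(i)`

  *-cancel-0 : ∀ {x z} → x ≢ 0ℚ → x * z ≡ 0ℚ → z ≡ 0ℚ
  *-cancel-0 {x} {z} x≢0 xz≡0 =
      trans (sym (ℚ.*-identityˡ z)) (trans (cong (_* z) (sym (ℚ.*-inverseˡ x)))
    (trans (ℚ.*-assoc (1/ x) x z) (trans (cong (1/ x *_) xz≡0) (ℚ.*-zeroʳ (1/ x)))))
    where instance _ = ℚ.≢-nonZero x≢0

  square≡0 : ∀ {x} → x * x ≡ 0ℚ → x ≡ 0ℚ
  square≡0 {x} x²≡0 with x ℚ.≟ 0ℚ
  ... | yes x≡0 = x≡0
  ... | no  x≢0 = *-cancel-0 x≢0 x²≡0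

  sum-of-squares≡0 : ∀ {x y} → x * x + y * y ≡ 0ℚ → x ≡ 0ℚ
  sum-of-squares≡0 {x} {y} eq with (x +i y) ≟ 0#
  ... | yes z≡0 = cong re z≡0
  ... | no  z≢0 = contradiction refl (ℕ.≢-nonZero⁻¹ 0 {{subst ℚ.NonZero eq (norm-nonZero z≢0)}})

  difference≡0 : ∀ {x y} → x - y ≡ 0ℚ → x ≡ y
  difference≡0 {x} {y} eq = trans (solve 2 (λ x y → x := x :- y :+ y) refl x y)
      (trans (cong (_+ y) eq) (ℚ.+-identityˡ y))

  ≡⇒difference≡0 : ∀ {x y} → x ≡ y → x - y ≡ 0ℚ
  ≡⇒difference≡0 {x} refl = ℚ.+-inverseʳ x

  module GaussianPoints (n : ℚ) (rational-point : ∀ x y → y * y ≡ x * x * x + n * x → x ≡ 0ℚ)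
    (n≢□ : ∀ x → x * x ≢ n) where

    -- The real and imaginary parts of `y² = x³ + n x` for `x = x₁ + i x₂` and `y = y₁ + i y₂`.
    Re Im : (x₁ x₂ y₁ y₂ : ℚ) → Set
    Re x₁ x₂ y₁ y₂ = y₁ * y₁ - y₂ * y₂ ≡ x₁ * x₁ * x₁ - (x₁ + x₁ + x₁) * (x₂ * x₂) + n * x₁
    Im x₁ x₂ y₁ y₂ = (y₁ + y₁) * y₂ ≡ x₂ * ((x₁ + x₁ + x₁) * x₁ - x₂ * x₂ + n)

    -- The line through (x , y) and its conjugate has slope m = y₂ / x₂; it meets the
    -- curve again in a rational point, whose abscissa is m² - 2 x₁.
    conjugate-chord : ∀ {x₁ x₂ y₁ y₂} → x₂ ≢ 0ℚ → Re x₁ x₂ y₁ y₂ → Im x₁ x₂ y₁ y₂ →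
                      ∃ λ m → m * x₂ ≡ y₂ × m * m ≡ x₁ + x₁
    conjugate-chord {x₁} {x₂} {y₁} {y₂} x₂≢0 re-eq im-eq =
        m , mx₂≡y₂ , difference≡0 (rational-point X Y on)
      where
      instance _ = ℚ.≢-nonZero x₂≢0
      m = y₂ * 1/ x₂
      X = m * m - (x₁ + x₁)
      Y = m * (x₁ - X) - y₁
      mx₂≡y₂ : m * x₂ ≡ y₂
      mx₂≡y₂ = trans (ℚ.*-assoc y₂ (1/ x₂) x₂)
          (trans (cong (y₂ *_) (ℚ.*-inverseˡ x₂)) (ℚ.*-identityʳ y₂))
      R = x₁ * x₁ * x₁ - (x₁ + x₁ + x₁) * (x₂ * x₂) + n * x₁
      S = (x₁ + x₁ + x₁) * x₁ - x₂ * x₂ + n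
      e₁ : y₁ * y₁ - m * x₂ * (m * x₂) - R ≡ 0ℚ
      e₁ = ≡⇒difference≡0 (trans (cong (λ z → y₁ * y₁ - z * z) mx₂≡y₂) re-eq)
      -- With `y₂ = m x₂` both sides of the imaginary part are multiples of `x₂`.
      e₂ : (y₁ + y₁) * m - S ≡ 0ℚ
      e₂ = *-cancel-0 x₂≢0 (trans
          (solve 4 (λ x₂ y₁ m S → x₂ :* ((y₁ :+ y₁) :* m :- S) := (y₁ :+ y₁) :*
            (m :* x₂) :- x₂ :* S) refl x₂ y₁ m S)
        (≡⇒difference≡0 (trans (cong ((y₁ + y₁) *_) mx₂≡y₂) im-eq)))
      -- `Y² - X³ - n X` is the left side of `e₁` minus `x₁ - X` times that of `e₂`.
      on : Y * Y ≡ X * X * X + n * X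
      on = trans (solve 5 (λ x₁ x₂ y₁ m n →
            let X = m :* m :- (x₁ :+ x₁)
                Y = m :* (x₁ :- X) :- y₁
                R = x₁ :* x₁ :* x₁ :- (x₁ :+ x₁ :+ x₁) :* (x₂ :* x₂) :+ n :* x₁
                S = (x₁ :+ x₁ :+ x₁) :* x₁ :- x₂ :* x₂ :+ n
            in Y :* Y := X :* X :* X :+ n :* X :+ (y₁ :* y₁ :- m :* x₂ :* (m :* x₂) :- R) :-
                (x₁ :- X) :* ((y₁ :+ y₁) :* m :- S))
            refl x₁ x₂ y₁ m n)
        (trans (cong₂ (λ u v → X * X * X + n * X + u - (x₁ - X) * v) e₁ e₂)
          (solve 2 (λ z w → z :+ con 0ℚ :- w :* con 0ℚ := z) refl (X * X * X + n * X) (x₁ - X)))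

    -- Multiplication by i maps (x , y) to (- x , i y).
    no-imaginary-abscissa : ∀ {x₁ x₂ y₁ y₂} → x₂ ≢ 0ℚ → Re x₁ x₂ y₁ y₂ → Im x₁ x₂ y₁ y₂ → ⊥
    no-imaginary-abscissa {x₁} {x₂} {y₁} {y₂} x₂≢0 re-eq im-eq =
      go (conjugate-chord {x₁} {x₂} {y₁} {y₂} x₂≢0 re-eq im-eq)
         (conjugate-chord { - x₁} { - x₂} { - y₂} {y₁} -x₂≢0 re-eq′ im-eq′)
      where
      -x₂≢0 : - x₂ ≢ 0ℚ
      -x₂≢0 eq = x₂≢0 (ℚ.neg-injective eq)
      re-eq′ : Re (- x₁) (- x₂) (- y₂) y₁
      re-eq′ = trans (solve 2 (λ y₁ y₂ →
          (:- y₂) :* (:- y₂) :- y₁ :* y₁ := :- (y₁ :* y₁ :- y₂ :* y₂)) refl y₁ y₂)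
        (trans (cong -_ re-eq) (solve 3 (λ x₁ x₂ n →
          :- (x₁ :* x₁ :* x₁ :- (x₁ :+ x₁ :+ x₁) :* (x₂ :* x₂) :+ n :* x₁) :=
          (:- x₁) :* (:- x₁) :* (:- x₁) :- ((:- x₁) :+ (:- x₁) :+ (:- x₁)) :*
            ((:- x₂) :* (:- x₂)) :+ n :* (:- x₁)) refl x₁ x₂ n))
      im-eq′ : Im (- x₁) (- x₂) (- y₂) y₁
      im-eq′ = trans (solve 2 (λ y₁ y₂ →
          ((:- y₂) :+ (:- y₂)) :* y₁ := :- ((y₁ :+ y₁) :* y₂)) refl y₁ y₂)
        (trans (cong -_ im-eq) (solve 3 (λ x₁ x₂ n →
          :- (x₂ :* ((x₁ :+ x₁ :+ x₁) :* x₁ :- x₂ :* x₂ :+ n)) :=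
          (:- x₂) :* (((:- x₁) :+ (:- x₁) :+ (:- x₁)) :* (:- x₁) :- (:- x₂) :*
            (:- x₂) :+ n)) refl x₁ x₂ n))
      -- The squares of the two slopes are `2 x₁` and `-2 x₁`, so both slopes vanish. Then
      -- `x₁ = y₂ = 0`, and the imaginary part leaves `x₂ (n - x₂²) = 0`.
      go : (∃ λ m → m * x₂ ≡ y₂ × m * m ≡ x₁ + x₁) → (∃ λ m → m * - x₂ ≡ y₁ × m * m ≡ - x₁ + - x₁) →
        ⊥
      go (m , mx₂≡y₂ , m²≡) (m′ , m′x₂≡y₁ , m′²≡) = n≢□ x₂ (sym (difference≡0
        (*-cancel-0 x₂≢0 (trans (solve 2
          (λ x₂ n → x₂ :* (n :- x₂ :* x₂) := x₂ :*
            ((con 0ℚ :+ con 0ℚ :+ con 0ℚ) :* con 0ℚ :- x₂ :* x₂ :+ n)) refl x₂ n)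
          (trans (sym (subst₂ (λ x y →
            (y₁ + y₁) * y ≡ x₂ * ((x + x + x) * x - x₂ * x₂ + n)) x₁≡0 y₂≡0 im-eq)) (ℚ.*-zeroʳ (y₁ + y₁)))))))
        where
        m≡0 : m ≡ 0ℚ
        m≡0 = sum-of-squares≡0 {m} {m′} (trans (cong₂ _+_ m²≡ m′²≡)
          (solve 1 (λ x → x :+ x :+ (:- x :+ :- x) := con 0ℚ) refl x₁))
        y₂≡0 : y₂ ≡ 0ℚ
        y₂≡0 = trans (sym mx₂≡y₂) (trans (cong (_* x₂) m≡0) (ℚ.*-zeroˡ x₂))
        x₁≡0 : x₁ ≡ 0ℚ
        x₁≡0 = *-cancel-0 {1ℚ + 1ℚ} (λ ())
            (trans (solve 1 (λ x → (con 1ℚ :+ con 1ℚ) :* x := x :+ x) refl x₁)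
          (trans (sym m²≡) (trans (cong (λ m → m * m) m≡0) (ℚ.*-zeroˡ 0ℚ))))

    -- The imaginary part is `2 y₁ y₂ = 0`. If `y₂ = 0` the point is rational; if `y₁ = 0`, then
    -- `(- x₁ , y₂)` is a rational point of the same curve.
    real-abscissa : ∀ {x₁ y₁ y₂} → Re x₁ 0ℚ y₁ y₂ → Im x₁ 0ℚ y₁ y₂ → x₁ ≡ 0ℚ × y₁ ≡ 0ℚ × y₂ ≡ 0ℚ
    real-abscissa {x₁} {y₁} {y₂} re-eq im-eq with y₂ ℚ.≟ 0ℚ
    ... | yes refl = x₁≡0 , square≡0 (trans real (trans (cong (λ x → x * x * x + n * x) x₁≡0)
            (solve 1 (λ n → con 0ℚ :* con 0ℚ :* con 0ℚ :+ n :* con 0ℚ := con 0ℚ) refl n))) , refl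
      where
      real : y₁ * y₁ ≡ x₁ * x₁ * x₁ + n * x₁
      real = trans (solve 1 (λ y → y :* y := y :* y :- con 0ℚ :* con 0ℚ) refl y₁) (trans re-eq
        (solve 2 (λ x n → x :* x :* x :- (x :+ x :+ x) :*
          (con 0ℚ :* con 0ℚ) :+ n :* x := x :* x :* x :+ n :* x) refl x₁ n))
      x₁≡0 : x₁ ≡ 0ℚ
      x₁≡0 = rational-point x₁ y₁ real
    ... | no y₂≢0 = contradiction y₂≡0 y₂≢0
      where
      y₁≡0 : y₁ ≡ 0ℚ
      y₁≡0 = *-cancel-0 {1ℚ + 1ℚ} (λ ()) (*-cancel-0 y₂≢0
        (trans (solve 2 (λ y₁ y₂ → y₂ :* ((con 1ℚ :+ con 1ℚ) :* y₁) := (y₁ :+ y₁) :* y₂) refl y₁ y₂)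
          (trans im-eq (ℚ.*-zeroˡ ((x₁ + x₁ + x₁) * x₁ - 0ℚ * 0ℚ + n)))))
      twisted : y₂ * y₂ ≡ - x₁ * - x₁ * - x₁ + n * - x₁
      twisted = trans (solve 1 (λ y → y :* y := :- (con 0ℚ :* con 0ℚ :- y :* y)) refl y₂)
        (trans (cong -_ (trans (cong (λ y → y * y - y₂ * y₂) (sym y₁≡0)) re-eq))
        (solve 2 (λ x n → :- (x :* x :* x :- (x :+ x :+ x) :* (con 0ℚ :* con 0ℚ) :+ n :* x) :=
                          (:- x) :* (:- x) :* (:- x) :+ n :* (:- x)) refl x₁ n))
      y₂≡0 : y₂ ≡ 0ℚ
      y₂≡0 = square≡0 (trans twisted
          (trans (cong (λ x → x * x * x + n * x) (rational-point (- x₁) y₂ twisted))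
            (solve 1 (λ n → con 0ℚ :* con 0ℚ :* con 0ℚ :+ n :* con 0ℚ := con 0ℚ) refl n)))

    gaussian-point : ∀ x y → y Defs.* y ≡ x Defs.* x Defs.* x Defs.+ (n +i 0ℚ) Defs.* x Defs.+ 0# →
      x ≡ 0# × y ≡ 0#
    gaussian-point (x₁ +i x₂) (y₁ +i y₂) on = by-abscissa (x₂ ℚ.≟ 0ℚ)
      where
      re-eq : Re x₁ x₂ y₁ y₂
      re-eq = trans (cong re on) (solve 3 (λ x₁ x₂ n →
        (x₁ :* x₁ :- x₂ :* x₂) :* x₁ :- (x₁ :* x₂ :+ x₂ :* x₁) :* x₂ :+
          (n :* x₁ :- con 0ℚ :* x₂) :+ con 0ℚ :=
        x₁ :* x₁ :* x₁ :- (x₁ :+ x₁ :+ x₁) :* (x₂ :* x₂) :+ n :* x₁) refl x₁ x₂ n)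
      im-eq : Im x₁ x₂ y₁ y₂
      im-eq = trans (solve 2 (λ y₁ y₂ → (y₁ :+ y₁) :* y₂ := y₁ :* y₂ :+ y₂ :* y₁) refl y₁ y₂)
        (trans (cong im on) (solve 3 (λ x₁ x₂ n →
          (x₁ :* x₁ :- x₂ :* x₂) :* x₂ :+ (x₁ :* x₂ :+ x₂ :* x₁) :* x₁ :+
            (n :* x₂ :+ con 0ℚ :* x₁) :+ con 0ℚ :=
          x₂ :* ((x₁ :+ x₁ :+ x₁) :* x₁ :- x₂ :* x₂ :+ n)) refl x₁ x₂ n))
      by-abscissa : _ → x₁ +i x₂ ≡ 0# × y₁ +i y₂ ≡ 0#
      by-abscissa (no x₂≢0) = ⊥-elim (no-imaginary-abscissa {x₁} {x₂} {y₁} {y₂} x₂≢0 re-eq im-eq)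
      by-abscissa (yes x₂≡0) = finish
          (real-abscissa {x₁} {y₁} {y₂} (subst (λ x₂ → Re x₁ x₂ y₁ y₂) x₂≡0 re-eq)
            (subst (λ x₂ → Im x₁ x₂ y₁ y₂) x₂≡0 im-eq))
        where
        finish : x₁ ≡ 0ℚ × y₁ ≡ 0ℚ × y₂ ≡ 0ℚ → x₁ +i x₂ ≡ 0# × y₁ +i y₂ ≡ 0#
        finish (x₁≡0 , y₁≡0 , y₂≡0) = cong₂ _+i_ x₁≡0 x₂≡0 , cong₂ _+i_ y₁≡0 y₂≡0

-- Torsion and the rank

import Defs
open import Defs using (_≅_[mod_]; legendre; HasRank; E⟨_,_⟩)
open import Defs using (Point; ∞; aff; _⊕_; 0#; _≟_; OnCurve; MordellWeil; Dependent)
open import Data.Fin.Base using (Fin; zero)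
import Data.Integer.Base as ℤ
open import Data.Integer.Base using (+_; _-_; -1ℤ; 1ℤ)
open import Data.Nat.Base using (ℕ; _*_)
open import Data.Nat.Divisibility using (_∣_)
open import Data.Nat.Primality using (Prime)
open import Data.Nat.Primality using (prime⇒nonZero)
open import Data.Product.Base using (_×_)
open import Data.Product.Base using (_,_; proj₂)
open import Data.Sum.Base using (_⊎_)
open import Data.Sum.Base using (inj₁; inj₂; map)
open import Function.Base using (_∘_)
open import Relation.Binary.PropositionalEquality using (_≡_; _≢_)
open import Relation.Binary.PropositionalEquality using (refl; cong)
open import Relation.Nullary using (¬_)
open import Relation.Nullary using (contradiction; yes; no)
open import Relation.Nullary.Decidable using (recompute)
open NaturalNumbers using (NoQuartics)
open QuadraticResidues
open RationalNumbers

-- At `y = 0` the tangent is vertical. The left-hand side is the unfolding of `2 ×ℕ P`.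
double≡∞ : ∀ {a b} → (∀ x y → OnCurve a b x y → y ≡ 0#) → (P : Point a b) → P ⊕ (P ⊕ ∞) ≡ ∞
double≡∞ y≡0 ∞ = refl
double≡∞ {a} {b} y≡0 (aff x y on)
  -- The equation stored in a point is irrelevant; decidable equality recovers a proof that can be
  -- used.
  with y≡0 x y (recompute (y Defs.* y ≟ x Defs.* x Defs.* x Defs.+ a Defs.* x Defs.+ b) on)
... | refl with x ≟ x
... | yes _ = refl
... | no x≢x = contradiction refl x≢x

-- The coefficient 2 annihilates any single point; the outer `⊕ ∞` is the end of the one-term sum.
rank-0 : ∀ {a b} → (∀ x y → OnCurve a b x y → y ≡ 0#) → HasRank (MordellWeil a b) 0
rank-0 {a} {b} y≡0 = ((λ ()) , λ _ _ ()) , dependent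
  where
  dependent : (v : Fin 1 → Point a b) → Dependent (MordellWeil a b) v
  dependent v = (λ _ → + 2) , (zero , λ ()) , cong (_⊕ ∞) (double≡∞ y≡0 (v zero))

corollary1p5 : ∀ (p q : ℕ) → Prime p → Prime q → ¬ (2 ∣ p) → ¬ (2 ∣ q) → p ≢ q →
    (   ( + p ≅ + 1 [mod 4 ] × + q ≅ + 1 [mod 4 ]
    × + (p * q) ≅ + 13 [mod 16 ] × legendre (+ p) q ≡ -1ℤ )
    ⊎ ( ¬ (+ p ≅ + q [mod 4 ])
    × + (p * q) ≅ + 3 [mod 8 ] × legendre (+ p) q ≡ -1ℤ )
    ⊎ ( + p ≅ + q [mod 4 ] × + q ≅ + 3 [mod 4 ]
    × legendre (+ p) q ≡ 1ℤ × + q ≅ + 3 [mod 8 ]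
    × (+ p - + q ≅ + 8 [mod 16 ] ⊎ + p - + q ≅ + 12 [mod 16 ]) )
    ⊎ ( + p ≅ + q [mod 4 ] × + q ≅ + 3 [mod 4 ]
    × legendre (+ p) q ≡ -1ℤ × + p ≅ + 3 [mod 8 ]
    × (+ q - + p ≅ + 8 [mod 16 ] ⊎ + q - + p ≅ + 12 [mod 16 ]) ) ) →
    HasRank E⟨ p , q ⟩ 0
corollary1p5 p q pp qp 2∤p 2∤q p≢q conditions = rank-0 λ x y on → proj₂ (gaussian-point x y on)
  where
  instance _ = prime⇒nonZero qp
  open Cases pp qp 2∤p 2∤q p≢q
  noQuartics : _ → NoQuartics p q
  noQuartics (inj₁ (p≅1 , q≅1 , pq≅13 , symbol)) =
    noQuartics₁ (≅⇒≡% {p} {1} p≅1) (≅⇒≡% {q} {1} q≅1) (≅⇒≡% {p * q} {13} pq≅13)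
        (legendre≡-1 {+ p} {q} symbol)
  noQuartics (inj₂ (inj₁ (p≇q , pq≅3 , symbol))) =
    noQuartics₂ (p≇q ∘ ≡%⇒≅ {p} {q}) (≅⇒≡% {p * q} {3} pq≅3) (legendre≡-1 {+ p} {q} symbol)
  noQuartics (inj₂ (inj₂ (inj₁ (_ , _ , symbol , q≅3 , offset)))) =
    noQuartics₃ (legendre≡1 {+ p} {q} symbol) (≅⇒≡% {q} {3} q≅3)
        (map (difference-≡% {p} {q} {8}) (difference-≡% {p} {q} {12}) offset)
  noQuartics (inj₂ (inj₂ (inj₂ (_ , _ , symbol , p≅3 , offset)))) =
    noQuartics₄ (legendre≡-1 {+ p} {q} symbol) (≅⇒≡% {p} {3} p≅3)
        (map (difference-≡% {q} {p} {8}) (difference-≡% {q} {p} {12}) offset)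
  open RationalPoints pp qp p≢q 2∤p 2∤q (noQuartics conditions)
  open GaussianPoints (ι (ℤ.- + (p * q))) rational-point -pq-nonsquare
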